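{- There exists an absolute constant $c>0$ with the following property. Let $p$ be a prime and let $A,B\subseteq \mathbb{Z}/p\mathbb{Z}$ satisfy $1<|A|<p/2$, $B\cap(-B)=\varnothing$, and $|B|<\min\{c|A|/\ln|A|,\sqrt{p/8}\}$. Then $\mu_A(B)\ge |B|$.
   Context: $\mathbb{Z}/p\mathbb{Z}$ denotes the cyclic group of prime order $p$. For a finite subset $A$ and an element $b$ of an abelian group, $\Delta_A(b):=|(A+b)\setminus A|$, and for a finite subset $B$ of the group, $\mu_A(B):=\max_{b\in B}\Delta_A(b)$ (with the convention that the maximum over the empty set is $0$). Here $-B=\{ -b: b\in B\}$ and $\ln$ is the natural logarithm. -}

module Defs where

open import Data.Nat using (ℕ; _+_; _∸_; _⊔_; NonZero)
open import Data.Nat.DivMod using (_mod_)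
open import Data.Fin using (Fin; toℕ)
open import Data.Fin.Subset using (Subset; _─_; ∣_∣)
open import Data.Vec using (lookup; tabulate)
open import Data.List using (foldr; map; allFin)
open import Data.Bool using (if_then_else_)

-- ℤ/pℤ is represented by Fin p (residues 0 … p-1).

_⊕_ : ∀ {p} .{{_ : NonZero p}} → Fin p → Fin p → Fin p
_⊕_ {p} x y = (toℕ x + toℕ y) mod p

⊖_ : ∀ {p} .{{_ : NonZero p}} → Fin p → Fin p
⊖_ {p} x = (p ∸ toℕ x) mod p

-- A + b = { a + b : a ∈ A } = { x : x + (-b) ∈ A }
_+ₛ_ : ∀ {p} .{{_ : NonZero p}} → Subset p → Fin p → Subset p
A +ₛ b = tabulate (λ x → lookup A (x ⊕ (⊖ b)))

-- -B = { -b : b ∈ B } = { x : -x ∈ B }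
negₛ : ∀ {p} .{{_ : NonZero p}} → Subset p → Subset p
negₛ B = tabulate (λ x → lookup B (⊖ x))

Δ : ∀ {p} .{{_ : NonZero p}} → Subset p → Fin p → ℕ
Δ A b = ∣ (A +ₛ b) ─ A ∣

-- μ_A(B) = max_{b ∈ B} Δ_A(b), with max over ∅ equal to 0
μ : ∀ {p} .{{_ : NonZero p}} → Subset p → Subset p → ℕ
μ {p} A B = foldr _⊔_ 0 (map (λ b → if lookup B b then Δ A b else 0) (allFin p))

{-# OPTIONS --safe #-}

-- Write f(x) = |(A + x) \ A|, k = |B|, and suppose f < k on B. By subadditivity and Cauchy–Davenport the
-- level sets D T = {f ≤ Tk} grow linearly in T. Hence there are b and a set Γ, closed under addition up to
-- bounded multiples of b, such that Z/p is almost partitioned into the columns γ + [0,Y)b, γ ∈ Γ, and each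
-- j ∈ D 1 moves the columns among themselves, the column of γ being displaced by e(γ) steps.
-- Summing over Γ, |Γ| j = (Σ e) b, so the integers |Σ e(γ)| are distinct and positive for j ∈ B and some
-- of them are at least k. If A contained a whole layer of the columns and missed another one, the flux of A
-- across the first layer would give f(j) ≥ |Σ e(γ)|, a contradiction. In general log|A| layers are inspected:
-- by dyadic pigeonhole many of them have about v exceptional points, which costs O(v) in the flux bound, while
-- the exceptional points between those layers contribute more than that to f(j) for some j ∈ B with
-- |Σ e(γ)| ≥ k − O(v).

module Submission where

open import Defs
open import Data.Nat using (ℕ; _+_; _*_; _^_; _<_; _≤_; NonZero)
open import Data.Nat.Primality using (Prime)
open import Data.Fin.Subset using (Subset; _∩_; ∣_∣; Empty)
open import Data.Product using (Σ; _×_)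
open import Algebra.Bundles using (AbelianGroup)
open import Algebra.Structures using (IsAbelianGroup)
import Algebra.Properties.CommutativeMonoid.Mult as CommMult
import Algebra.Properties.Group as GroupProperties
import Algebra.Properties.Monoid.Mult as Mult
import Algebra.Solver.CommutativeMonoid as ACSolver
open import Data.Bool using (Bool; true; false; if_then_else_)
open import Data.Bool.Properties using () renaming (_≟_ to _≟ᵇ_)
open import Data.Empty using (⊥; ⊥-elim)
open import Data.Fin using (Fin; toℕ; zero; suc)
open import Data.Fin.Properties using (toℕ-injective; toℕ-fromℕ<; toℕ<n) renaming (_≟_ to _≟ᶠ_)
open import Data.Fin.Subset using (_─_)
open import Data.Fin.Subset.Properties using (x∈p∩q⁺)
open import Data.List using (List; []; _∷_; _++_; length; filter; map; foldr; upTo; applyUpTo; cartesianProduct; allFin; tabulate)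
open import Data.List.Membership.Propositional using (_∈_)
open import Data.List.Membership.Propositional.Properties using (∈-∃++; ∈-++⁺ˡ; ∈-++⁺ʳ; ∈-++⁻; ∈-filter⁺; ∈-filter⁻; ∈-map⁻; ∈-upTo⁺; ∈-upTo⁻; ∈-allFin) renaming (∈-cartesianProduct⁺ to ∈-⊗⁺; ∈-cartesianProduct⁻ to ∈-⊗⁻)
open import Data.List.Properties using (length-++; length-map; length-upTo; length-tabulate; length-filter; filter-accept; filter-reject; filter-++)
import Data.List.Relation.Binary.Permutation.Propositional as Perm
open import Data.List.Relation.Binary.Permutation.Propositional using (_↭_; ↭-refl; ↭-sym; ↭-trans; prep)
open import Data.List.Relation.Binary.Permutation.Propositional.Properties using () renaming (shift to ↭-shift)
import Data.List.Relation.Unary.All as All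
open import Data.List.Relation.Unary.All using () renaming ([] to []ᴬ; _∷_ to _∷ᴬ_)
open import Data.List.Relation.Unary.AllPairs using () renaming ([] to []ᴾ; _∷_ to _∷ᴾ_)
open import Data.List.Relation.Unary.Any using (here; there)
open import Data.List.Relation.Unary.Unique.Propositional using (Unique)
import Data.List.Relation.Unary.Unique.Propositional.Properties as Uniq
open import Data.Nat using (zero; suc; _∸_; _⊔_; z≤n; s≤s; s≤s⁻¹; _≤?_; _<?_; >-nonZero; ≢-nonZero⁻¹)
open import Data.Nat.Divisibility using (_∣_; m%n≡0⇒n∣m; ∣⇒≤)
open import Data.Nat.DivMod using (_/_; _%_; _mod_; m/n*n≤m; m≡m%n+[m/n]*n; m%n<n; m≥n⇒m/n>0; %-distribˡ-+; m%n%n≡m%n; n%n≡0; m<n⇒m%n≡m)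
open import Data.Nat.Primality using (euclidsLemma)
open import Data.Nat.Properties
open import Data.Nat.Tactic.RingSolver using (solve; solve-∀)
open import Data.Product using (_,_; proj₁; proj₂)
open import Data.Sum using (_⊎_; inj₁; inj₂)
import Data.Vec as Vec
open import Data.Vec using (lookup)
open import Data.Vec.Properties using (lookup∘tabulate; lookup⇒[]=)
open import Relation.Binary.Definitions using (DecidableEquality; tri<; tri≈; tri>)
open import Relation.Binary.PropositionalEquality using (_≡_; _≢_; refl; sym; trans; cong; cong₂; subst; subst₂; isEquivalence; module ≡-Reasoning)
open import Relation.Nullary using (¬_; Dec; yes; no)
open import Relation.Nullary.Decidable using (_×-dec_; _⊎-dec_; ¬?; map′)

-- A set `Γ` of the required kind exists because the number of clusters of `D T` is at most 9(M +
-- 1)k for every admissible T, while there are more than k of them for T = 1. Along the scales T =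
-- 8^t the number must therefore fail to double at some point, and there no translate of `Γ` by an
-- element of `D (7 * T)` can avoid the columns of `Γ`. The two zones of layers come from averages.
-- A base point in `A` is chosen such that the columns started there stay in `A` for a while, and a
-- cell outside `A` such that they stay outside; such cells are plentiful because the columns fill
-- nearly the whole group and 2|A| < p. Both averages cost a constant times k times the length of a
-- zone, and this length is proportional to the number of dyadic classes: that is the source of the
-- logarithm. The deficit O(v) is recovered because the exceptional points of one band form a set
-- that obeys the same level set bound as `A`. Only O(v) shifts nearly preserve it, whereas more
-- than 144v elements of `B` have a nearly maximal displacement, so one of them disturbs half of the
-- bands.

-- Counting in finite sets

-- Linear arithmetic by certificate: the identity is left to the ring solver.
linear : ∀ {a b c d} s → c ≤ d → a + d + s ≡ b + c → a ≤ b
linear {a} {b} {c} {d} s c≤d eq = +-cancelʳ-≤ c a b (begin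
  a + c  ≤⟨ +-monoʳ-≤ a c≤d ⟩
  a + d  ≤⟨ m≤m+n (a + d) s ⟩
  a + d + s  ≡⟨ eq ⟩
  b + c  ∎)
  where open ≤-Reasoning

infixl 6 _⊹_
_⊹_ : ∀ {a b c d} → a ≤ b → c ≤ d → a + c ≤ b + d
_⊹_ = +-mono-≤

infixr 7 _⊛_
_⊛_ : ∀ c {a b} → a ≤ b → c * a ≤ c * b
c ⊛ p = *-monoʳ-≤ c p

-- The decision procedure determines the predicate, so a subset is written as `⟪ d ⟫` and its
-- cardinality along a list is the length of a filtered list.
record Sub (A : Set) : Set₁ where
  constructor ⟪_⟫
  field
    {mem} : A → Set
    dec   : ∀ x → Dec (mem x)

open Sub public using (dec)

infix 4 _∋_
_∋_ : {A : Set} → Sub A → A → Set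
X ∋ x = Sub.mem X x

module _ {A : Set} where

  infixr 7 _⋂_
  infixr 6 _⋃_
  _⋂_ _⋃_ : Sub A → Sub A → Sub A
  X ⋂ Y = ⟪ (λ x → dec X x ×-dec dec Y x) ⟫
  X ⋃ Y = ⟪ (λ x → dec X x ⊎-dec dec Y x) ⟫

  ∁ : Sub A → Sub A
  ∁ X = ⟪ (λ x → ¬? (dec X x)) ⟫

  els : List A → Sub A → List A
  els xs X = filter (dec X) xs

  card : List A → Sub A → ℕ
  card xs X = length (els xs X)

  els-unique : ∀ {xs} X → Unique xs → Unique (els xs X)
  els-unique X = Uniq.filter⁺ (dec X)

  ∈-els : ∀ {xs} X {x} → x ∈ xs → X ∋ x → x ∈ els xs X
  ∈-els X = ∈-filter⁺ (dec X)

  els-∈ : ∀ xs X {x} → x ∈ els xs X → x ∈ xs × X ∋ x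
  els-∈ xs X = ∈-filter⁻ (dec X)

  some-or-none : ∀ xs (X : Sub A) → (Σ A λ x → x ∈ xs × X ∋ x) ⊎ (∀ x → x ∈ xs → ¬ (X ∋ x))
  some-or-none []       X = inj₂ λ _ ()
  some-or-none (x ∷ xs) X with dec X x | some-or-none xs X
  ... | yes q | _                  = inj₁ (x , here refl , q)
  ... | no _  | inj₁ (y , y∈ , q)  = inj₁ (y , there y∈ , q)
  ... | no ¬q | inj₂ none          = inj₂ λ { _ (here refl) → ¬q ; y (there y∈) → none y y∈ }

  ∃? : ∀ xs (X : Sub A) → Dec (Σ A λ x → x ∈ xs × X ∋ x)
  ∃? xs X with some-or-none xs X
  ... | inj₁ q = yes q
  ... | inj₂ ¬q = no λ { (x , x∈ , q) → ¬q x x∈ q }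

∃<? : ∀ n {P : ℕ → Set} → (∀ i → Dec (P i)) → Dec (Σ ℕ λ i → i < n × P i)
∃<? n P? = map′ (λ { (i , i∈ , q) → i , ∈-upTo⁻ i∈ , q }) (λ { (i , i< , q) → i , ∈-upTo⁺ i< , q }) (∃? (upTo n) ⟪ P? ⟫)

module _ {A B : Set} where

  -- Each element of `xs` removes its partner from `ys`, and injectivity keeps the partners of the
  -- others. A relation takes the place of a map because partners mostly come out of existence
  -- proofs.
  length-inj : (R : A → B → Set) → (∀ {x x′ y} → R x y → R x′ y → x ≡ x′) →
    ∀ {xs} ys → Unique xs → (∀ {x} → x ∈ xs → Σ B λ y → y ∈ ys × R x y) →
    length xs ≤ length ys
  length-inj R inj {[]}     ys _        _ = z≤n
  length-inj R inj {x ∷ xs} ys (x∉ ∷ᴾ u) r with r (here refl)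
  ... | y , y∈ , Rxy with ∈-∃++ y∈
  ... | as , bs , refl = begin
      suc (length xs)  ≤⟨ s≤s (length-inj R inj (as ++ bs) u r′) ⟩
      suc (length (as ++ bs))  ≡⟨ cong suc (length-++ as) ⟩
      suc (length as + length bs)  ≡⟨ sym (+-suc (length as) (length bs)) ⟩
      length as + suc (length bs)  ≡⟨ sym (length-++ as) ⟩
      length (as ++ y ∷ bs)  ∎
    where
    open ≤-Reasoning
    r′ : ∀ {z} → z ∈ xs → Σ B λ w → w ∈ as ++ bs × R z w
    r′ {z} z∈ with r (there z∈)
    ... | w , w∈ , Rzw with ∈-++⁻ as w∈
    ... | inj₁ q           = w , ∈-++⁺ˡ q , Rzw
    ... | inj₂ (there q)   = w , ∈-++⁺ʳ as q , Rzw
    ... | inj₂ (here refl) = ⊥-elim (All.lookup x∉ z∈ (inj Rxy Rzw))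

  card-inj : ∀ {xs ys} (X : Sub A) (Y : Sub B) → Unique xs → (R : A → B → Set) →
    (∀ x → x ∈ xs → X ∋ x → Σ B λ y → y ∈ ys × Y ∋ y × R x y) →
    (∀ x x′ y → X ∋ x → X ∋ x′ → R x y → R x′ y → x ≡ x′) →
    card xs X ≤ card ys Y
  card-inj {xs} {ys} X Y u R tot inj =
    length-inj (λ x y → X ∋ x × R x y) (λ { (q , r) (q′ , r′) → inj _ _ _ q q′ r r′ }) (els ys Y) (els-unique X u) go
    where
    go : ∀ {x} → x ∈ els xs X → Σ B λ y → y ∈ els ys Y × X ∋ x × R x y
    go {x} x∈ with els-∈ xs X x∈
    ... | x∈xs , Xx with tot x x∈xs Xx
    ... | y , y∈ , Yy , r = y , ∈-els Y y∈ Yy , Xx , r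

⟦_⟧ : {P : Set} → Dec P → ℕ
⟦ yes _ ⟧ = 1
⟦ no _ ⟧  = 0

∑ : {A : Set} → List A → (A → ℕ) → ℕ
∑ []       f = 0
∑ (x ∷ xs) f = f x + ∑ xs f

module _ {A : Set} where

  card-∷-yes : ∀ {x} xs (X : Sub A) → X ∋ x → card (x ∷ xs) X ≡ suc (card xs X)
  card-∷-yes xs X q = cong length (filter-accept (dec X) q)

  card-∷-no : ∀ {x} xs (X : Sub A) → ¬ (X ∋ x) → card (x ∷ xs) X ≡ card xs X
  card-∷-no xs X q = cong length (filter-reject (dec X) q)

  card-∑ : ∀ xs (X : Sub A) → card xs X ≡ ∑ xs (λ x → ⟦ dec X x ⟧)
  card-∑ []       X = refl
  card-∑ (x ∷ xs) X with dec X x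
  ... | yes _ = cong suc (card-∑ xs X)
  ... | no _  = card-∑ xs X

  ∑-cong : ∀ xs {f g : A → ℕ} → (∀ x → x ∈ xs → f x ≡ g x) → ∑ xs f ≡ ∑ xs g
  ∑-cong []       e = refl
  ∑-cong (x ∷ xs) e = cong₂ _+_ (e x (here refl)) (∑-cong xs λ y y∈ → e y (there y∈))

  ∑-mono : ∀ xs {f g : A → ℕ} → (∀ x → x ∈ xs → f x ≤ g x) → ∑ xs f ≤ ∑ xs g
  ∑-mono []       e = z≤n
  ∑-mono (x ∷ xs) e = e x (here refl) ⊹ ∑-mono xs λ y y∈ → e y (there y∈)

  ∑-+ : ∀ xs (f g : A → ℕ) → ∑ xs (λ x → f x + g x) ≡ ∑ xs f + ∑ xs g
  ∑-+ []       f g = refl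
  ∑-+ (x ∷ xs) f g = trans (cong (f x + g x +_) (∑-+ xs f g)) (shuffle (f x) (g x) (∑ xs f) (∑ xs g))
    where
    shuffle : ∀ a b c d → a + b + (c + d) ≡ a + c + (b + d)
    shuffle = solve-∀

  ∑-const : ∀ xs c → ∑ xs (λ (_ : A) → c) ≡ length xs * c
  ∑-const []       c = refl
  ∑-const (x ∷ xs) c = cong (c +_) (∑-const xs c)

  ∑-* : ∀ xs c (f : A → ℕ) → ∑ xs (λ x → c * f x) ≡ c * ∑ xs f
  ∑-* []       c f = sym (*-zeroʳ c)
  ∑-* (x ∷ xs) c f = trans (cong (c * f x +_) (∑-* xs c f)) (sym (*-distribˡ-+ c (f x) (∑ xs f)))

  ∑-≤ : ∀ xs (f : A → ℕ) c → (∀ x → x ∈ xs → f x ≤ c) → ∑ xs f ≤ length xs * c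
  ∑-≤ xs f c h = ≤-trans (∑-mono xs h) (≤-reflexive (∑-const xs c))

  ∑-≥ : ∀ xs (f : A → ℕ) c → (∀ x → x ∈ xs → c ≤ f x) → length xs * c ≤ ∑ xs f
  ∑-≥ xs f c h = ≤-trans (≤-reflexive (sym (∑-const xs c))) (∑-mono xs h)

  card≤length : ∀ xs (X : Sub A) → card xs X ≤ length xs
  card≤length xs X = length-filter (dec X) xs

  card-mono : ∀ xs (X Y : Sub A) → (∀ x → x ∈ xs → X ∋ x → Y ∋ x) → card xs X ≤ card xs Y
  card-mono []       X Y h = z≤n
  card-mono (x ∷ xs) X Y h with dec X x
  ... | no _  = ≤-trans (card-mono xs X Y λ y y∈ → h y (there y∈)) (subset-∷ (dec Y x))
    where
    subset-∷ : Dec (Y ∋ x) → card xs Y ≤ card (x ∷ xs) Y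
    subset-∷ (yes q) = ≤-trans (n≤1+n _) (≤-reflexive (sym (card-∷-yes xs Y q)))
    subset-∷ (no q)  = ≤-reflexive (sym (card-∷-no xs Y q))
  ... | yes q = ≤-trans (s≤s (card-mono xs X Y λ y y∈ → h y (there y∈))) (≤-reflexive (sym (card-∷-yes xs Y (h x (here refl) q))))

  card-cover : ∀ xs (X Z W : Sub A) → (∀ x → x ∈ xs → X ∋ x → (Z ∋ x) ⊎ (W ∋ x)) → card xs X ≤ card xs Z + card xs W
  card-cover xs X Z W h = begin
    card xs X  ≡⟨ card-∑ xs X ⟩
    ∑ xs (λ x → ⟦ dec X x ⟧)  ≤⟨ ∑-mono xs pointwise ⟩
    ∑ xs (λ x → ⟦ dec Z x ⟧ + ⟦ dec W x ⟧)  ≡⟨ ∑-+ xs _ _ ⟩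
    ∑ xs (λ x → ⟦ dec Z x ⟧) + ∑ xs (λ x → ⟦ dec W x ⟧)  ≡⟨ cong₂ _+_ (sym (card-∑ xs Z)) (sym (card-∑ xs W)) ⟩
    card xs Z + card xs W  ∎
    where
    open ≤-Reasoning
    pointwise : ∀ x → x ∈ xs → ⟦ dec X x ⟧ ≤ ⟦ dec Z x ⟧ + ⟦ dec W x ⟧
    pointwise x x∈ with dec X x | dec Z x | dec W x
    ... | no _  | _     | _     = z≤n
    ... | yes q | yes _ | _     = s≤s z≤n
    ... | yes q | no _  | yes _ = s≤s z≤n
    ... | yes q | no z  | no w with h x x∈ q
    ... | inj₁ z′ = ⊥-elim (z z′)
    ... | inj₂ w′ = ⊥-elim (w w′)

  card-split : ∀ xs (X Y : Sub A) → card xs X ≤ card xs (X ⋂ Y) + card xs (X ⋂ ∁ Y)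
  card-split xs X Y = card-cover xs X (X ⋂ Y) (X ⋂ ∁ Y) λ x _ → decide x
    where
    decide : ∀ x → X ∋ x → (X ⋂ Y ∋ x) ⊎ (X ⋂ ∁ Y ∋ x)
    decide x q with dec Y x
    ... | yes r = inj₁ (q , r)
    ... | no r  = inj₂ (q , r)

  card-∁ : ∀ xs (X : Sub A) → length xs ≤ card xs X + card xs (∁ X)
  card-∁ []       X = z≤n
  card-∁ (x ∷ xs) X with dec X x
  ... | yes _ = s≤s (card-∁ xs X)
  ... | no _  = ≤-trans (s≤s (card-∁ xs X)) (≤-reflexive (sym (+-suc _ _)))

  card-disjoint : ∀ xs (X Z W : Sub A) → (∀ x → x ∈ xs → Z ∋ x → X ∋ x) → (∀ x → x ∈ xs → W ∋ x → X ∋ x) →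
    (∀ x → x ∈ xs → Z ∋ x → ¬ (W ∋ x)) → card xs Z + card xs W ≤ card xs X
  card-disjoint xs X Z W hz hw d = begin
    card xs Z + card xs W  ≡⟨ cong₂ _+_ (card-∑ xs Z) (card-∑ xs W) ⟩
    ∑ xs (λ x → ⟦ dec Z x ⟧) + ∑ xs (λ x → ⟦ dec W x ⟧)  ≡⟨ sym (∑-+ xs _ _) ⟩
    ∑ xs (λ x → ⟦ dec Z x ⟧ + ⟦ dec W x ⟧)  ≤⟨ ∑-mono xs pointwise ⟩
    ∑ xs (λ x → ⟦ dec X x ⟧)  ≡⟨ sym (card-∑ xs X) ⟩
    card xs X  ∎
    where
    open ≤-Reasoning
    pointwise : ∀ x → x ∈ xs → ⟦ dec Z x ⟧ + ⟦ dec W x ⟧ ≤ ⟦ dec X x ⟧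
    pointwise x x∈ with dec Z x | dec W x | dec X x
    ... | no _  | no _  | _     = z≤n
    ... | yes z | yes w | _     = ⊥-elim (d x x∈ z w)
    ... | yes _ | no _  | yes _ = s≤s z≤n
    ... | no _  | yes _ | yes _ = s≤s z≤n
    ... | yes z | no _  | no q  = ⊥-elim (q (hz x x∈ z))
    ... | no _  | yes w | no q  = ⊥-elim (q (hw x x∈ w))

  least : (f : A → ℕ) → ∀ ys → 0 < length ys → Σ A λ x → x ∈ ys × (∀ y → y ∈ ys → f x ≤ f y)
  least f (y ∷ [])          _ = y , here refl , λ { _ (here refl) → ≤-refl }
  least f (y ∷ ys@(_ ∷ _))  _ with least f ys (s≤s z≤n)
  ... | x , x∈ , h with ≤-total (f x) (f y)
  ... | inj₁ x≤y = x , there x∈ , λ { _ (here refl) → x≤y ; z (there z∈) → h z z∈ }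
  ... | inj₂ y≤x = y , here refl , λ { _ (here refl) → ≤-refl ; z (there z∈) → ≤-trans y≤x (h z z∈) }

  average : ∀ xs (f : A → ℕ) → 0 < length xs → Σ A λ x → x ∈ xs × length xs * f x ≤ ∑ xs f
  average xs f 0< with least f xs 0<
  ... | x , x∈ , h = x , x∈ , ∑-≥ xs f (f x) h

  -- Deleting the head of `ys` from both lists preserves the inclusion and the inequality of
  -- lengths. This later turns an injective self-map of a finite set into a permutation.
  sublist-↭ : {ys : List A} (xs : List A) → Unique ys → (∀ {y} → y ∈ ys → y ∈ xs) → length xs ≤ length ys → ys ↭ xs
  sublist-↭ {[]} []       _ _ _ = ↭-refl
  sublist-↭ {y ∷ ys} xs (y∉ ∷ᴾ u) sub len with ∈-∃++ (sub (here refl))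
  ... | as , bs , refl = ↭-trans (prep y (sublist-↭ (as ++ bs) u sub′ len′)) (↭-sym (↭-shift y as bs))
    where
    sub′ : ∀ {z} → z ∈ ys → z ∈ as ++ bs
    sub′ {z} z∈ with ∈-++⁻ as (sub (there z∈))
    ... | inj₁ q           = ∈-++⁺ˡ q
    ... | inj₂ (there q)   = ∈-++⁺ʳ as q
    ... | inj₂ (here refl) = ⊥-elim (All.lookup y∉ z∈ refl)
    len′ : length (as ++ bs) ≤ length ys
    len′ = s≤s⁻¹ (begin
      suc (length (as ++ bs))  ≡⟨ cong suc (length-++ as) ⟩
      suc (length as + length bs)  ≡⟨ sym (+-suc (length as) (length bs)) ⟩
      length as + suc (length bs)  ≡⟨ sym (length-++ as) ⟩
      length (as ++ y ∷ bs)  ≤⟨ len ⟩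
      suc (length ys)  ∎)
      where open ≤-Reasoning

module _ {A B : Set} where

  ∑-swap : ∀ xs ys (f : A → B → ℕ) → ∑ xs (λ x → ∑ ys (f x)) ≡ ∑ ys (λ y → ∑ xs (λ x → f x y))
  ∑-swap []       ys f = sym (trans (∑-const ys 0) (*-zeroʳ (length ys)))
  ∑-swap (x ∷ xs) ys f = trans (cong (∑ ys (f x) +_) (∑-swap xs ys f)) (sym (∑-+ ys (f x) _))

  ∑-card-swap : ∀ xs ys {P : A → B → Set} (P? : ∀ x y → Dec (P x y)) →
    ∑ xs (λ x → card ys ⟪ P? x ⟫) ≡ ∑ ys (λ y → card xs ⟪ (λ x → P? x y) ⟫)
  ∑-card-swap xs ys P? = begin
    ∑ xs (λ x → card ys ⟪ P? x ⟫)  ≡⟨ ∑-cong xs (λ x _ → card-∑ ys ⟪ P? x ⟫) ⟩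
    ∑ xs (λ x → ∑ ys (λ y → ⟦ P? x y ⟧))  ≡⟨ ∑-swap xs ys _ ⟩
    ∑ ys (λ y → ∑ xs (λ x → ⟦ P? x y ⟧))  ≡⟨ ∑-cong ys (λ y _ → sym (card-∑ xs ⟪ (λ x → P? x y) ⟫)) ⟩
    ∑ ys (λ y → card xs ⟪ (λ x → P? x y) ⟫)  ∎
    where open ≡-Reasoning

  card-++ : ∀ xs ys (X : Sub A) → card (xs ++ ys) X ≡ card xs X + card ys X
  card-++ xs ys X = trans (cong length (filter-++ (dec X) xs ys)) (length-++ (els xs X))

  card-map : ∀ (g : A → B) xs (X : Sub B) → card (map g xs) X ≡ card xs ⟪ (λ x → dec X (g x)) ⟫
  card-map g []       X = refl
  card-map g (x ∷ xs) X with dec X (g x)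
  ... | yes _ = cong suc (card-map g xs X)
  ... | no _  = card-map g xs X

  infixr 5 _⊗_
  _⊗_ : List A → List B → List (A × B)
  _⊗_ = cartesianProduct

∑-card-⊗ : {A B : Set} → ∀ (xs : List A) (ys : List B) (X : Sub (A × B)) →
  card (xs ⊗ ys) X ≡ ∑ xs (λ x → card ys ⟪ (λ y → dec X (x , y)) ⟫)
∑-card-⊗ []       ys X = refl
∑-card-⊗ {A} {B} (x ∷ xs) ys X = trans (card-++ {B = B} (map (x ,_) ys) (xs ⊗ ys) X) (cong₂ _+_ (card-map (x ,_) ys X) (∑-card-⊗ xs ys X))

length-⊗ : {A B : Set} → ∀ (xs : List A) (ys : List B) → length (xs ⊗ ys) ≡ length xs * length ys
length-⊗ []       ys = refl
length-⊗ (x ∷ xs) ys = trans (length-++ (map (x ,_) ys)) (cong₂ _+_ (length-map (x ,_) ys) (length-⊗ xs ys))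

⊗-unique : {A B : Set} {xs : List A} {ys : List B} → Unique xs → Unique ys → Unique (xs ⊗ ys)
⊗-unique = Uniq.cartesianProduct⁺

-- Cauchy–Davenport and level sets

-- Primality of the order enters only through `torsion-free`; everything before the cyclic group
-- itself is proved from these fields.
record PrimeGroup : Set₁ where
  infixl 6 _⊞_
  field
    G              : Set
    _⊞_            : G → G → G
    𝟘              : G
    ⊟_             : G → G
    isAbelianGroup : IsAbelianGroup _≡_ _⊞_ 𝟘 ⊟_
    _≟ᴳ_           : DecidableEquality G
    U              : List G
    U-unique       : Unique U
    U-full         : ∀ x → x ∈ U

  abelianGroup : AbelianGroup _ _
  abelianGroup = record { isAbelianGroup = isAbelianGroup }

  open AbelianGroup abelianGroup public using (assoc; comm; identityˡ; identityʳ; inverseˡ; inverseʳ; monoid; group; commutativeMonoid)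
  open Mult monoid public using () renaming (_×_ to _·_; ×-homo-+ to ·-+; ×-assocˡ to ·-assoc)
  open CommMult commutativeMonoid public using () renaming (×-distrib-+ to ·-⊞)

  p : ℕ
  p = length U

  field
    torsion-free : ∀ i x → 0 < i → i < p → i · x ≡ 𝟘 → x ≡ 𝟘

module Groups (𝔾 : PrimeGroup) where

  open PrimeGroup 𝔾 public
  open GroupProperties group public using () renaming (∙-cancelʳ to cancelʳ)
  open ACSolver commutativeMonoid public using (_⊜_) renaming (_⊕_ to _∙_; solve to ac)

  ⌊_⌋ : Sub G → ℕ
  ⌊ X ⌋ = card U X

  infixl 6 _⊝_
  _⊝_ : G → G → G
  x ⊝ y = x ⊞ (⊟ y)

  ⊖-⊞ : ∀ x y → x ⊝ y ⊞ y ≡ x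
  ⊖-⊞ x y = trans (assoc x (⊟ y) y) (trans (cong (x ⊞_) (inverseˡ y)) (identityʳ x))

  ⊞-⊖ : ∀ x y → (x ⊞ y) ⊝ y ≡ x
  ⊞-⊖ x y = trans (assoc x y (⊟ y)) (trans (cong (x ⊞_) (inverseʳ y)) (identityʳ x))

  ⊞-swap : ∀ x y z → x ⊞ y ⊞ z ≡ x ⊞ z ⊞ y
  ⊞-swap = ac 3 (λ x y z → (x ∙ y) ∙ z ⊜ (x ∙ z) ∙ y) refl

  ⊖⇒≡ : ∀ {x y} → x ⊝ y ≡ 𝟘 → x ≡ y
  ⊖⇒≡ {x} {y} e = trans (sym (⊖-⊞ x y)) (trans (cong (_⊞ y) e) (identityˡ y))

  ·-⊟ : ∀ i x → i · (⊟ x) ⊞ i · x ≡ 𝟘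
  ·-⊟ i x = trans (sym (·-⊞ (⊟ x) x i)) (trans (cong (i ·_) (inverseˡ x)) (·-𝟘 i))
    where
    ·-𝟘 : ∀ i → i · 𝟘 ≡ 𝟘
    ·-𝟘 zero    = refl
    ·-𝟘 (suc i) = trans (identityˡ _) (·-𝟘 i)

  ·-injˡ-≤ : ∀ {x} i j → x ≢ 𝟘 → i ≤ j → j < p → i · x ≡ j · x → i ≡ j
  ·-injˡ-≤ {x} i j x≢ i≤j j<p e with j ∸ i in eq
  ... | zero  = ≤-antisym i≤j (m∸n≡0⇒m≤n eq)
  ... | suc c = ⊥-elim (x≢ (torsion-free (suc c) x (s≤s z≤n) c<p (cancelʳ (i · x) _ _ (begin
      suc c · x ⊞ i · x  ≡⟨ sym (·-+ x (suc c) i) ⟩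
      (suc c + i) · x  ≡⟨ cong (_· x) (trans (cong (_+ i) (sym eq)) (m∸n+n≡m i≤j)) ⟩
      j · x  ≡⟨ sym e ⟩
      i · x  ≡⟨ sym (identityˡ _) ⟩
      𝟘 ⊞ i · x  ∎))))
    where
    open ≡-Reasoning
    c<p : suc c < p
    c<p = ≤-<-trans (≤-trans (≤-reflexive (sym eq)) (m∸n≤m j i)) j<p

  ·-injˡ : ∀ {x} i j → x ≢ 𝟘 → i < p → j < p → i · x ≡ j · x → i ≡ j
  ·-injˡ i j x≢ i<p j<p e with ≤-total i j
  ... | inj₁ i≤j = ·-injˡ-≤ i j x≢ i≤j j<p e
  ... | inj₂ j≤i = sym (·-injˡ-≤ j i x≢ j≤i i<p (sym e))

  ·-injʳ : ∀ i {x y} → 0 < i → i < p → i · x ≡ i · y → x ≡ y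
  ·-injʳ i {x} {y} 0<i i<p e = ⊖⇒≡ (torsion-free i (x ⊝ y) 0<i i<p (begin
      i · (x ⊝ y)  ≡⟨ ·-⊞ x (⊟ y) i ⟩
      i · x ⊞ i · (⊟ y)  ≡⟨ cong (_⊞ i · (⊟ y)) e ⟩
      i · y ⊞ i · (⊟ y)  ≡⟨ comm _ _ ⟩
      i · (⊟ y) ⊞ i · y  ≡⟨ ·-⊟ i y ⟩
      𝟘  ∎))
    where open ≡-Reasoning

  translate : ∀ X Y e → (∀ x → X ∋ x → Y ∋ x ⊞ e) → ⌊ X ⌋ ≤ ⌊ Y ⌋
  translate X Y e h = card-inj X Y U-unique (λ x y → x ⊞ e ≡ y)
    (λ x _ Xx → x ⊞ e , U-full _ , h x Xx , refl) (λ x x′ y _ _ r r′ → cancelʳ e x x′ (trans r (sym r′)))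

  point : G → Sub G
  point y = ⟪ (λ x → x ≟ᴳ y) ⟫

  mono : ∀ X Y → (∀ x → X ∋ x → Y ∋ x) → ⌊ X ⌋ ≤ ⌊ Y ⌋
  mono X Y h = card-mono U X Y λ x _ → h x

  nonempty : ∀ X x → X ∋ x → 1 ≤ ⌊ X ⌋
  nonempty X x q = length-inj {A = G} (λ y z → y ≡ z) (λ { refl refl → refl }) {xs = x ∷ []} (els U X)
    ([]ᴬ ∷ᴾ []ᴾ) λ { (here refl) → x , ∈-els X (U-full x) q , refl }

  strict : ∀ X Y y → (∀ x → X ∋ x → Y ∋ x) → Y ∋ y → ¬ (X ∋ y) → ⌊ X ⌋ < ⌊ Y ⌋
  strict X Y y h Yy ¬Xy = ≤-trans (≤-trans (≤-reflexive (+-comm 1 ⌊ X ⌋)) (+-monoʳ-≤ ⌊ X ⌋ (nonempty (point y) y refl)))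
    (card-disjoint U Y X (point y) (λ x _ → h x) (λ { x _ refl → Yy }) λ { x _ Xx refl → ¬Xy Xx })

  everything : ∀ X → p ≤ ⌊ X ⌋ → ∀ x → X ∋ x
  everything X p≤ x with dec X x
  ... | yes q = q
  ... | no ¬q = ⊥-elim (<⇒≱ (strict X (X ⋃ point x) x (λ _ → inj₁) (inj₂ refl) ¬q) (≤-trans (card≤length U (X ⋃ point x)) p≤))

  whole : ∀ X → (∀ x → X ∋ x) → p ≤ ⌊ X ⌋
  whole X all = length-inj {A = G} (λ x y → x ≡ y) (λ { refl refl → refl }) (els U X) U-unique λ {x} x∈ → x , ∈-els X x∈ (all x) , refl

  -- The points x + i·d with i < p are distinct and all lie in `X`: there is no proper nontrivial
  -- subgroup to get stuck in.
  closed⇒everything : ∀ X x d → X ∋ x → d ≢ 𝟘 → (∀ y → X ∋ y → X ∋ y ⊞ d) → ∀ y → X ∋ y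
  closed⇒everything X x d Xx d≢ cl = everything X (≤-trans (≤-reflexive (sym (length-upTo p)))
      (length-inj (λ i y → i < p × x ⊞ i · d ≡ y) inj (els U X) (Uniq.upTo⁺ p)
        λ {i} i∈ → x ⊞ i · d , ∈-els X (U-full _) (orbit i) , ∈-upTo⁻ i∈ , refl))
    where
    orbit : ∀ i → X ∋ x ⊞ i · d
    orbit zero    = subst (X ∋_) (sym (identityʳ x)) Xx
    orbit (suc i) = subst (X ∋_) (trans (assoc x (i · d) d) (cong (x ⊞_) (comm (i · d) d))) (cl _ (orbit i))
    inj : ∀ {i j y} → i < p × x ⊞ i · d ≡ y → j < p × x ⊞ j · d ≡ y → i ≡ j
    inj {i} {j} (i< , e) (j< , e′) = ·-injˡ i j d≢ i< j< (cancelʳ x _ _ (trans (comm _ x) (trans e (trans (sym e′) (comm x _)))))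

  CauchyDavenport : Sub G → Sub G → Sub G → Set
  CauchyDavenport X Y Z = (p ≤ ⌊ Z ⌋) ⊎ (⌊ X ⌋ + ⌊ Y ⌋ ≤ suc ⌊ Z ⌋)

  -- Induction on |Y| by the Dyson e-transform.
  cauchy-davenport-≤ : ∀ m X Y Z → ⌊ Y ⌋ ≤ m → ∀ x₀ y₀ → X ∋ x₀ → Y ∋ y₀ →
    (∀ x y → X ∋ x → Y ∋ y → Z ∋ x ⊞ y) → CauchyDavenport X Y Z
  cauchy-davenport-≤ zero X Y Z Y≤ x₀ y₀ X∋ Y∋ sum = ⊥-elim (<⇒≱ (nonempty Y y₀ Y∋) Y≤)
  cauchy-davenport-≤ (suc m) X Y Z Y≤ x₀ y₀ X∋ Y∋ sum with some-or-none U (Y ⋂ ∁ (point y₀))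
  ... | inj₂ none = inj₂ (≤-trans (+-mono-≤ (translate X Z y₀ λ x q → sum x y₀ q Y∋) |Y|≤1) (≤-reflexive (+-comm _ 1)))
    where
    |Y|≤1 : ⌊ Y ⌋ ≤ 1
    |Y|≤1 = length-inj {B = G} (λ x y → x ≡ y₀) (λ { refl refl → refl }) (y₀ ∷ []) (els-unique Y U-unique) go
      where
      go : ∀ {x} → x ∈ els U Y → Σ G λ y → y ∈ y₀ ∷ [] × x ≡ y₀
      go {x} x∈ with x ≟ᴳ y₀
      ... | yes e = y₀ , here refl , e
      ... | no ne = ⊥-elim (none x (U-full x) (proj₂ (els-∈ U Y x∈) , ne))
  ... | inj₁ (y₁ , _ , Yy₁ , y₁≢y₀) with some-or-none U (X ⋂ ⟪ (λ x → ¬? (dec X (x ⊞ (y₁ ⊝ y₀)))) ⟫)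
  ... | inj₂ none = inj₁ (whole Z λ z → subst (Z ∋_) (⊖-⊞ z y₀) (sum (z ⊝ y₀) y₀ (X-all (z ⊝ y₀)) Y∋))
    where
    step : ∀ y → X ∋ y → X ∋ y ⊞ (y₁ ⊝ y₀)
    step y q with dec X (y ⊞ (y₁ ⊝ y₀))
    ... | yes r = r
    ... | no r  = ⊥-elim (none y (U-full y) (q , r))
    X-all : ∀ z → X ∋ z
    X-all = closed⇒everything X x₀ (y₁ ⊝ y₀) X∋ (λ e → y₁≢y₀ (⊖⇒≡ e)) step
  ... | inj₁ (x , _ , Xx , x∉) = conclude (cauchy-davenport-≤ m X′ Y′ Z |Y′|≤m x₀ y₀ (inj₁ X∋) (Y∋ , y₀∈) sum′)
    where
    -- With this shift `y₀` survives in `Y′`, as y₀ + e = x lies in `X`, but `y₁` drops out, so that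
    -- `Y′` is nonempty and smaller than `Y`.
    e : G
    e = x ⊝ y₀
    Yᵉ X′ Y′ : Sub G
    Yᵉ = ⟪ (λ z → dec Y (z ⊝ e)) ⟫
    X′ = X ⋃ Yᵉ
    Y′ = Y ⋂ ⟪ (λ y → dec X (y ⊞ e)) ⟫
    y₀∈ : X ∋ y₀ ⊞ e
    y₀∈ = subst (X ∋_) (sym (trans (comm y₀ e) (⊖-⊞ x y₀))) Xx
    y₁∉ : ¬ (X ∋ y₁ ⊞ e)
    y₁∉ q = x∉ (subst (X ∋_) (ac 3 (λ a b c → a ∙ (b ∙ c) ⊜ b ∙ (a ∙ c)) refl y₁ x (⊟ y₀)) q)
    |Y′|≤m : ⌊ Y′ ⌋ ≤ m
    |Y′|≤m = s≤s⁻¹ (≤-trans (strict Y′ Y y₁ (λ _ → proj₁) Yy₁ λ q → y₁∉ (proj₂ q)) Y≤)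
    sum′ : ∀ a b → X′ ∋ a → Y′ ∋ b → Z ∋ a ⊞ b
    sum′ a b (inj₁ Xa) (Yb , _)   = sum a b Xa Yb
    sum′ a b (inj₂ Ya) (_ , Xb) = subst (Z ∋_) (trans (ac 3 (λ b e a → (b ∙ e) ∙ a ⊜ (a ∙ e) ∙ b) refl b e (a ⊝ e)) (cong (_⊞ b) (⊖-⊞ a e))) (sum (b ⊞ e) (a ⊝ e) Xb Ya)
    gain : ⌊ X ⌋ + ⌊ Y ⌋ ≤ ⌊ X′ ⌋ + ⌊ Y′ ⌋
    gain = begin
      ⌊ X ⌋ + ⌊ Y ⌋  ≤⟨ +-monoʳ-≤ ⌊ X ⌋ (≤-trans (card-split U Y ⟪ (λ y → dec X (y ⊞ e)) ⟫) (≤-reflexive (+-comm ⌊ Y′ ⌋ _))) ⟩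
      ⌊ X ⌋ + (⌊ Y∖Y′ ⌋ + ⌊ Y′ ⌋)  ≡⟨ sym (+-assoc ⌊ X ⌋ _ _) ⟩
      ⌊ X ⌋ + ⌊ Y∖Y′ ⌋ + ⌊ Y′ ⌋  ≤⟨ +-monoˡ-≤ ⌊ Y′ ⌋ (+-monoʳ-≤ ⌊ X ⌋ (translate Y∖Y′ (Yᵉ ⋂ ∁ X) e λ y q → subst (Y ∋_) (sym (⊞-⊖ y e)) (proj₁ q) , proj₂ q)) ⟩
      ⌊ X ⌋ + ⌊ Yᵉ ⋂ ∁ X ⌋ + ⌊ Y′ ⌋  ≤⟨ +-monoˡ-≤ ⌊ Y′ ⌋ (card-disjoint U X′ X (Yᵉ ⋂ ∁ X) (λ _ _ → inj₁) (λ _ _ q → inj₂ (proj₁ q)) λ _ _ q r → proj₂ r q) ⟩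
      ⌊ X′ ⌋ + ⌊ Y′ ⌋  ∎
      where
      open ≤-Reasoning
      Y∖Y′ : Sub G
      Y∖Y′ = Y ⋂ ∁ ⟪ (λ y → dec X (y ⊞ e)) ⟫
    conclude : CauchyDavenport X′ Y′ Z → CauchyDavenport X Y Z
    conclude (inj₁ q) = inj₁ q
    conclude (inj₂ q) = inj₂ (≤-trans gain q)

  cauchy-davenport : ∀ X Y Z x₀ y₀ → X ∋ x₀ → Y ∋ y₀ → (∀ x y → X ∋ x → Y ∋ y → Z ∋ x ⊞ y) → CauchyDavenport X Y Z
  cauchy-davenport X Y Z = cauchy-davenport-≤ ⌊ Y ⌋ X Y Z ≤-refl

  -- The sets `Z m` only have to absorb the m-fold sums of `X`. Level sets do so without being
  -- sumsets, which is the intended use.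
  iterated-cauchy-davenport : ∀ X (Z : ℕ → Sub G) x₀ → X ∋ x₀ → (∀ x → X ∋ x → Z 1 ∋ x) →
    (∀ m x y → Z (suc m) ∋ x → X ∋ y → Z (suc (suc m)) ∋ x ⊞ y) →
    ∀ m → (p ≤ ⌊ Z (suc m) ⌋) ⊎ (suc m * ⌊ X ⌋ ≤ ⌊ Z (suc m) ⌋ + m)
  iterated-cauchy-davenport X Z x₀ X∋ base step zero = inj₂ (≤-trans (≤-reflexive (*-identityˡ _)) (≤-trans (mono X (Z 1) base) (m≤m+n _ 0)))
  iterated-cauchy-davenport X Z x₀ X∋ base step (suc m) with iterated-cauchy-davenport X Z x₀ X∋ base step m
  ... | inj₁ q = inj₁ (≤-trans q (translate (Z (suc m)) (Z (suc (suc m))) x₀ λ x r → step m x x₀ r X∋))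
  ... | inj₂ q with cauchy-davenport (Z (suc m)) X (Z (suc (suc m))) (x₀ₘ m) x₀ (Zx₀ m) X∋ (step m)
    where
    x₀ₘ : ℕ → G
    x₀ₘ zero    = x₀
    x₀ₘ (suc m) = x₀ₘ m ⊞ x₀
    Zx₀ : ∀ m → Z (suc m) ∋ x₀ₘ m
    Zx₀ zero    = base x₀ X∋
    Zx₀ (suc m) = step m _ x₀ (Zx₀ m) X∋
  ... | inj₁ r = inj₁ r
  ... | inj₂ r = inj₂ (arith ⌊ X ⌋ ⌊ Z (suc m) ⌋ ⌊ Z (suc (suc m)) ⌋ m q r)
    where
    arith : ∀ x z z′ m → suc m * x ≤ z + m → z + x ≤ suc z′ → suc (suc m) * x ≤ z′ + suc m
    arith x z z′ m h₁ h₂ = linear 0 (h₁ ⊹ h₂) (solve (x ∷ z ∷ z′ ∷ m ∷ []))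

  lost : Sub G → G → Sub G
  lost X x = X ⋂ ⟪ (λ a → ¬? (dec X (a ⊞ x))) ⟫

  kept : Sub G → G → Sub G
  kept X x = X ⋂ ⟪ (λ a → dec X (a ⊞ x)) ⟫

  -- The f of the overview, counted at the points that leave `X` instead of at their images.
  δ : Sub G → G → ℕ
  δ X x = ⌊ lost X x ⌋

  lost-or-kept : ∀ X x a → X ∋ a → (lost X x ∋ a) ⊎ (kept X x ∋ a)
  lost-or-kept X x a q with dec X (a ⊞ x)
  ... | yes r = inj₂ (q , r)
  ... | no r  = inj₁ (q , r)

  δ+kept : ∀ X x → ⌊ X ⌋ ≤ δ X x + ⌊ kept X x ⌋
  δ+kept X x = ≤-trans (card-split U X ⟪ (λ a → dec X (a ⊞ x)) ⟫) (≤-reflexive (+-comm ⌊ kept X x ⌋ _))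

  δ+kept′ : ∀ X x → δ X x + ⌊ kept X x ⌋ ≤ ⌊ X ⌋
  δ+kept′ X x = card-disjoint U X (lost X x) (kept X x) (λ _ _ → proj₁) (λ _ _ → proj₁) λ _ _ q r → proj₂ q (proj₂ r)

  δ-𝟘 : ∀ X → δ X 𝟘 ≡ 0
  δ-𝟘 X = n≤0⇒n≡0 (+-cancelʳ-≤ ⌊ kept X 𝟘 ⌋ _ 0 (≤-trans (δ+kept′ X 𝟘) (mono X (kept X 𝟘) λ a q → q , subst (X ∋_) (sym (identityʳ a)) q)))

  δ-⊞ : ∀ X x y → δ X (x ⊞ y) ≤ δ X x + δ X y
  δ-⊞ X x y = ≤-trans (card-cover U (lost X (x ⊞ y)) (lost X x) late split) (+-monoʳ-≤ (δ X x) (translate late (lost X y) x λ a q → proj₁ (proj₂ q) , proj₂ (proj₂ q)))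
    where
    late : Sub G
    late = X ⋂ ⟪ (λ a → dec X (a ⊞ x)) ⟫ ⋂ ⟪ (λ a → ¬? (dec X (a ⊞ x ⊞ y))) ⟫
    split : ∀ a → a ∈ U → lost X (x ⊞ y) ∋ a → (lost X x ∋ a) ⊎ (late ∋ a)
    split a _ (q , r) with dec X (a ⊞ x)
    ... | yes s = inj₂ (q , s , λ t → r (subst (X ∋_) (assoc a x y) t))
    ... | no s  = inj₁ (q , s)

  -- The points kept under x and those kept under -x are translates of each other by x, and δ counts
  -- the rest of `X` in both cases.
  δ-⊟ : ∀ X x → δ X (⊟ x) ≤ δ X x
  δ-⊟ X x = +-cancelʳ-≤ ⌊ kept X x ⌋ _ _ (begin
    δ X (⊟ x) + ⌊ kept X x ⌋  ≤⟨ +-monoʳ-≤ (δ X (⊟ x)) (translate (kept X x) (kept X (⊟ x)) x λ a q → proj₂ q , subst (X ∋_) (sym (⊞-⊖ a x)) (proj₁ q)) ⟩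
    δ X (⊟ x) + ⌊ kept X (⊟ x) ⌋  ≤⟨ δ+kept′ X (⊟ x) ⟩
    ⌊ X ⌋  ≤⟨ δ+kept X x ⟩
    δ X x + ⌊ kept X x ⌋  ∎)
    where open ≤-Reasoning

  δ-· : ∀ X i x → δ X (i · x) ≤ i * δ X x
  δ-· X zero    x = ≤-reflexive (δ-𝟘 X)
  δ-· X (suc i) x = ≤-trans (δ-⊞ X x (i · x)) (+-monoʳ-≤ (δ X x) (δ-· X i x))

  level : Sub G → ℕ → Sub G
  level X t = ⟪ (λ x → δ X x ≤? t) ⟫

  -- Double counting of the pairs (x , a) with a and a + x in `X`: each x of the level set has at
  -- least |X| - t of them, and (a , a + x) determines the pair.
  level-trivial-bound : ∀ X t → ⌊ level X t ⌋ * ⌊ X ⌋ ≤ ⌊ X ⌋ * ⌊ X ⌋ + ⌊ level X t ⌋ * t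
  level-trivial-bound X t = begin
    ⌊ L ⌋ * ⌊ X ⌋  ≤⟨ ∑-≥ (els U L) (λ x → ⌊ kept X x ⌋ + t) ⌊ X ⌋ pointwise ⟩
    ∑ (els U L) (λ x → ⌊ kept X x ⌋ + t)  ≡⟨ ∑-+ (els U L) _ _ ⟩
    ∑ (els U L) (λ x → ⌊ kept X x ⌋) + ∑ (els U L) (λ _ → t)  ≡⟨ cong₂ _+_ (sym (∑-card-⊗ (els U L) U pairs)) (∑-const (els U L) t) ⟩
    card (els U L ⊗ U) pairs + ⌊ L ⌋ * t  ≤⟨ +-monoˡ-≤ (⌊ L ⌋ * t) pairs≤ ⟩
    ⌊ X ⌋ * ⌊ X ⌋ + ⌊ L ⌋ * t  ∎
    where
    open ≤-Reasoning
    L : Sub G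
    L = level X t
    pairs : Sub (G × G)
    pairs = ⟪ (λ { (x , a) → dec (kept X x) a }) ⟫
    pointwise : ∀ x → x ∈ els U L → ⌊ X ⌋ ≤ ⌊ kept X x ⌋ + t
    pointwise x x∈ = ≤-trans (δ+kept X x) (≤-trans (+-monoˡ-≤ _ (proj₂ (els-∈ U L x∈))) (≤-reflexive (+-comm t _)))
    pairs≤ : card (els U L ⊗ U) pairs ≤ ⌊ X ⌋ * ⌊ X ⌋
    pairs≤ = ≤-trans (length-inj (λ { (x , a) (b , c) → a ≡ b × a ⊞ x ≡ c })
        (λ { {x , a} {x′ , .a} (refl , r) (refl , r′) → cong (_, a) (cancelʳ a x x′ (trans (comm x a) (trans (trans r (sym r′)) (comm a x′)))) })
        (els U X ⊗ els U X) (els-unique pairs (⊗-unique (els-unique L U-unique) U-unique)) go)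
      (≤-reflexive (length-⊗ (els U X) (els U X)))
      where
      go : ∀ {xa : G × G} → xa ∈ els (els U L ⊗ U) pairs → Σ (G × G) λ bc → bc ∈ els U X ⊗ els U X × proj₂ xa ≡ proj₁ bc × proj₂ xa ⊞ proj₁ xa ≡ proj₂ bc
      go {x , a} xa∈ with els-∈ (els U L ⊗ U) pairs xa∈
      ... | _ , Xa , Xax = (a , a ⊞ x) , ∈-⊗⁺ (∈-els X (U-full a) Xa) (∈-els X (U-full _) Xax) , refl , refl

  half-bound : ∀ X t → 1 ≤ ⌊ X ⌋ → 3 * t ≤ ⌊ X ⌋ → 2 * ⌊ level X t ⌋ ≤ 3 * ⌊ X ⌋
  half-bound X t 1≤ 3t≤ = *-cancelˡ-≤ ⌊ X ⌋ ⦃ >-nonZero 1≤ ⦄ (arith ⌊ X ⌋ ⌊ level X t ⌋ t 3t≤ (level-trivial-bound X t))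
    where
    arith : ∀ n l t → 3 * t ≤ n → l * n ≤ n * n + l * t → n * (2 * l) ≤ n * (3 * n)
    arith n l t h₁ h₂ = linear 0 (l ⊛ h₁ ⊹ 3 ⊛ h₂) (solve (n ∷ l ∷ t ∷ []))

  -- At most 3|X|/2 < p elements lie in such a level set. This excludes the first alternative of
  -- Cauchy-Davenport as long as the threshold stays below |X|/3.
  level<p : ∀ X t → 1 ≤ ⌊ X ⌋ → 2 * ⌊ X ⌋ < p → 3 * t ≤ ⌊ X ⌋ → ¬ (p ≤ ⌊ level X t ⌋)
  level<p X t 1≤ 2< 3t≤ p≤ = <-irrefl refl (arith ⌊ X ⌋ ⌊ level X t ⌋ p 1≤ 2< (half-bound X t 1≤ 3t≤) p≤)
    where
    arith : ∀ n l p → 1 ≤ n → 2 * n < p → 2 * l ≤ 3 * n → p ≤ l → n < n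
    arith n l p h₁ h₂ h₃ h₄ = linear 2 (h₁ ⊹ 2 ⊛ h₂ ⊹ h₃ ⊹ 2 ⊛ h₄) (solve (n ∷ l ∷ p ∷ []))

  level-step : ∀ X t u x y → level X t ∋ x → level X u ∋ y → level X (t + u) ∋ x ⊞ y
  level-step X t u x y q r = ≤-trans (δ-⊞ X x y) (+-mono-≤ q r)

  level-iterate : ∀ X t → 1 ≤ ⌊ X ⌋ → 2 * ⌊ X ⌋ < p → ∀ m → 3 * (suc m * t) ≤ ⌊ X ⌋ → suc m * ⌊ level X t ⌋ ≤ ⌊ level X (suc m * t) ⌋ + m
  level-iterate X t 1≤ 2< m 3t≤ with iterated-cauchy-davenport (level X t) (λ m → level X (m * t)) 𝟘
      (≤-trans (≤-reflexive (δ-𝟘 X)) z≤n) (λ x q → ≤-trans q (≤-reflexive (sym (*-identityˡ t))))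
      (λ m x y q r → ≤-trans (level-step X (suc m * t) t x y q r) (≤-reflexive (+-comm (suc m * t) t))) m
  ... | inj₁ q = ⊥-elim (level<p X (suc m * t) 1≤ 2< 3t≤ q)
  ... | inj₂ q = q

  -- For s = ⌊|X| / 3t⌋ the s-fold sums stay in the level set of s·t, which has at most 3|X|/2 < 9(s
  -- + 1)t/2 ≤ 9st elements, while by Cauchy-Davenport there are at least s times as many sums as
  -- elements, up to s - 1. Division by s gives the bound.
  level-bound : ∀ X t → 2 * ⌊ X ⌋ < p → 1 ≤ t → 3 * t ≤ ⌊ X ⌋ → ⌊ level X t ⌋ ≤ 9 * t
  level-bound X t 2< 1≤t 3t≤ = go (n / (3 * t)) refl
    where
    n : ℕ
    n = ⌊ X ⌋
    instance
      3t≢0 : NonZero (3 * t)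
      3t≢0 = >-nonZero (≤-trans (s≤s z≤n) (*-monoʳ-≤ 3 1≤t))
    1≤n : 1 ≤ n
    1≤n = ≤-trans (≤-trans 1≤t (m≤m+n t _)) 3t≤
    go : ∀ s → n / (3 * t) ≡ s → ⌊ level X t ⌋ ≤ 9 * t
    go zero    e = ⊥-elim (<-irrefl (sym e) (m≥n⇒m/n>0 3t≤))
    go (suc m) e = s≤s⁻¹ (*-cancelˡ-< (2 * suc m) _ _ (final n t ⌊ level X t ⌋ ⌊ level X (suc m * t) ⌋ m
        (level-iterate X t 1≤n 2< m s3t≤n) (half-bound X (suc m * t) 1≤n s3t≤n)
        (subst (λ s → n < 3 * t + s * (3 * t)) e n<)))
      where
      s3t≤n : 3 * (suc m * t) ≤ n
      s3t≤n = ≤-trans (≤-reflexive (reorder m t)) (subst (λ s → s * (3 * t) ≤ n) e (m/n*n≤m n (3 * t)))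
        where
        reorder : ∀ m t → 3 * (suc m * t) ≡ suc m * (3 * t)
        reorder = solve-∀
      n< : n < 3 * t + n / (3 * t) * (3 * t)
      n< = ≤-trans (s≤s (≤-reflexive (m≡m%n+[m/n]*n n (3 * t)))) (+-monoˡ-≤ _ (m%n<n n (3 * t)))
      final : ∀ n t l z m → suc m * l ≤ z + m → 2 * z ≤ 3 * n → n < 3 * t + suc m * (3 * t) → 2 * suc m * l < 2 * suc m * suc (9 * t)
      final n t l z m h₁ h₂ h₃ = linear (4 + 9 * (m * t)) (2 ⊛ h₁ ⊹ h₂ ⊹ 3 ⊛ h₃) (solve (n ∷ t ∷ l ∷ z ∷ m ∷ []))

-- A direction with separated multiples

maximum : ∀ {P : ℕ → Set} (P? : ∀ i → Dec (P i)) m → P 0 → Σ ℕ λ i → i ≤ m × P i × (∀ j → i < j → j ≤ m → ¬ P j)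
maximum P? zero    P0 = 0 , z≤n , P0 , λ j 0<j j≤0 → ⊥-elim (<⇒≱ 0<j j≤0)
maximum P? (suc m) P0 with P? (suc m) | maximum P? m P0
... | yes q | _ = suc m , ≤-refl , q , λ j m<j j≤m → ⊥-elim (<⇒≱ m<j j≤m)
... | no ¬q | i , i≤m , Pi , max = i , m≤n⇒m≤1+n i≤m , Pi , λ j i<j j≤ → go j i<j (m≤n⇒m<n∨m≡n j≤)
  where
  go : ∀ j → i < j → (j < suc m) ⊎ (j ≡ suc m) → ¬ _
  go j i<j (inj₁ j<) = max j i<j (s≤s⁻¹ j<)
  go j i<j (inj₂ refl) = ¬q

record Small (𝔾 : PrimeGroup) (A : Sub (PrimeGroup.G 𝔾)) (k : ℕ) : Set where
  open Groups 𝔾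
  field
    1≤k   : 1 ≤ k
    2|A|< : 2 * ⌊ A ⌋ < p
    k<D   : k < ⌊ level A k ⌋

module Structure {𝔾 : PrimeGroup} {A : Sub (PrimeGroup.G 𝔾)} {k : ℕ} (small : Small 𝔾 A k) where

  open Groups 𝔾 public
  open Small small public

  n : ℕ
  n = ⌊ A ⌋

  D : ℕ → Sub G
  D T = level A (T * k)

  -- The range of T in which `D T` grows linearly: both `D-upper` and `D-lower` need its threshold
  -- to be at most a third of |A|.
  record Room (T : ℕ) : Set where
    constructor mkRoom
    field
      3Tk≤n : 3 * (T * k) ≤ n

  open Room

  room-mono : ∀ {S T} → S ≤ T → Room T → Room S
  room-mono S≤T r = mkRoom (≤-trans (*-monoʳ-≤ 3 (*-monoˡ-≤ k S≤T)) (3Tk≤n r))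

  D-mono : ∀ {S T} x → S ≤ T → D S ∋ x → D T ∋ x
  D-mono x S≤T q = ≤-trans q (*-monoˡ-≤ k S≤T)

  D-⊞ : ∀ S T x y → D S ∋ x → D T ∋ y → D (S + T) ∋ x ⊞ y
  D-⊞ S T x y q r = ≤-trans (level-step A (S * k) (T * k) x y q r) (≤-reflexive (sym (*-distribʳ-+ k S T)))

  D-⊟ : ∀ T x → D T ∋ x → D T ∋ (⊟ x)
  D-⊟ T x q = ≤-trans (δ-⊟ A x) q

  D-⊖ : ∀ S T x y → D S ∋ x → D T ∋ y → D (S + T) ∋ x ⊝ y
  D-⊖ S T x y q r = D-⊞ S T x (⊟ y) q (D-⊟ T y r)

  D-· : ∀ T i x → D T ∋ x → D (i * T) ∋ i · x
  D-· T i x q = ≤-trans (δ-· A i x) (≤-trans (*-monoʳ-≤ i q) (≤-reflexive (sym (*-assoc i T k))))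

  D-𝟘 : ∀ T → D T ∋ 𝟘
  D-𝟘 T = ≤-trans (≤-reflexive (δ-𝟘 A)) z≤n

  D₁ : ∀ x → level A k ∋ x → D 1 ∋ x
  D₁ x q = ≤-trans q (≤-reflexive (sym (*-identityˡ k)))

  1≤n : ∀ {T} → 1 ≤ T → Room T → 1 ≤ n
  1≤n 1≤T r = ≤-trans (*-mono-≤ {1} {3} (s≤s z≤n) (*-mono-≤ 1≤T 1≤k)) (3Tk≤n r)

  D-upper : ∀ {T} → 1 ≤ T → Room T → ⌊ D T ⌋ ≤ 9 * (T * k)
  D-upper 1≤T r = level-bound A _ 2|A|< (*-mono-≤ 1≤T 1≤k) (3Tk≤n r)

  D<p : ∀ {T} → 1 ≤ T → Room T → ¬ (p ≤ ⌊ D T ⌋)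
  D<p 1≤T r = level<p A _ (1≤n 1≤T r) 2|A|< (3Tk≤n r)

  D-lower : ∀ {T} → 1 ≤ T → Room T → T * k < ⌊ D T ⌋
  D-lower {suc m} 1≤T r = arith k m ⌊ level A k ⌋ ⌊ D (suc m) ⌋ k<D (level-iterate A k (1≤n 1≤T r) 2|A|< m (3Tk≤n r))
    where
    arith : ∀ k m d z → k < d → suc m * d ≤ z + m → suc m * k < z
    arith k m d z h₁ h₂ = linear 0 (suc m ⊛ h₁ ⊹ h₂) (solve (k ∷ m ∷ d ∷ z ∷ []))

  ·-∸ : ∀ {i j} x → i ≤ j → j · x ≡ (j ∸ i) · x ⊞ i · x
  ·-∸ {i} {j} x i≤j = trans (cong (_· x) (sym (m∸n+n≡m i≤j))) (·-+ x (j ∸ i) i)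

  shift-difference : ∀ {i j} b x y → i ≤ j → x ⊞ i · b ≡ y ⊞ j · b → x ≡ y ⊞ (j ∸ i) · b
  shift-difference {i} {j} b x y i≤j e = cancelʳ (i · b) _ _ (trans e (trans (cong (y ⊞_) (·-∸ b i≤j)) (sym (assoc y _ _))))

  index-difference : ∀ S {i j} b x y → i ≤ j → D S ∋ x → D S ∋ y → x ⊞ i · b ≡ y ⊞ j · b → D (S + S) ∋ (j ∸ i) · b
  index-difference S {i} {j} b x y i≤j Dx Dy e =
    subst (D (S + S) ∋_) (trans (cong (_⊝ y) (trans (shift-difference b x y i≤j e) (comm y _))) (⊞-⊖ _ y)) (D-⊖ S S x y Dx Dy)

  -- Multiplication by i is injective, so few elements of D M have a small multiple inside D 2.
  base-exists : ∀ i₀ M → 18 * i₀ ≤ M → 2 ≤ M → i₀ < p → Room M →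
    Σ G λ b → D M ∋ b × (∀ i → 1 ≤ i → i ≤ i₀ → ¬ (D 2 ∋ i · b))
  base-exists i₀ M 18i₀≤M 2≤M i₀<p room with some-or-none U (D M ⋂ ∁ bad)
    where
    bad : Sub G
    bad = ⟪ (λ b → ∃<? i₀ (λ i → dec (D 2) (suc i · b))) ⟫
  ... | inj₁ (b , _ , Db , good) = b , Db , λ { (suc i) _ i<i₀ q → good (i , i<i₀ , q) }
  ... | inj₂ none = ⊥-elim (<⇒≱ (D-lower 1≤M room) (begin
      ⌊ D M ⌋  ≤⟨ length-inj (λ b iy → proj₁ iy < i₀ × (suc (proj₁ iy) · b ≡ proj₂ iy)) inj (upTo i₀ ⊗ els U (D 2)) (els-unique (D M) U-unique) tot ⟩
      length (upTo i₀ ⊗ els U (D 2))  ≡⟨ length-⊗ (upTo i₀) (els U (D 2)) ⟩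
      length (upTo i₀) * ⌊ D 2 ⌋  ≡⟨ cong (_* ⌊ D 2 ⌋) (length-upTo i₀) ⟩
      i₀ * ⌊ D 2 ⌋  ≤⟨ arith i₀ k M ⌊ D 2 ⌋ 18i₀≤M (D-upper (s≤s z≤n) (room-mono 2≤M room)) ⟩
      M * k  ∎))
    where
    open ≤-Reasoning
    1≤M : 1 ≤ M
    1≤M = ≤-trans (s≤s z≤n) 2≤M
    inj : ∀ {b b′ iy} → proj₁ iy < i₀ × (suc (proj₁ iy) · b ≡ proj₂ iy) → proj₁ iy < i₀ × (suc (proj₁ iy) · b′ ≡ proj₂ iy) → b ≡ b′
    inj (i< , e) (_ , e′) = ·-injʳ _ (s≤s z≤n) (≤-<-trans i< i₀<p) (trans e (sym e′))
    tot : ∀ {b} → b ∈ els U (D M) → Σ (ℕ × G) λ iy → (iy ∈ upTo i₀ ⊗ els U (D 2)) × (proj₁ iy < i₀ × (suc (proj₁ iy) · b ≡ proj₂ iy))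
    tot {b} b∈ with els-∈ U (D M) b∈
    ... | b∈U , Db with ∃<? i₀ (λ i → dec (D 2) (suc i · b))
    ... | yes (i , i< , q) = (i , suc i · b) , ∈-⊗⁺ (∈-upTo⁺ i<) (∈-els (D 2) (U-full _) q) , i< , refl
    ... | no ¬q = ⊥-elim (none b b∈U (Db , ¬q))
    arith : ∀ i k M d → 18 * i ≤ M → d ≤ 9 * (2 * k) → i * d ≤ M * k
    arith i k M d h₁ h₂ = linear 0 (k ⊛ h₁ ⊹ i ⊛ h₂) (solve (i ∷ k ∷ M ∷ d ∷ []))

  -- Differences of elements of `D 1` lie in `D 2`, so this makes the translates of `D 1` by 0, b,
  -- ..., R·b pairwise disjoint.
  Separated : G → ℕ → Set
  Separated b R = ∀ i → 1 ≤ i → i ≤ R → ¬ (D 2 ∋ i · b)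

  separated-≤ : ∀ {b R} → Separated b R → ∀ {i j x y} → i ≤ j → j ≤ R → D 1 ∋ x → D 1 ∋ y → x ⊞ i · b ≡ y ⊞ j · b → i ≡ j
  separated-≤ {b} {R} sep {i} {j} {x} {y} i≤j j≤R Dx Dy e with j ∸ i in eq
  ... | zero  = ≤-antisym i≤j (m∸n≡0⇒m≤n eq)
  ... | suc c = ⊥-elim (sep (suc c) (s≤s z≤n) (≤-trans (≤-trans (≤-reflexive (sym eq)) (m∸n≤m j i)) j≤R)
                  (subst (λ c → D 2 ∋ c · b) eq (index-difference 1 b x y i≤j Dx Dy e)))

  separated-index : ∀ {b R} → Separated b R → ∀ {i j x y} → i ≤ R → j ≤ R → D 1 ∋ x → D 1 ∋ y → x ⊞ i · b ≡ y ⊞ j · b → i ≡ j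
  separated-index sep {i} {j} i≤R j≤R Dx Dy e with ≤-total i j
  ... | inj₁ i≤j = separated-≤ sep i≤j j≤R Dx Dy e
  ... | inj₂ j≤i = sym (separated-≤ sep j≤i i≤R Dy Dx (sym e))

  separated-pair : ∀ {b R} → Separated b R → ∀ {i j x y} → i ≤ R → j ≤ R → D 1 ∋ x → D 1 ∋ y → x ⊞ i · b ≡ y ⊞ j · b → (i , x) ≡ (j , y)
  separated-pair {b} sep {i} i≤R j≤R Dx Dy e with separated-index sep i≤R j≤R Dx Dy e
  ... | refl = cong (i ,_) (cancelʳ (i · b) _ _ e)

  -- If i is minimal with i·b ∈ D 2, the translates of D 1 along [0,i)·b are disjoint but their sum
  -- wraps around, so by Cauchy–Davenport it would grow faster than the level sets do.
  separated-step : ∀ M b i → D M ∋ b → 54 ≤ i → Separated b i → Room (suc i * M + 3 * suc (18 * M)) → ¬ (D 2 ∋ suc i · b)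
  separated-step M b i₋ Db 54≤i sep room Dib = <⇒≱ (s≤s 54≤i) (*-cancelˡ-≤ (suc (9 * M) * k) ⦃ m*n≢0 (suc (9 * M)) k ⦃ _ ⦄ ⦃ >-nonZero 1≤k ⦄ ⦄ bound)
    where
    i : ℕ
    i = suc i₋
    -- About m-fold sums have size at least m·i·k, but they lie in a level set with at most 9(i·M +
    -- 3(m + 1))k elements. Taking m to be twice the growth rate 9M leaves (9M + 1)i ≤ 54(9M + 1).
    m : ℕ
    m = 18 * M
    Z : ℕ → Sub G
    Z s = ⟪ (λ x → ∃<? i (λ l → dec (D s) (x ⊝ l · b))) ⟫
    in-Z : ∀ s l x → l < i → D s ∋ x → Z s ∋ x ⊞ l · b
    in-Z s l x l<i q = l , l<i , subst (D s ∋_) (sym (⊞-⊖ x (l · b))) q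
    -- An index that reaches `i` is reduced by `i`, at the price of two levels, because i·b lies in
    -- `D 2`.
    wrap : ∀ s x l l′ → D s ∋ x → l < i → l′ < i → Z (2 + s) ∋ x ⊞ (l + l′) · b
    wrap s x l l′ q l< l′< with l + l′ <? i
    ... | yes r = in-Z (2 + s) (l + l′) x r (D-mono x (m≤n+m s 2) q)
    ... | no r = subst (Z (2 + s) ∋_) (trans (cong (_⊞ (l + l′ ∸ i) · b) (comm (i · b) x)) (trans (assoc x _ _) (cong (x ⊞_) (trans (comm _ _) (sym (·-∸ b (≮⇒≥ r)))))))
        (in-Z (2 + s) (l + l′ ∸ i) (i · b ⊞ x) (+-cancelʳ-< i _ _ (≤-trans (s≤s (≤-reflexive (m∸n+n≡m (≮⇒≥ r)))) (+-mono-<-≤ l< (<⇒≤ l′<)))) (D-⊞ 2 s (i · b) x Dib q))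
    base : ∀ x → Z 1 ∋ x → Z 3 ∋ x
    base x (l , l< , q) = l , l< , D-mono {1} {3} (x ⊝ l · b) (s≤s z≤n) q
    step : ∀ s x y → Z (3 * suc s) ∋ x → Z 1 ∋ y → Z (3 * suc (suc s)) ∋ x ⊞ y
    step s x y (l , l< , q) (l′ , l′< , q′) = subst (λ s → Z s ∋ x ⊞ y) (count s)
        (subst (Z (2 + (3 * suc s + 1)) ∋_) assemble (wrap (3 * suc s + 1) ((x ⊝ l · b) ⊞ (y ⊝ l′ · b)) l l′ (D-⊞ (3 * suc s) 1 _ _ q q′) l< l′<))
      where
      count : ∀ s → 2 + (3 * suc s + 1) ≡ 3 * suc (suc s)
      count = solve-∀
      assemble : (x ⊝ l · b) ⊞ (y ⊝ l′ · b) ⊞ (l + l′) · b ≡ x ⊞ y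
      assemble = trans (cong ((x ⊝ l · b) ⊞ (y ⊝ l′ · b) ⊞_) (·-+ b l l′))
        (trans (ac 4 (λ u v w z → (u ∙ v) ∙ (w ∙ z) ⊜ (u ∙ w) ∙ (v ∙ z)) refl (x ⊝ l · b) (y ⊝ l′ · b) (l · b) (l′ · b))
          (cong₂ _⊞_ (⊖-⊞ x (l · b)) (⊖-⊞ y (l′ · b))))
    |Z₁|≥ : i * ⌊ D 1 ⌋ ≤ ⌊ Z 1 ⌋
    |Z₁|≥ = begin
      i * ⌊ D 1 ⌋  ≡⟨ cong (_* ⌊ D 1 ⌋) (sym (length-upTo i)) ⟩
      length (upTo i) * ⌊ D 1 ⌋  ≡⟨ sym (length-⊗ (upTo i) (els U (D 1))) ⟩
      length (upTo i ⊗ els U (D 1))  ≤⟨ length-inj (λ ld x → proj₁ ld ≤ i₋ × D 1 ∋ proj₂ ld × proj₂ ld ⊞ proj₁ ld · b ≡ x)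
                                                (λ { (l≤ , d , e) (l′≤ , d′ , e′) → separated-pair sep l≤ l′≤ d d′ (trans e (sym e′)) })
                                                (els U (Z 1)) (⊗-unique (Uniq.upTo⁺ i) (els-unique (D 1) U-unique)) go ⟩
      ⌊ Z 1 ⌋  ∎
      where
      open ≤-Reasoning
      go : ∀ {ld} → ld ∈ upTo i ⊗ els U (D 1) → Σ G λ x → (x ∈ els U (Z 1)) × proj₁ ld ≤ i₋ × D 1 ∋ proj₂ ld × proj₂ ld ⊞ proj₁ ld · b ≡ x
      go {l , d} ld∈ with ∈-⊗⁻ (upTo i) (els U (D 1)) ld∈
      ... | l∈ , d∈ with els-∈ U (D 1) d∈
      ... | _ , Dd = d ⊞ l · b , ∈-els (Z 1) (U-full _) (in-Z 1 l d (∈-upTo⁻ l∈) Dd) , s≤s⁻¹ (∈-upTo⁻ l∈) , Dd , refl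
    Top : ℕ
    Top = i * M + 3 * suc m
    1≤Top : 1 ≤ Top
    1≤Top = ≤-trans (s≤s z≤n) (m≤n+m (3 * suc m) (i * M))
    Z⊂D : ∀ x → Z (3 * suc m) ∋ x → D Top ∋ x
    Z⊂D x (l , l< , q) = subst (D Top ∋_) (trans (comm _ _) (⊖-⊞ x (l · b)))
      (D-⊞ (i * M) (3 * suc m) (l · b) (x ⊝ l · b) (D-mono (l · b) (*-monoˡ-≤ M (<⇒≤ l<)) (D-· M l b Db)) q)
    1≤Room : Room 1
    1≤Room = room-mono 1≤Top room
    bound : suc (9 * M) * k * i ≤ suc (9 * M) * k * 54
    bound with iterated-cauchy-davenport (Z 1) (λ s → Z (3 * s)) (𝟘 ⊞ 0 · b) (in-Z 1 0 𝟘 (s≤s z≤n) (D-𝟘 1)) base step m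
    ... | inj₁ q = ⊥-elim (D<p 1≤Top room (≤-trans q (mono (Z (3 * suc m)) (D Top) Z⊂D)))
    ... | inj₂ q = arith M k i ⌊ D 1 ⌋ ⌊ Z 1 ⌋ ⌊ Z (3 * suc m) ⌋ (D-lower (s≤s z≤n) 1≤Room) |Z₁|≥ q (≤-trans (mono (Z (3 * suc m)) (D Top) Z⊂D) (D-upper 1≤Top room)) (s≤s z≤n)
      where
      arith : ∀ M k i d q z → 1 * k < d → i * d ≤ q → suc (18 * M) * q ≤ z + 18 * M → z ≤ 9 * ((i * M + 3 * suc (18 * M)) * k) → 1 ≤ i →
        suc (9 * M) * k * i ≤ suc (9 * M) * k * 54
      arith M k i d q z h₁ h₂ h₃ h₄ h₅ = linear (1 + 27 * k) ((suc (18 * M) * i) ⊛ h₁ ⊹ suc (18 * M) ⊛ h₂ ⊹ h₃ ⊹ h₄ ⊹ suc (18 * M) ⊛ h₅) (solve (M ∷ k ∷ i ∷ d ∷ q ∷ z ∷ []))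

  separated : ∀ M b → D M ∋ b → Separated b 54 → ∀ R → Room (R * M + 3 * suc (18 * M)) → Separated b R
  separated M b Db sep₀ zero room i 1≤i i≤0 = ⊥-elim (<⇒≱ 1≤i i≤0)
  separated M b Db sep₀ (suc R) room i 1≤i i≤R with m≤n⇒m<n∨m≡n i≤R
  ... | inj₁ i< = separated M b Db sep₀ R (room-mono (+-monoˡ-≤ _ (m≤n+m (R * M) M)) room) i 1≤i (s≤s⁻¹ i<)
  ... | inj₂ refl with 54 ≤? R
  ... | yes 54≤R = separated-step M b R Db 54≤R (separated M b Db sep₀ R (room-mono (+-monoˡ-≤ _ (m≤n+m (R * M) M)) room)) room
  ... | no 54≰R = sep₀ (suc R) (s≤s z≤n) (≰⇒> 54≰R)

-- Clusters

digits-unique : ∀ i a c a′ c′ → a < i → a′ < i → a + c * i ≡ a′ + c′ * i → (a , c) ≡ (a′ , c′)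
digits-unique i a zero    a′ zero     a< a′< e = cong (_, 0) (+-cancelʳ-≡ 0 a a′ e)
digits-unique i a zero    a′ (suc c′) a< a′< e = ⊥-elim (<⇒≱ a< (≤-trans (≤-trans (m≤m+n i (c′ * i)) (m≤n+m (i + c′ * i) a′)) (≤-reflexive (trans (sym e) (+-identityʳ a)))))
digits-unique i a (suc c) a′ zero     a< a′< e = ⊥-elim (<⇒≱ a′< (≤-trans (≤-trans (m≤m+n i (c * i)) (m≤n+m (i + c * i) a)) (≤-reflexive (trans e (+-identityʳ a′)))))
digits-unique i a (suc c) a′ (suc c′) a< a′< e = cong (λ ac → proj₁ ac , suc (proj₂ ac))
  (digits-unique i a c a′ c′ a< a′< (+-cancelˡ-≡ i _ _ (trans (swap i a (c * i)) (trans e (sym (swap i a′ (c′ * i)))))))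
  where
  swap : ∀ x y z → x + (y + z) ≡ y + (x + z)
  swap = solve-∀

-- Two scales along b: inside `D Tₘ` two points of the same column are either fewer than `r₀` or
-- more than about `ρ` steps apart. The gap between the scales makes clusters well defined.
-- Separation is required far enough to cover a grid with r₀ rows and columns and steps b and i·b, i
-- ≤ ρ.
record Base {𝔾 : PrimeGroup} {A : Sub (PrimeGroup.G 𝔾)} {k : ℕ} (small : Small 𝔾 A k) : Set where
  open Structure small
  field
    M Tₘ r₀ ρ : ℕ
    b         : G
    b∈D       : D M ∋ b
    b-sep     : Separated b (r₀ + r₀ * ρ)
    r₀-large  : 9 * (M + Tₘ) + 10 ≤ r₀
    ρ-large   : 10 * r₀ ≤ ρ
    room      : Room (r₀ * M + r₀ * Tₘ + 1)
    room′     : Room (Tₘ + ρ * M)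

module Tops {𝔾 : PrimeGroup} {A : Sub (PrimeGroup.G 𝔾)} {k : ℕ} {small : Small 𝔾 A k} (base : Base small) where

  open Structure small public
  open Base base public

  1≤r₀ : 1 ≤ r₀
  1≤r₀ = ≤-trans (≤-trans (s≤s z≤n) (m≤n+m 10 (9 * (M + Tₘ)))) r₀-large

  Tₘ≤ρ : Tₘ ≤ ρ
  Tₘ≤ρ = arith M Tₘ r₀ ρ r₀-large ρ-large
    where
    arith : ∀ M T r ρ → 9 * (M + T) + 10 ≤ r → 10 * r ≤ ρ → T ≤ ρ
    arith M T r ρ h₁ h₂ = linear (90 * M + 89 * T + 100) (10 ⊛ h₁ ⊹ h₂) (solve (M ∷ T ∷ r ∷ ρ ∷ []))

  2r₀≤ρ : r₀ + r₀ ≤ ρ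
  2r₀≤ρ = ≤-trans (m≤m+n (r₀ + r₀) (8 * r₀)) (≤-trans (≤-reflexive (ten r₀)) ρ-large)
    where
    ten : ∀ r → r + r + 8 * r ≡ 10 * r
    ten = solve-∀

  sep-ρ : Separated b ρ
  sep-ρ i 1≤i i≤ρ = b-sep i 1≤i (≤-trans i≤ρ (≤-trans (m≤n*m ρ r₀ ⦃ >-nonZero 1≤r₀ ⦄) (m≤n+m (r₀ * ρ) r₀)))

  -- A grid spanned by b and i·b would consist of separated points and be two-dimensional.
  grid : ∀ i → r₀ ≤ i → i ≤ ρ → ¬ (D Tₘ ∋ i · b)
  grid i r₀≤i i≤ρ Di = <-irrefl refl (arith M Tₘ k r₀ ⌊ D 1 ⌋ ⌊ D Top ⌋ r₀-large (D-lower (s≤s z≤n) (room-mono 1≤Top room)) 1≤k inside (D-upper 1≤Top room))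
    where
    Top : ℕ
    Top = r₀ * M + r₀ * Tₘ + 1
    1≤Top : 1 ≤ Top
    1≤Top = m≤n+m 1 (r₀ * M + r₀ * Tₘ)
    arith : ∀ M T k r d z → 9 * (M + T) + 10 ≤ r → 1 * k < d → 1 ≤ k → r * (r * d) ≤ z → z ≤ 9 * ((r * M + r * T + 1) * k) → k < k
    arith M T k r d z h₁ h₂ h₃ h₄ h₅ = linear (90 * k + 90 * (k * (M + T)) + r * r) (h₄ ⊹ (r * r) ⊛ h₂ ⊹ h₅ ⊹ (r * k) ⊛ h₁ ⊹ (10 * k) ⊛ h₁ ⊹ h₃) (solve (M ∷ T ∷ k ∷ r ∷ d ∷ z ∷ []))
    index : ℕ × ℕ → ℕ
    index (a , c) = a + c * i
    index≤ : ∀ a c → a < r₀ → c < r₀ → index (a , c) ≤ r₀ + r₀ * ρ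
    index≤ a c a< c< = +-mono-≤ (<⇒≤ a<) (*-mono-≤ (<⇒≤ c<) i≤ρ)
    index-inj : ∀ {a c a′ c′} → a < r₀ → a′ < r₀ → index (a , c) ≡ index (a′ , c′) → (a , c) ≡ (a′ , c′)
    index-inj a< a′< = digits-unique i _ _ _ _ (≤-trans a< r₀≤i) (≤-trans a′< r₀≤i)
    R : (ℕ × ℕ) × G → G → Set
    R (ac , d) x = (proj₁ ac < r₀) × proj₂ ac < r₀ × D 1 ∋ d × d ⊞ index ac · b ≡ x
    R-inj : ∀ {u v x} → R u x → R v x → u ≡ v
    R-inj {(a , c) , d} {(a′ , c′) , d′} (a< , c< , Dd , e) (a′< , c′< , Dd′ , e′)
      with separated-pair b-sep (index≤ a c a< c<) (index≤ a′ c′ a′< c′<) Dd Dd′ (trans e (sym e′))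
    ... | q = cong₂ _,_ (index-inj a< a′< (cong proj₁ q)) (cong proj₂ q)
    inside : r₀ * (r₀ * ⌊ D 1 ⌋) ≤ ⌊ D Top ⌋
    inside = begin
      r₀ * (r₀ * ⌊ D 1 ⌋)  ≡⟨ sym (*-assoc r₀ r₀ _) ⟩
      r₀ * r₀ * ⌊ D 1 ⌋  ≡⟨ cong (_* ⌊ D 1 ⌋) (sym (trans (length-⊗ (upTo r₀) (upTo r₀)) (cong₂ _*_ (length-upTo r₀) (length-upTo r₀)))) ⟩
      length (upTo r₀ ⊗ upTo r₀) * ⌊ D 1 ⌋  ≡⟨ sym (length-⊗ (upTo r₀ ⊗ upTo r₀) (els U (D 1))) ⟩
      length ((upTo r₀ ⊗ upTo r₀) ⊗ els U (D 1))  ≤⟨ length-inj R R-inj (els U (D Top)) (⊗-unique (⊗-unique (Uniq.upTo⁺ r₀) (Uniq.upTo⁺ r₀)) (els-unique (D 1) U-unique)) tot ⟩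
      ⌊ D Top ⌋  ∎
      where
      open ≤-Reasoning
      tot : ∀ {u} → u ∈ (upTo r₀ ⊗ upTo r₀) ⊗ els U (D 1) → Σ G λ x → (x ∈ els U (D Top)) × R u x
      tot {(a , c) , d} u∈ with ∈-⊗⁻ (upTo r₀ ⊗ upTo r₀) (els U (D 1)) u∈
      ... | ac∈ , d∈ with ∈-⊗⁻ (upTo r₀) (upTo r₀) ac∈ | els-∈ U (D 1) d∈
      ... | a∈ , c∈ | _ , Dd = d ⊞ (a + c * i) · b , ∈-els (D Top) (U-full _) q , ∈-upTo⁻ a∈ , ∈-upTo⁻ c∈ , Dd , refl
        where
        q : D Top ∋ d ⊞ (a + c * i) · b
        q = subst (D Top ∋_) (comm _ d) (D-⊞ (r₀ * M + r₀ * Tₘ) 1 _ d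
              (subst (D (r₀ * M + r₀ * Tₘ) ∋_) (trans (cong (a · b ⊞_) (·-assoc b c i)) (sym (·-+ b a (c * i))))
                (D-⊞ (r₀ * M) (r₀ * Tₘ) _ _ (D-mono (a · b) (*-monoˡ-≤ M (<⇒≤ (∈-upTo⁻ a∈))) (D-· M a b b∈D)) (D-mono (c · (i · b)) (*-monoˡ-≤ Tₘ (<⇒≤ (∈-upTo⁻ c∈))) (D-· Tₘ c (i · b) Di)))) Dd)

  cluster : ∀ S i → S ≤ Tₘ → i ≤ ρ → D S ∋ i · b → i < r₀
  cluster S i S≤ i≤ρ q with i <? r₀
  ... | yes r = r
  ... | no r  = ⊥-elim (grid i (≮⇒≥ r) i≤ρ (D-mono (i · b) S≤ q))

  -- One representative for each cluster of `D T` along b, namely its top: from here none of the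
  -- next `ρ` steps meets `D T` again.
  Γ : ℕ → Sub G
  Γ T = D T ⋂ ∁ ⟪ (λ x → ∃<? ρ (λ i → dec (D T) (x ⊞ suc i · b))) ⟫

  Γ⊂D : ∀ T x → Γ T ∋ x → D T ∋ x
  Γ⊂D T x = proj₁

  Γ-unique-≤ : ∀ T {x y i j} → i ≤ j → j ≤ ρ → Γ T ∋ x → Γ T ∋ y → x ⊞ i · b ≡ y ⊞ j · b → x ≡ y
  Γ-unique-≤ T {x} {y} {i} {j} i≤j j≤ρ Γx Γy e with j ∸ i in eq
  ... | zero  = trans (shift-difference b x y i≤j e) (trans (cong (λ c → y ⊞ c · b) eq) (identityʳ y))
  ... | suc c = ⊥-elim (proj₂ Γy (c , ≤-trans (≤-trans (≤-reflexive (sym eq)) (m∸n≤m j i)) j≤ρ ,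
                  subst (D T ∋_) (trans (shift-difference b x y i≤j e) (cong (λ c → y ⊞ c · b) eq)) (proj₁ Γx)))

  Γ-unique : ∀ T {x y i j} → i ≤ ρ → j ≤ ρ → Γ T ∋ x → Γ T ∋ y → x ⊞ i · b ≡ y ⊞ j · b → x ≡ y
  Γ-unique T {i = i} {j} i≤ρ j≤ρ Γx Γy e with ≤-total i j
  ... | inj₁ i≤j = Γ-unique-≤ T i≤j j≤ρ Γx Γy e
  ... | inj₂ j≤i = sym (Γ-unique-≤ T j≤i i≤ρ Γy Γx (sym e))

  -- Two points of `D T` that differ by at most `ρ` steps differ by an element of `D (T + T)`, hence
  -- by fewer than `r₀` steps. A further ascent from the highest point reached would remain below
  -- 2r₀ ≤ ρ steps from d and contradict maximality.
  top : ∀ T d → T + T ≤ Tₘ → D T ∋ d → Σ ℕ λ i → i < r₀ × Γ T ∋ d ⊞ i · b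
  top T d 2T≤ Dd with maximum (λ i → dec (D T) (d ⊞ i · b)) ρ (subst (D T ∋_) (sym (identityʳ d)) Dd)
  ... | i , i≤ρ , Di , max = i , i<r₀ , Di , λ { (c , c<ρ , q) → above c c<ρ q }
    where
    climb : ∀ x c → D T ∋ x → c ≤ ρ → D T ∋ x ⊞ c · b → c < r₀
    climb x c Dx c≤ρ q = cluster (T + T) c 2T≤ c≤ρ (index-difference T {0} {c} b (x ⊞ c · b) x z≤n q Dx (identityʳ _))
    i<r₀ : i < r₀
    i<r₀ = climb d i Dd i≤ρ Di
    above : ∀ c → c < ρ → ¬ (D T ∋ d ⊞ i · b ⊞ suc c · b)
    above c c<ρ q = max (i + suc c) (m<m+n i (s≤s z≤n)) (≤-trans (+-mono-≤ (<⇒≤ i<r₀) (<⇒≤ (climb (d ⊞ i · b) (suc c) Di c<ρ q))) 2r₀≤ρ)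
      (subst (D T ∋_) (trans (assoc d _ _) (cong (d ⊞_) (sym (·-+ b i (suc c))))) q)

  -- The `ρ` translates of the tops along b are disjoint and lie in `D (T + ρ * M)`. Since T ≤ ρ,
  -- division by `ρ` leaves a bound that does not depend on T.
  Γ-bound : ∀ T → 1 ≤ T → T ≤ Tₘ → ⌊ Γ T ⌋ ≤ 9 * (suc M * k)
  Γ-bound T 1≤T T≤ = *-cancelʳ-≤ _ _ ρ ⦃ >-nonZero (≤-trans 1≤r₀ (≤-trans (m≤m+n r₀ r₀) 2r₀≤ρ)) ⦄ (begin
      ⌊ Γ T ⌋ * ρ  ≡⟨ cong (⌊ Γ T ⌋ *_) (sym (length-upTo ρ)) ⟩
      ⌊ Γ T ⌋ * length (upTo ρ)  ≡⟨ sym (length-⊗ (els U (Γ T)) (upTo ρ)) ⟩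
      length (els U (Γ T) ⊗ upTo ρ)  ≤⟨ length-inj R R-inj (els U (D (T + ρ * M))) (⊗-unique (els-unique (Γ T) U-unique) (Uniq.upTo⁺ ρ)) tot ⟩
      ⌊ D (T + ρ * M) ⌋  ≤⟨ D-upper (≤-trans 1≤T (m≤m+n T _)) (room-mono (+-monoˡ-≤ (ρ * M) T≤) room′) ⟩
      9 * ((T + ρ * M) * k)  ≤⟨ arith T ρ M k (≤-trans T≤ Tₘ≤ρ) ⟩
      9 * (suc M * k) * ρ  ∎)
    where
    open ≤-Reasoning
    arith : ∀ T ρ M k → T ≤ ρ → 9 * ((T + ρ * M) * k) ≤ 9 * (suc M * k) * ρ
    arith T ρ M k h = linear 0 ((9 * k) ⊛ h) (solve (T ∷ ρ ∷ M ∷ k ∷ []))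
    R : G × ℕ → G → Set
    R (x , i) y = (Γ T ∋ x) × i < ρ × x ⊞ i · b ≡ y
    R-inj : ∀ {u v y} → R u y → R v y → u ≡ v
    R-inj {x , i} {x′ , j} (Γx , i< , e) (Γx′ , j< , e′) with Γ-unique T (<⇒≤ i<) (<⇒≤ j<) Γx Γx′ (trans e (sym e′))
    ... | refl = cong (x ,_) (separated-index sep-ρ (<⇒≤ i<) (<⇒≤ j<) (D-𝟘 1) (D-𝟘 1) (cancelʳ x _ _
                   (trans (ac′ (i · b)) (trans (cong₂ _⊞_ refl (trans e (sym e′))) (sym (ac′ (j · b)))))))
      where
      ac′ : ∀ z → 𝟘 ⊞ z ⊞ x ≡ 𝟘 ⊞ (x ⊞ z)
      ac′ z = ac 3 (λ o z x → (o ∙ z) ∙ x ⊜ o ∙ (x ∙ z)) refl 𝟘 z x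
    tot : ∀ {u} → u ∈ els U (Γ T) ⊗ upTo ρ → Σ G λ y → (y ∈ els U (D (T + ρ * M))) × R u y
    tot {x , i} u∈ with ∈-⊗⁻ (els U (Γ T)) (upTo ρ) u∈
    ... | x∈ , i∈ with els-∈ U (Γ T) x∈
    ... | _ , Γx = x ⊞ i · b , ∈-els (D (T + ρ * M)) (U-full _) (D-⊞ T (ρ * M) x (i · b) (Γ⊂D T x Γx) (D-mono (i · b) (*-monoˡ-≤ M (<⇒≤ (∈-upTo⁻ i∈))) (D-· M i b b∈D))) , Γx , ∈-upTo⁻ i∈ , refl

  -- By separation each element of `D 1` is a cluster of its own.
  D₁⊂Γ₁ : ⌊ D 1 ⌋ ≤ ⌊ Γ 1 ⌋
  D₁⊂Γ₁ = mono (D 1) (Γ 1) λ x Dx → Dx , λ { (i , i<ρ , q) → sep-ρ (suc i) (s≤s z≤n) i<ρ (index-difference 1 {0} {suc i} b (x ⊞ suc i · b) x z≤n q Dx (identityʳ _)) }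

  -- The factor 8 is 1 + 7: `Γ T` and its translate by an element of `D (7 * T)` both lie in
  -- `D (8 * T)`, so if they belonged to different clusters there would be twice as many of them.
  Stable : ℕ → Set
  Stable T = ⌊ Γ (8 * T) ⌋ < 2 * ⌊ Γ T ⌋

  stable-or-grows : ∀ s → (Σ ℕ λ t → t < s × Stable (8 ^ t)) ⊎ (2 ^ s * ⌊ Γ 1 ⌋ ≤ ⌊ Γ (8 ^ s) ⌋)
  stable-or-grows zero = inj₂ (≤-reflexive (*-identityˡ _))
  stable-or-grows (suc s) with stable-or-grows s
  ... | inj₁ (t , t< , st) = inj₁ (t , m≤n⇒m≤1+n t< , st)
  ... | inj₂ q = conclude (⌊ Γ (8 * 8 ^ s) ⌋ <? 2 * ⌊ Γ (8 ^ s) ⌋)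
    where
    conclude : Dec (Stable (8 ^ s)) → (Σ ℕ λ t → t < suc s × Stable (8 ^ t)) ⊎ (2 ^ suc s * ⌊ Γ 1 ⌋ ≤ ⌊ Γ (8 ^ suc s) ⌋)
    conclude (yes st) = inj₁ (s , ≤-refl , st)
    conclude (no ¬st) = inj₂ (≤-trans (≤-reflexive (*-assoc 2 (2 ^ s) _)) (≤-trans (*-monoʳ-≤ 2 q) (≮⇒≥ ¬st)))

  -- Starting from more than k clusters, s doublings would give more than 2^s k of them, beyond the
  -- uniform bound 9(M + 1)k.
  stable-exists : ∀ s → 9 * suc M ≤ 2 ^ s → 2 * 8 ^ s ≤ Tₘ → Σ ℕ λ T → 1 ≤ T × 8 * T + 8 * T ≤ Tₘ × Stable T
  stable-exists s large fits with stable-or-grows s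
  ... | inj₁ (t , t<s , st) = 8 ^ t , m^n>0 8 t , ≤-trans (≤-trans (≤-reflexive (two (8 * 8 ^ t))) (*-monoʳ-≤ 2 (^-monoʳ-≤ 8 t<s))) fits , st
    where
    two : ∀ x → x + x ≡ 2 * x
    two = solve-∀
  ... | inj₂ q = ⊥-elim (<-irrefl refl (arith M k (2 ^ s) ⌊ Γ 1 ⌋ ⌊ Γ (8 ^ s) ⌋ large 1≤k (≤-trans (D-lower (s≤s z≤n) (room-mono (m≤n+m 1 (r₀ * M + r₀ * Tₘ)) room)) D₁⊂Γ₁) q
      (Γ-bound (8 ^ s) (m^n>0 8 s) (≤-trans (m≤n*m (8 ^ s) 2) fits))))
    where
    arith : ∀ M k e g z → 9 * suc M ≤ e → 1 ≤ k → 1 * k < g → e * g ≤ z → z ≤ 9 * (suc M * k) → 0 < 0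
    arith M k e g z h₁ h₂ h₃ h₄ h₅ = linear (8 + 9 * M) (k ⊛ h₁ ⊹ h₁ ⊹ e ⊛ h₃ ⊹ h₄ ⊹ h₅) (solve (M ∷ k ∷ e ∷ g ∷ z ∷ []))

  -- Says that z is a difference y - x of tops, up to fewer than `r₀` steps along b in either
  -- direction.
  Meets : ℕ → G → Set
  Meets T z = Σ ((G × G) × (ℕ × ℕ)) λ { ((x , y) , (i , j)) → Γ T ∋ x × Γ T ∋ y × i < r₀ × j < r₀ × x ⊞ z ⊞ i · b ≡ y ⊞ j · b }

  meets? : ∀ T z → Dec (Meets T z)
  meets? T z = map′ to from (∃? quads hit)
    where
    quads : List ((G × G) × (ℕ × ℕ))
    quads = (els U (Γ T) ⊗ els U (Γ T)) ⊗ (upTo r₀ ⊗ upTo r₀)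
    hit : Sub ((G × G) × (ℕ × ℕ))
    hit = ⟪ (λ q → (proj₁ (proj₁ q) ⊞ z ⊞ proj₁ (proj₂ q) · b) ≟ᴳ (proj₂ (proj₁ q) ⊞ proj₂ (proj₂ q) · b)) ⟫
    to : (Σ ((G × G) × (ℕ × ℕ)) λ q → q ∈ quads × hit ∋ q) → Meets T z
    to (q , q∈ , e) =
      let xy∈ , ij∈ = ∈-⊗⁻ (els U (Γ T) ⊗ els U (Γ T)) (upTo r₀ ⊗ upTo r₀) q∈
          x∈ , y∈ = ∈-⊗⁻ (els U (Γ T)) (els U (Γ T)) xy∈
          i∈ , j∈ = ∈-⊗⁻ (upTo r₀) (upTo r₀) ij∈
      in q , proj₂ (els-∈ U (Γ T) x∈) , proj₂ (els-∈ U (Γ T) y∈) , ∈-upTo⁻ i∈ , ∈-upTo⁻ j∈ , e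
    from : Meets T z → Σ ((G × G) × (ℕ × ℕ)) λ q → q ∈ quads × hit ∋ q
    from (q , Γx , Γy , i< , j< , e) = q ,
      ∈-⊗⁺ (∈-⊗⁺ (∈-els (Γ T) (U-full _) Γx) (∈-els (Γ T) (U-full _) Γy)) (∈-⊗⁺ (∈-upTo⁺ i<) (∈-upTo⁺ j<)) , e

  Column : Sub G → ℕ → G → Set
  Column Γ′ r z = Σ G λ γ → Σ ℕ λ e → Γ′ ∋ γ × e ≤ 2 * r × z ⊞ r · b ≡ γ ⊞ e · b

  column-equation : ∀ {z x y i j l r} → i + l ≤ r → x ⊞ z ⊞ i · b ≡ y ⊞ j · b →
    z ⊞ r · b ≡ y ⊝ x ⊞ l · b ⊞ ((r ∸ (i + l)) + j) · b
  column-equation {z} {x} {y} {i} {j} {l} {r} i+l≤ e = cancelʳ x _ _ (begin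
      z ⊞ r · b ⊞ x  ≡⟨ cong (λ w → z ⊞ w ⊞ x) (trans (·-∸ b i+l≤) (cong (c ⊞_) (·-+ b i l))) ⟩
      z ⊞ (c ⊞ (i · b ⊞ l · b)) ⊞ x  ≡⟨ ac 5 (λ z c i l x → (z ∙ (c ∙ (i ∙ l))) ∙ x ⊜ ((x ∙ z) ∙ i) ∙ (c ∙ l)) refl z c (i · b) (l · b) x ⟩
      x ⊞ z ⊞ i · b ⊞ (c ⊞ l · b)  ≡⟨ cong (_⊞ (c ⊞ l · b)) e ⟩
      y ⊞ j · b ⊞ (c ⊞ l · b)  ≡⟨ cong (λ w → w ⊞ j · b ⊞ (c ⊞ l · b)) (sym (⊖-⊞ y x)) ⟩
      y ⊝ x ⊞ x ⊞ j · b ⊞ (c ⊞ l · b)  ≡⟨ ac 5 (λ w x j c l → ((w ∙ x) ∙ j) ∙ (c ∙ l) ⊜ ((w ∙ l) ∙ (c ∙ j)) ∙ x) refl (y ⊝ x) x (j · b) c (l · b) ⟩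
      y ⊝ x ⊞ l · b ⊞ (c ⊞ j · b) ⊞ x  ≡⟨ cong (λ w → y ⊝ x ⊞ l · b ⊞ w ⊞ x) (sym (·-+ b (r ∸ (i + l)) j)) ⟩
      y ⊝ x ⊞ l · b ⊞ ((r ∸ (i + l)) + j) · b ⊞ x  ∎)
    where
    open ≡-Reasoning
    c : G
    c = (r ∸ (i + l)) · b

  meets⇒column : ∀ T z → 8 * T + 8 * T ≤ Tₘ → Meets T z → Column (Γ (2 * T)) (2 * r₀) z
  meets⇒column T z 16T≤ (((x , y) , (i , j)) , Γx , Γy , i< , j< , e) = build (top (2 * T) (y ⊝ x) 4T≤ (subst (λ S → D S ∋ y ⊝ x) (two T) (D-⊖ T T y x (Γ⊂D T y Γy) (Γ⊂D T x Γx))))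
    where
    two : ∀ T → T + T ≡ 2 * T
    two = solve-∀
    4T≤ : 2 * T + 2 * T ≤ Tₘ
    4T≤ = ≤-trans (+-mono-≤ (*-monoˡ-≤ T {2} {8} (s≤s (s≤s z≤n))) (*-monoˡ-≤ T {2} {8} (s≤s (s≤s z≤n)))) 16T≤
    build : (Σ ℕ λ l → l < r₀ × (Γ (2 * T) ∋ y ⊝ x ⊞ l · b)) → Column (Γ (2 * T)) (2 * r₀) z
    -- Here z = (y - x) + (j - i)·b and the top is (y - x) + l·b, so the displacement is j - i - l.
    -- Adding 2r₀ > i + l keeps it a natural number, which fixes r = 2r₀ for the column system.
    build (l , l< , Γγ) = y ⊝ x ⊞ l · b , (2 * r₀ ∸ (i + l)) + j , Γγ ,
        ≤-trans (+-mono-≤ (m∸n≤m (2 * r₀) (i + l)) (≤-trans (<⇒≤ j<) (m≤m+n r₀ _))) (≤-reflexive (cong (2 * r₀ +_) (sym (+-identityʳ (2 * r₀))))) ,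
        column-equation {i = i} {j} {l} (≤-trans (+-mono-≤ (<⇒≤ i<) (<⇒≤ l<)) (≤-reflexive (cong (r₀ +_) (sym (+-identityʳ r₀))))) e

  -- Both `Γ T` and its translate by z are pushed up to the tops of `D (8 * T)`. A coincidence of
  -- two of these tops is excluded by uniqueness inside one family and by `none` across the
  -- families.
  module Disjoint (T : ℕ) (z : G) (16T≤ : 8 * T + 8 * T ≤ Tₘ) (Dz : D (7 * T) ∋ z) (none : ¬ Meets T z) where

    moved : Bool → G → G
    moved true  x = x
    moved false x = x ⊞ z

    R : Bool × G → G → Set
    R (s , x) y = (Γ T ∋ x) × (Σ ℕ λ i → i < r₀ × moved s x ⊞ i · b ≡ y)

    r₀≤ρ : r₀ ≤ ρ
    r₀≤ρ = ≤-trans (m≤m+n r₀ r₀) 2r₀≤ρ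

    R-inj : ∀ {u v y} → R u y → R v y → u ≡ v
    R-inj {true , x} {true , x′} (Γx , i , i< , e) (Γx′ , j , j< , e′) = cong (true ,_) (Γ-unique T (≤-trans (<⇒≤ i<) r₀≤ρ) (≤-trans (<⇒≤ j<) r₀≤ρ) Γx Γx′ (trans e (sym e′)))
    R-inj {false , x} {false , x′} (Γx , i , i< , e) (Γx′ , j , j< , e′) = cong (false ,_) (Γ-unique T (≤-trans (<⇒≤ i<) r₀≤ρ) (≤-trans (<⇒≤ j<) r₀≤ρ) Γx Γx′
      (cancelʳ z _ _ (trans (⊞-swap x (i · b) z) (trans (trans e (sym e′)) (⊞-swap x′ z (j · b))))))
    R-inj {true , x} {false , x′} (Γx , i , i< , e) (Γx′ , j , j< , e′) = ⊥-elim (none (((x′ , x) , (j , i)) , Γx′ , Γx , j< , i< , trans e′ (sym e)))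
    R-inj {false , x} {true , x′} (Γx , i , i< , e) (Γx′ , j , j< , e′) = ⊥-elim (none (((x , x′) , (i , j)) , Γx , Γx′ , i< , j< , trans e (sym e′)))

    moved-D : ∀ s x → Γ T ∋ x → D (8 * T) ∋ moved s x
    moved-D true  x q = D-mono x (m≤n*m T 8) (Γ⊂D T x q)
    moved-D false x q = D-⊞ T (7 * T) x z (Γ⊂D T x q) Dz

    signs : List Bool
    signs = true ∷ false ∷ []

    tot : ∀ {u} → u ∈ signs ⊗ els U (Γ T) → Σ G λ y → (y ∈ els U (Γ (8 * T))) × R u y
    tot {s , x} u∈ =
      let Γx = proj₂ (els-∈ U (Γ T) (proj₂ (∈-⊗⁻ signs (els U (Γ T)) u∈)))
          i , i< , Γy = top (8 * T) (moved s x) 16T≤ (moved-D s x Γx)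
      in moved s x ⊞ i · b , ∈-els (Γ (8 * T)) (U-full _) Γy , Γx , i , i< , refl

    doubled : 2 * ⌊ Γ T ⌋ ≤ ⌊ Γ (8 * T) ⌋
    doubled = ≤-trans (≤-reflexive (sym (length-⊗ signs (els U (Γ T)))))
      (length-inj R R-inj (els U (Γ (8 * T))) (⊗-unique (((λ ()) ∷ᴬ []ᴬ) ∷ᴾ ([]ᴬ ∷ᴾ []ᴾ)) (els-unique (Γ T) U-unique)) tot)

  stability : ∀ T → 8 * T + 8 * T ≤ Tₘ → Stable T → ∀ z → D (7 * T) ∋ z → Column (Γ (2 * T)) (2 * r₀) z
  stability T 16T≤ st z Dz = conclude (meets? T z)
    where
    conclude : Dec (Meets T z) → Column (Γ (2 * T)) (2 * r₀) z
    conclude (yes m)   = meets⇒column T z 16T≤ m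
    conclude (no none) = ⊥-elim (<⇒≱ st (Disjoint.doubled T z 16T≤ Dz none))

-- Columns

-- The outcome of the cluster analysis: `Γ` is closed under addition up to at most `r` steps along
-- b. The level 7T accommodates an element of `Γ`, at level 2T, plus a shift at level 5T.
record ColumnSystem {𝔾 : PrimeGroup} {A : Sub (PrimeGroup.G 𝔾)} {k : ℕ} (small : Small 𝔾 A k) : Set₁ where
  open Structure small
  field
    M T r ρ   : ℕ
    b         : G
    Γ         : Sub G
    b≢𝟘       : b ≢ 𝟘
    b∈D       : D M ∋ b
    Γ⊂D       : ∀ γ → Γ ∋ γ → D (2 * T) ∋ γ
    Γ-unique  : ∀ {γ γ′ i j} → i ≤ ρ → j ≤ ρ → Γ ∋ γ → Γ ∋ γ′ → γ ⊞ i · b ≡ γ′ ⊞ j · b → γ ≡ γ′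
    γ₀        : G
    γ₀∈Γ      : Γ ∋ γ₀
    1≤T       : 1 ≤ T
    ρ-large   : 4 * r + 2 ≤ ρ
    -- The signed displacement is e − r.
    column    : ∀ z → D (7 * T) ∋ z → Σ G λ γ → Σ ℕ λ e → Γ ∋ γ × e ≤ 2 * r × z ⊞ r · b ≡ γ ⊞ e · b

module Columns {𝔾 : PrimeGroup} {A : Sub (PrimeGroup.G 𝔾)} {k : ℕ} {small : Small 𝔾 A k} (system : ColumnSystem small) where

  open Structure small public
  open ColumnSystem system public

  N : ℕ
  N = ⌊ Γ ⌋

  1≤N : 1 ≤ N
  1≤N = nonempty Γ γ₀ γ₀∈Γ

  -- Counts columns of Y + 1 cells lengthened by 2r at both ends. This is the extent of the set that
  -- must not exhaust the group in `Return`.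
  Fits : ℕ → Set
  Fits Y = N * suc (Y + 4 * r) < p

  NoReturn : ℕ → Set
  NoReturn Y = ∀ y → 1 ≤ y → y ≤ Y → ∀ γ γ′ → Γ ∋ γ → Γ ∋ γ′ → γ ⊞ y · b ≢ γ′

  Γ-level-≤ : ∀ {Y} → NoReturn Y → ∀ {γ γ′ i j} → i ≤ j → j ≤ Y → Γ ∋ γ → Γ ∋ γ′ → γ ⊞ i · b ≡ γ′ ⊞ j · b → (γ , i) ≡ (γ′ , j)
  Γ-level-≤ nr {γ} {γ′} {i} {j} i≤j j≤Y Γγ Γγ′ e = go (j ∸ i) refl
    where
    go : ∀ c → j ∸ i ≡ c → (γ , i) ≡ (γ′ , j)
    go zero    eq = cong₂ _,_ (trans (shift-difference b γ γ′ i≤j e) (trans (cong (λ c → γ′ ⊞ c · b) eq) (identityʳ γ′))) (≤-antisym i≤j (m∸n≡0⇒m≤n eq))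
    go (suc c) eq = ⊥-elim (nr (suc c) (s≤s z≤n) (≤-trans (≤-trans (≤-reflexive (sym eq)) (m∸n≤m j i)) j≤Y) γ′ γ Γγ′ Γγ
                      (sym (trans (shift-difference b γ γ′ i≤j e) (cong (λ c → γ′ ⊞ c · b) eq))))

  Γ-level : ∀ {Y} → NoReturn Y → ∀ {γ γ′ i j} → i ≤ Y → j ≤ Y → Γ ∋ γ → Γ ∋ γ′ → γ ⊞ i · b ≡ γ′ ⊞ j · b → (γ , i) ≡ (γ′ , j)
  Γ-level nr {i = i} {j} i≤Y j≤Y Γγ Γγ′ e with ≤-total i j
  ... | inj₁ i≤j = Γ-level-≤ nr i≤j j≤Y Γγ Γγ′ e
  ... | inj₂ j≤i = sym (Γ-level-≤ nr j≤i i≤Y Γγ′ Γγ (sym e))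

  column-≤ : ∀ S z → S ≤ 7 * T → D S ∋ z → Σ G λ γ → Σ ℕ λ e → Γ ∋ γ × e ≤ 2 * r × z ⊞ r · b ≡ γ ⊞ e · b
  column-≤ S z S≤ Dz = column z (D-mono z S≤ Dz)

  4T≤ : 2 * T + 2 * T ≤ 7 * T
  4T≤ = ≤-trans (≤-reflexive (sym (*-distribʳ-+ T 2 2))) (*-monoˡ-≤ T {4} {7} (s≤s (s≤s (s≤s (s≤s z≤n)))))

  -- If Γ returned to itself after y steps, Γ + [0,y)b would be almost closed under addition.
  module Return (y : ℕ) (nr : NoReturn y) (γ₁ γ₂ : G) (Γγ₁ : Γ ∋ γ₁) (Γγ₂ : Γ ∋ γ₂) (back : γ₁ ⊞ suc y · b ≡ γ₂) where

    P Z : Sub G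
    P = ⟪ (λ x → ∃<? (suc y) (λ i → dec Γ (x ⊝ i · b))) ⟫
    -- This is `Γ` plus the multiples of b from -2r to y + 1 + 2r; the shift by 2r makes the index
    -- natural.
    Z = ⟪ (λ x → ∃<? (suc (suc y + 4 * r)) (λ i → dec Γ (x ⊞ (2 * r) · b ⊝ i · b))) ⟫

    |P|≥ : N * suc y ≤ ⌊ P ⌋
    |P|≥ = begin
      N * suc y  ≡⟨ cong (N *_) (sym (length-upTo (suc y))) ⟩
      N * length (upTo (suc y))  ≡⟨ sym (length-⊗ (els U Γ) (upTo (suc y))) ⟩
      length (els U Γ ⊗ upTo (suc y))  ≤⟨ length-inj R R-inj (els U P) (⊗-unique (els-unique Γ U-unique) (Uniq.upTo⁺ (suc y))) tot ⟩
      ⌊ P ⌋  ∎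
      where
      open ≤-Reasoning
      R : G × ℕ → G → Set
      R (γ , i) x = (Γ ∋ γ) × i ≤ y × γ ⊞ i · b ≡ x
      R-inj : ∀ {u v x} → R u x → R v x → u ≡ v
      R-inj (Γγ , i≤ , e) (Γγ′ , j≤ , e′) = Γ-level nr i≤ j≤ Γγ Γγ′ (trans e (sym e′))
      tot : ∀ {u} → u ∈ els U Γ ⊗ upTo (suc y) → Σ G λ x → x ∈ els U P × R u x
      tot {γ , i} u∈ =
        let γ∈ , i∈ = ∈-⊗⁻ (els U Γ) (upTo (suc y)) u∈
            Γγ = proj₂ (els-∈ U Γ γ∈)
        in γ ⊞ i · b , ∈-els P (U-full _) (i , ∈-upTo⁻ i∈ , subst (Γ ∋_) (sym (⊞-⊖ γ (i · b))) Γγ) , Γγ , s≤s⁻¹ (∈-upTo⁻ i∈) , refl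

    |Z|≤ : ⌊ Z ⌋ ≤ N * suc (suc y + 4 * r)
    |Z|≤ = begin
      ⌊ Z ⌋  ≤⟨ length-inj R (λ {x} {x′} {v} → R-inj {x} {x′} {v}) (els U Γ ⊗ upTo (suc (suc y + 4 * r))) (els-unique Z U-unique) tot ⟩
      length (els U Γ ⊗ upTo (suc (suc y + 4 * r)))  ≡⟨ length-⊗ (els U Γ) (upTo (suc (suc y + 4 * r))) ⟩
      N * length (upTo (suc (suc y + 4 * r)))  ≡⟨ cong (N *_) (length-upTo (suc (suc y + 4 * r))) ⟩
      N * suc (suc y + 4 * r)  ∎
      where
      open ≤-Reasoning
      R : G → G × ℕ → Set
      R x (γ , i) = x ⊞ (2 * r) · b ≡ γ ⊞ i · b
      R-inj : ∀ {x x′ v} → R x v → R x′ v → x ≡ x′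
      R-inj e e′ = cancelʳ _ _ _ (trans e (sym e′))
      tot : ∀ {x} → x ∈ els U Z → Σ (G × ℕ) λ v → (v ∈ els U Γ ⊗ upTo (suc (suc y + 4 * r))) × R x v
      tot {x} x∈ =
        let _ , (i , i< , Γγ) = els-∈ U Z x∈
        in (x ⊞ (2 * r) · b ⊝ i · b , i) , ∈-⊗⁺ (∈-els Γ (U-full _) Γγ) (∈-upTo⁺ i<) , sym (⊖-⊞ _ (i · b))

    y·b∈D : D (4 * T) ∋ suc y · b
    y·b∈D = subst (λ S → D S ∋ suc y · b) (four T)
      (subst (D (2 * T + 2 * T) ∋_) (trans (cong (_⊝ γ₁) (trans (sym back) (comm γ₁ _))) (⊞-⊖ _ γ₁)) (D-⊖ (2 * T) (2 * T) γ₂ γ₁ (Γ⊂D γ₂ Γγ₂) (Γ⊂D γ₁ Γγ₁)))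
      where
      four : ∀ T → 2 * T + 2 * T ≡ 4 * T
      four = solve-∀

    in-Z : ∀ {x γ i} → Γ ∋ γ → i ≤ suc y + 4 * r → x ⊞ (2 * r) · b ≡ γ ⊞ i · b → Z ∋ x
    in-Z {x} {γ} {i} Γγ i≤ e = i , s≤s i≤ , subst (Γ ∋_) (sym (trans (cong (_⊝ i · b) e) (⊞-⊖ γ (i · b)))) Γγ

    2r·b : (2 * r) · b ≡ r · b ⊞ r · b
    2r·b = trans (cong (λ s → (r + s) · b) (+-identityʳ r)) (·-+ b r r)

    -- As (y + 1)·b is a difference of two elements of `Γ`, it lies in `D (4 * T)`, and γ + (y +
    -- 1)·b is again on a column up to `r` steps. One such reduction suffices, since the index of a
    -- sum is at most 2y + 2r.
    reduce : ∀ x γ i → Γ ∋ γ → i ≤ 2 * r + (y + y) → x ⊞ r · b ≡ γ ⊞ i · b → Z ∋ x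
    reduce x γ i Γγ i≤ e with i ≤? y
    ... | yes i≤y = in-Z Γγ (≤-trans (+-mono-≤ (m≤n⇒m≤1+n i≤y) (m≤n*m r 4)) ≤-refl) (begin
        x ⊞ (2 * r) · b  ≡⟨ cong (x ⊞_) 2r·b ⟩
        x ⊞ (r · b ⊞ r · b)  ≡⟨ sym (assoc x _ _) ⟩
        x ⊞ r · b ⊞ r · b  ≡⟨ cong (_⊞ r · b) e ⟩
        γ ⊞ i · b ⊞ r · b  ≡⟨ trans (assoc γ _ _) (cong (γ ⊞_) (sym (·-+ b i r))) ⟩
        γ ⊞ (i + r) · b  ∎)
      where open ≡-Reasoning
    ... | no i≰y = build (column-≤ (2 * T + 4 * T) (γ ⊞ suc y · b) 6T≤ (D-⊞ (2 * T) (4 * T) γ (suc y · b) (Γ⊂D γ Γγ) y·b∈D))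
      where
      6T≤ : 2 * T + 4 * T ≤ 7 * T
      6T≤ = ≤-trans (≤-reflexive (sym (*-distribʳ-+ T 2 4))) (*-monoˡ-≤ T (n≤1+n 6))
      build : (Σ G λ γ′ → Σ ℕ λ e → Γ ∋ γ′ × e ≤ 2 * r × γ ⊞ suc y · b ⊞ r · b ≡ γ′ ⊞ e · b) → Z ∋ x
      build (γ′ , e′ , Γγ′ , e′≤ , eq) = in-Z Γγ′ bound (begin
          x ⊞ (2 * r) · b  ≡⟨ cong (x ⊞_) 2r·b ⟩
          x ⊞ (r · b ⊞ r · b)  ≡⟨ sym (assoc x _ _) ⟩
          x ⊞ r · b ⊞ r · b  ≡⟨ cong (_⊞ r · b) e ⟩
          γ ⊞ i · b ⊞ r · b  ≡⟨ cong (λ w → γ ⊞ w ⊞ r · b) (·-∸ b (≰⇒> i≰y)) ⟩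
          γ ⊞ ((i ∸ suc y) · b ⊞ suc y · b) ⊞ r · b  ≡⟨ ac 4 (λ γ c s r → (γ ∙ (c ∙ s)) ∙ r ⊜ ((γ ∙ s) ∙ r) ∙ c) refl γ ((i ∸ suc y) · b) (suc y · b) (r · b) ⟩
          γ ⊞ suc y · b ⊞ r · b ⊞ (i ∸ suc y) · b  ≡⟨ cong (_⊞ (i ∸ suc y) · b) eq ⟩
          γ′ ⊞ e′ · b ⊞ (i ∸ suc y) · b  ≡⟨ trans (assoc γ′ _ _) (cong (γ′ ⊞_) (sym (·-+ b e′ (i ∸ suc y)))) ⟩
          γ′ ⊞ (e′ + (i ∸ suc y)) · b  ∎)
        where
        open ≡-Reasoning
        arith : ∀ e r y d i → e ≤ 2 * r → d + suc y ≡ i → i ≤ 2 * r + (y + y) → e + d ≤ suc y + 4 * r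
        arith e r y d i h₁ refl h₂ = linear 2 (h₁ ⊹ h₂) (solve (e ∷ r ∷ y ∷ d ∷ []))
        bound : e′ + (i ∸ suc y) ≤ suc y + 4 * r
        bound = arith e′ r y (i ∸ suc y) i e′≤ (m∸n+n≡m (≰⇒> i≰y)) i≤

    sum : ∀ x x′ → P ∋ x → P ∋ x′ → Z ∋ x ⊞ x′
    sum x x′ (i , i< , Γγ) (i′ , i′< , Γγ′) = build (column-≤ (2 * T + 2 * T) (γ ⊞ γ′) 4T≤ (D-⊞ (2 * T) (2 * T) γ γ′ (Γ⊂D γ Γγ) (Γ⊂D γ′ Γγ′)))
      where
      γ γ′ : G
      γ = x ⊝ i · b
      γ′ = x′ ⊝ i′ · b
      build : (Σ G λ γ″ → Σ ℕ λ e → Γ ∋ γ″ × e ≤ 2 * r × γ ⊞ γ′ ⊞ r · b ≡ γ″ ⊞ e · b) → Z ∋ x ⊞ x′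
      build (γ″ , e , Γγ″ , e≤ , eq) = reduce (x ⊞ x′) γ″ (e + (i + i′)) Γγ″ (+-mono-≤ e≤ (+-mono-≤ (s≤s⁻¹ i<) (s≤s⁻¹ i′<))) (begin
          x ⊞ x′ ⊞ r · b  ≡⟨ cong₂ (λ u v → u ⊞ v ⊞ r · b) (sym (⊖-⊞ x (i · b))) (sym (⊖-⊞ x′ (i′ · b))) ⟩
          (γ ⊞ i · b) ⊞ (γ′ ⊞ i′ · b) ⊞ r · b  ≡⟨ ac 5 (λ γ i γ′ i′ r → ((γ ∙ i) ∙ (γ′ ∙ i′)) ∙ r ⊜ ((γ ∙ γ′) ∙ r) ∙ (i ∙ i′)) refl γ (i · b) γ′ (i′ · b) (r · b) ⟩
          γ ⊞ γ′ ⊞ r · b ⊞ (i · b ⊞ i′ · b)  ≡⟨ cong₂ _⊞_ eq (sym (·-+ b i i′)) ⟩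
          γ″ ⊞ e · b ⊞ (i + i′) · b  ≡⟨ trans (assoc γ″ _ _) (cong (γ″ ⊞_) (sym (·-+ b e (i + i′)))) ⟩
          γ″ ⊞ (e + (i + i′)) · b  ∎)
        where open ≡-Reasoning

    contradiction : ρ ≤ y → N * suc (suc y + 4 * r) < p → ⊥
    contradiction ρ≤y fits with cauchy-davenport P P Z (γ₀ ⊞ 0 · b) (γ₀ ⊞ 0 · b) γ₀∈P γ₀∈P sum
      where
      γ₀∈P : P ∋ γ₀ ⊞ 0 · b
      γ₀∈P = 0 , s≤s z≤n , subst (Γ ∋_) (sym (⊞-⊖ γ₀ 𝟘)) γ₀∈Γ
    ... | inj₁ p≤ = <⇒≱ fits (≤-trans p≤ |Z|≤)
    ... | inj₂ q  = <-irrefl refl (arith N y r ⌊ P ⌋ ⌊ Z ⌋ 1≤N |P|≥ |Z|≤ q (≤-trans ρ-large ρ≤y))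
      where
      arith : ∀ N y r P Z → 1 ≤ N → N * suc y ≤ P → Z ≤ N * suc (suc y + 4 * r) → P + P ≤ suc Z → 4 * r + 2 ≤ y → 0 < 0
      arith N y r P Z h₁ h₂ h₃ h₄ h₅ = linear 0 (2 ⊛ h₁ ⊹ 2 ⊛ h₂ ⊹ h₃ ⊹ h₄ ⊹ N ⊛ h₅) (solve (N ∷ y ∷ r ∷ P ∷ Z ∷ []))

  -- A return after at most `ρ` steps identifies the two tops, so that y·b = 0. A first return after
  -- more than `ρ` steps is refuted by Cauchy-Davenport, since doubling columns of that length adds
  -- more cells than the lengthening by 4r provides.
  no-return : ∀ Y → Fits Y → NoReturn Y
  no-return zero    fits y 1≤y y≤0 = ⊥-elim (<⇒≱ 1≤y y≤0)
  no-return (suc Y) fits y 1≤y y≤ γ γ′ Γγ Γγ′ back with m≤n⇒m<n∨m≡n y≤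
  ... | inj₁ y< = no-return Y (<-trans (*-monoʳ-< N ⦃ >-nonZero 1≤N ⦄ (n<1+n _)) fits) y 1≤y (s≤s⁻¹ y<) γ γ′ Γγ Γγ′ back
  ... | inj₂ refl with suc Y ≤? ρ
  ... | no Y≰ρ = Return.contradiction Y (no-return Y (<-trans (*-monoʳ-< N ⦃ >-nonZero 1≤N ⦄ (n<1+n _)) fits)) γ γ′ Γγ Γγ′ back (s≤s⁻¹ (≰⇒> Y≰ρ)) fits
  ... | yes Y≤ρ = b≢𝟘 (torsion-free (suc Y) b (s≤s z≤n) (≤-<-trans Y<p fits) (cancelʳ γ _ _ (trans (comm _ γ) (trans back (trans (sym γ≡γ′) (sym (identityˡ γ)))))))
    where
    γ≡γ′ : γ ≡ γ′
    γ≡γ′ = Γ-unique {i = suc Y} {j = 0} Y≤ρ z≤n Γγ Γγ′ (trans back (sym (identityʳ γ′)))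
    Y<p : suc Y ≤ N * suc (suc Y + 4 * r)
    Y<p = ≤-trans (≤-trans (m≤m+n (suc Y) (4 * r)) (n≤1+n _)) (m≤n*m _ N ⦃ >-nonZero 1≤N ⦄)

map-unique : {A B : Set} (g : A → B) → ∀ {xs} → Unique xs → (∀ x y → x ∈ xs → y ∈ xs → g x ≡ g y → x ≡ y) → Unique (map g xs)
map-unique g []ᴾ       inj = []ᴾ
map-unique g (x∉ ∷ᴾ u) inj = All.tabulate (λ y∈ e → fresh (∈-map⁻ g y∈) e) ∷ᴾ map-unique g u λ x y x∈ y∈ → inj x y (there x∈) (there y∈)
  where
  fresh : ∀ {y} → Σ _ (λ z → z ∈ _ × y ≡ g z) → g _ ≢ y
  fresh (z , z∈ , refl) e = All.lookup x∉ z∈ (inj _ z (here refl) (there z∈) e)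

-- Counting in windows of integers

∑-applyUpTo-∘ : ∀ (f g : ℕ → ℕ) w → ∑ (applyUpTo g w) f ≡ ∑ (upTo w) (λ i → f (g i))
∑-applyUpTo-∘ f g w = go f g (λ i → i) w
  where
  go : ∀ (f g h : ℕ → ℕ) w → ∑ (applyUpTo (λ i → g (h i)) w) f ≡ ∑ (applyUpTo h w) (λ i → f (g i))
  go f g h zero    = refl
  go f g h (suc w) = cong (f (g (h 0)) +_) (go f g (λ i → h (suc i)) w)

count : Sub ℕ → ℕ → ℕ → ℕ
count P l w = card (upTo w) ⟪ (λ i → dec P (l + i)) ⟫

private
  count-from : Sub ℕ → ℕ → ℕ → ℕ
  count-from P l zero    = 0
  count-from P l (suc w) = ⟦ dec P l ⟧ + count-from P (suc l) w

  ∑-applyUpTo : ∀ P l (g : ℕ → ℕ) w → (∀ i → g i ≡ l + i) → ∑ (applyUpTo g w) (λ i → ⟦ dec P i ⟧) ≡ count-from P l w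
  ∑-applyUpTo P l g zero    e = refl
  ∑-applyUpTo P l g (suc w) e = cong₂ _+_ (cong (λ i → ⟦ dec P i ⟧) (trans (e 0) (+-identityʳ l))) (∑-applyUpTo P (suc l) (λ i → g (suc i)) w λ i → trans (e (suc i)) (+-suc l i))

  count≡count-from : ∀ P l w → count P l w ≡ count-from P l w
  count≡count-from P l w = trans (card-∑ (upTo w) _) (trans (sym (∑-applyUpTo-∘ (λ i → ⟦ dec P i ⟧) (l +_) w)) (∑-applyUpTo P l (l +_) w λ _ → refl))

count-+ : ∀ P l c d → count P l (c + d) ≡ count P l c + count P (l + c) d
count-+ P l c d = trans (count≡count-from P l (c + d)) (trans (go l c) (sym (cong₂ _+_ (count≡count-from P l c) (count≡count-from P (l + c) d))))
  where
  go : ∀ l c → count-from P l (c + d) ≡ count-from P l c + count-from P (l + c) d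
  go l zero    = cong (λ m → count-from P m d) (sym (+-identityʳ l))
  go l (suc c) = trans (cong (⟦ dec P l ⟧ +_) (trans (go (suc l) c) (cong (λ m → count-from P (suc l) c + count-from P m d) (sym (+-suc l c))))) (sym (+-assoc ⟦ dec P l ⟧ _ _))

count-∁ : ∀ P l w → w ≤ count P l w + count (∁ P) l w
count-∁ P l w = ≤-trans (≤-reflexive (sym (length-upTo w))) (card-∁ (upTo w) ⟪ (λ i → dec P (l + i)) ⟫)

count-≤ : ∀ P l w → count P l w ≤ w
count-≤ P l w = ≤-trans (card≤length (upTo w) _) (≤-reflexive (length-upTo w))

-- The window [l + r , l + w + 2r) is moved down by the signed amount e − r.
window-shift : ∀ P l w r e → e ≤ 2 * r →
  count P (l + r) (w + r) + e ≤ count P (l + (2 * r ∸ e)) (w + r) + count (∁ P) l r + count P (l + r + w) r + r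
window-shift P l w r e e≤ with ≤-total r e
... | inj₁ r≤e = subst₂ (λ s e → count P (l + r) (w + r) + e ≤ count P (l + s) (w + r) + count (∁ P) l r + count P (l + r + w) r + r) s≡ e≡ main
  where
  d s : ℕ
  d = e ∸ r
  s = r ∸ d
  d≤r : d ≤ r
  d≤r = ≤-trans (∸-monoˡ-≤ r e≤) (≤-reflexive (trans (cong (_∸ r) (cong (r +_) (+-identityʳ r))) (m+n∸n≡m r r)))
  sd : s + d ≡ r
  sd = m∸n+n≡m d≤r
  e≡ : d + r ≡ e
  e≡ = m∸n+n≡m r≤e
  s≡ : s ≡ 2 * r ∸ e
  s≡ = sym (trans (cong₂ _∸_ (cong (r +_) (+-identityʳ r)) (sym (trans (+-comm r d) e≡))) ([m+n]∸[m+o]≡n∸o r r d))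
  W : ℕ
  W = w + r
  -- The window gains `d` cells at its lower end, in `P` except for those missing from the lowest
  -- strip, and gives up `d` cells at its upper end, which are in `P` only if counted in the highest
  -- strip.
  slide : count P (l + s) d + count P (l + r) W ≡ count P (l + s) W + count P (l + s + W) d
  slide = begin
    count P (l + s) d + count P (l + r) W  ≡⟨ cong (λ m → count P (l + s) d + count P m W) (trans (cong (l +_) (sym sd)) (sym (+-assoc l s d))) ⟩
    count P (l + s) d + count P (l + s + d) W  ≡⟨ sym (count-+ P (l + s) d W) ⟩
    count P (l + s) (d + W)  ≡⟨ cong (count P (l + s)) (+-comm d W) ⟩
    count P (l + s) (W + d)  ≡⟨ count-+ P (l + s) W d ⟩
    count P (l + s) W + count P (l + s + W) d  ∎
    where open ≡-Reasoning
  missing : count (∁ P) (l + s) d ≤ count (∁ P) l r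
  missing = ≤-trans (m≤n+m _ (count (∁ P) l s)) (≤-reflexive (trans (sym (count-+ (∁ P) l s d)) (cong (count (∁ P) l) sd)))
  present : count P (l + s + W) d ≤ count P (l + r + w) r
  present = ≤-trans (≤-reflexive (cong (λ m → count P m d) (reorder l s w r))) (≤-trans (m≤n+m _ (count P (l + r + w) s)) (≤-reflexive (trans (sym (count-+ P (l + r + w) s d)) (cong (count P (l + r + w)) sd))))
    where
    reorder : ∀ l s w r → l + s + (w + r) ≡ l + r + w + s
    reorder = solve-∀
  main : count P (l + r) W + (d + r) ≤ count P (l + s) W + count (∁ P) l r + count P (l + r + w) r + r
  main = arith _ _ _ _ _ _ _ d r slide (count-∁ P (l + s) d) missing present
    where
    arith : ∀ a b c a′ b′ m q d r → a + b ≡ c + a′ → d ≤ a + b′ → b′ ≤ m → a′ ≤ q → b + (d + r) ≤ c + m + q + r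
    arith a b c a′ b′ m q d r h₁ h₂ h₃ h₄ = linear 0 (≤-reflexive h₁ ⊹ h₂ ⊹ h₃ ⊹ h₄) (solve (a ∷ b ∷ c ∷ a′ ∷ b′ ∷ m ∷ q ∷ d ∷ r ∷ []))
-- Here the window moves up by r - e. It loses at most that many elements of `P`, and e + (r - e) =
-- r accounts for the last term.
... | inj₂ e≤r = begin
    count P (l + r) W + e  ≤⟨ +-monoˡ-≤ e (m≤m+n _ (count P (l + r + W) d)) ⟩
    count P (l + r) W + count P (l + r + W) d + e  ≡⟨ cong (_+ e) slide ⟩
    count P (l + r) d + count P (l + r + d) W + e  ≤⟨ +-monoˡ-≤ e (+-monoˡ-≤ _ (count-≤ P (l + r) d)) ⟩
    d + count P (l + r + d) W + e  ≡⟨ swap′ d _ e ⟩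
    count P (l + r + d) W + (d + e)  ≡⟨ cong₂ (λ m n → count P m W + n) bottom (m∸n+n≡m e≤r) ⟩
    count P (l + (2 * r ∸ e)) W + r  ≤⟨ +-monoˡ-≤ r (≤-trans (m≤m+n _ (count (∁ P) l r)) (m≤m+n _ (count P (l + r + w) r))) ⟩
    count P (l + (2 * r ∸ e)) W + count (∁ P) l r + count P (l + r + w) r + r  ∎
  where
  open ≤-Reasoning
  d W : ℕ
  d = r ∸ e
  W = w + r
  swap′ : ∀ a b c → a + b + c ≡ b + (a + c)
  swap′ = solve-∀
  slide : count P (l + r) W + count P (l + r + W) d ≡ count P (l + r) d + count P (l + r + d) W
  slide = trans (sym (count-+ P (l + r) W d)) (trans (cong (count P (l + r)) (+-comm W d)) (count-+ P (l + r) d W))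
  bottom : l + r + d ≡ l + (2 * r ∸ e)
  bottom = trans (+-assoc l r d) (cong (l +_) (trans (sym (+-∸-assoc r e≤r)) (cong (λ m → r + m ∸ e) (sym (+-identityʳ r)))))

-- Cells of the columns and the flux across them

module Picture {𝔾 : PrimeGroup} {A : Sub (PrimeGroup.G 𝔾)} {k : ℕ} {small : Small 𝔾 A k} (system : ColumnSystem small)
  (a₀ : PrimeGroup.G 𝔾) (Y : ℕ) (fits : Columns.Fits system Y) where

  open Columns system public

  nr : NoReturn Y
  nr = no-return Y fits

  pos : G → ℕ → G
  pos γ t = a₀ ⊞ (γ ⊞ t · b)

  pos-unique : ∀ {γ γ′ i j} → i ≤ Y → j ≤ Y → Γ ∋ γ → Γ ∋ γ′ → pos γ i ≡ pos γ′ j → (γ , i) ≡ (γ′ , j)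
  pos-unique i≤ j≤ Γγ Γγ′ e = Γ-level nr i≤ j≤ Γγ Γγ′ (cancelʳ a₀ _ _ (trans (comm _ a₀) (trans e (comm a₀ _))))

  -- The shift by z carries the column of γ to that of γ′ with displacement e - r.
  Act : G → G → G → ℕ → Set
  Act z γ γ′ e = (Γ ∋ γ′) × e ≤ 2 * r × γ ⊞ z ⊞ r · b ≡ γ′ ⊞ e · b

  act : ∀ {z} → D (5 * T) ∋ z → ∀ γ → Γ ∋ γ → Σ G λ γ′ → Σ ℕ λ e → Act z γ γ′ e
  act {z} Dz γ Γγ = column-≤ (2 * T + 5 * T) (γ ⊞ z) (≤-reflexive (sym (*-distribʳ-+ T 2 5))) (D-⊞ (2 * T) (5 * T) γ z (Γ⊂D γ Γγ) Dz)

  -- Eliminating γ′ from the two equations leaves γ₁ + e₂·b = γ₂ + e₁·b, and tops within `ρ` steps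
  -- of each other on a column coincide.
  act-inj : ∀ {z γ₁ γ₂ γ′ e₁ e₂} → Γ ∋ γ₁ → Γ ∋ γ₂ → Act z γ₁ γ′ e₁ → Act z γ₂ γ′ e₂ → γ₁ ≡ γ₂
  act-inj {z} {γ₁} {γ₂} {γ′} {e₁} {e₂} Γγ₁ Γγ₂ (_ , e₁≤ , q₁) (_ , e₂≤ , q₂) = Γ-unique (≤-trans e₂≤ 2r≤ρ) (≤-trans e₁≤ 2r≤ρ) Γγ₁ Γγ₂
      (cancelʳ (z ⊞ r · b) _ _ (begin
        γ₁ ⊞ e₂ · b ⊞ (z ⊞ r · b)  ≡⟨ ac 4 (λ g e z r → (g ∙ e) ∙ (z ∙ r) ⊜ ((g ∙ z) ∙ r) ∙ e) refl γ₁ (e₂ · b) z (r · b) ⟩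
        γ₁ ⊞ z ⊞ r · b ⊞ e₂ · b  ≡⟨ cong (_⊞ e₂ · b) q₁ ⟩
        γ′ ⊞ e₁ · b ⊞ e₂ · b  ≡⟨ ⊞-swap γ′ _ _ ⟩
        γ′ ⊞ e₂ · b ⊞ e₁ · b  ≡⟨ cong (_⊞ e₁ · b) (sym q₂) ⟩
        γ₂ ⊞ z ⊞ r · b ⊞ e₁ · b  ≡⟨ ac 4 (λ g e z r → ((g ∙ z) ∙ r) ∙ e ⊜ (g ∙ e) ∙ (z ∙ r)) refl γ₂ (e₁ · b) z (r · b) ⟩
        γ₂ ⊞ e₁ · b ⊞ (z ⊞ r · b)  ∎))
    where
    open ≡-Reasoning
    2r≤ρ : 2 * r ≤ ρ
    2r≤ρ = ≤-trans (*-monoˡ-≤ r {2} {4} (s≤s (s≤s z≤n))) (≤-trans (m≤m+n (4 * r) 2) ρ-large)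

  move : ∀ {z γ γ′ e} t → Act z γ γ′ e → r ≤ t + e → pos γ t ⊞ z ≡ pos γ′ (t + e ∸ r)
  move {z} {γ} {γ′} {e} t (_ , _ , q) r≤ = cancelʳ (r · b) _ _ (begin
      a₀ ⊞ (γ ⊞ t · b) ⊞ z ⊞ r · b  ≡⟨ ac 5 (λ a g t z r → ((a ∙ (g ∙ t)) ∙ z) ∙ r ⊜ a ∙ (((g ∙ z) ∙ r) ∙ t)) refl a₀ γ (t · b) z (r · b) ⟩
      a₀ ⊞ (γ ⊞ z ⊞ r · b ⊞ t · b)  ≡⟨ cong (λ w → a₀ ⊞ (w ⊞ t · b)) q ⟩
      a₀ ⊞ (γ′ ⊞ e · b ⊞ t · b)  ≡⟨ cong (a₀ ⊞_) (trans (assoc γ′ _ _) (cong (γ′ ⊞_) (trans (comm _ _) (sym (·-+ b t e))))) ⟩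
      a₀ ⊞ (γ′ ⊞ (t + e) · b)  ≡⟨ cong (λ w → a₀ ⊞ (γ′ ⊞ w)) (·-∸ b r≤) ⟩
      a₀ ⊞ (γ′ ⊞ ((t + e ∸ r) · b ⊞ r · b))  ≡⟨ ac 4 (λ a g t r → a ∙ (g ∙ (t ∙ r)) ⊜ (a ∙ (g ∙ t)) ∙ r) refl a₀ γ′ ((t + e ∸ r) · b) (r · b) ⟩
      a₀ ⊞ (γ′ ⊞ (t + e ∸ r) · b) ⊞ r · b  ∎)
    where open ≡-Reasoning

  Cell : ℕ → ℕ → G → Set
  Cell l w x = Σ G λ γ → Σ ℕ λ t → Γ ∋ γ × l ≤ t × t < l + w × x ≡ pos γ t

  cells : ℕ → List (G × ℕ)
  cells w = els U Γ ⊗ upTo w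

  cells-unique : ∀ w → Unique (cells w)
  cells-unique w = ⊗-unique (els-unique Γ U-unique) (Uniq.upTo⁺ w)

  ∈-cells : ∀ {w γ i} → Γ ∋ γ → i < w → (γ , i) ∈ cells w
  ∈-cells Γγ i< = ∈-⊗⁺ (∈-els Γ (U-full _) Γγ) (∈-upTo⁺ i<)

  cells-∈ : ∀ w {γ i} → (γ , i) ∈ cells w → Γ ∋ γ × i < w
  cells-∈ w u∈ = let γ∈ , i∈ = ∈-⊗⁻ (els U Γ) (upTo w) u∈ in proj₂ (els-∈ U Γ γ∈) , ∈-upTo⁻ i∈

  cell? : ∀ l w x → Dec (Cell l w x)
  cell? l w x = map′ to from (∃? (cells w) ⟪ (λ u → x ≟ᴳ pos (proj₁ u) (l + proj₂ u)) ⟫)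
    where
    to : (Σ (G × ℕ) λ u → u ∈ cells w × (x ≡ pos (proj₁ u) (l + proj₂ u))) → Cell l w x
    to ((γ , i) , u∈ , e) = let Γγ , i< = cells-∈ w u∈ in γ , l + i , Γγ , m≤m+n l i , +-monoʳ-< l i< , e
    from : Cell l w x → Σ (G × ℕ) λ u → u ∈ cells w × (x ≡ pos (proj₁ u) (l + proj₂ u))
    from (γ , t , Γγ , l≤t , t< , e) = (γ , t ∸ l) , ∈-cells Γγ (+-cancelˡ-< l _ _ (subst (_< l + w) (sym t≡) t<)) , trans e (cong (pos γ) (sym t≡))
      where
      t≡ : l + (t ∸ l) ≡ t
      t≡ = m+[n∸m]≡n l≤t

  Cols : ℕ → ℕ → Sub G
  Cols l w = ⟪ cell? l w ⟫

  cols-mono : ∀ {l w l′ w′} x → l′ ≤ l → l + w ≤ l′ + w′ → Cols l w ∋ x → Cols l′ w′ ∋ x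
  cols-mono x l≤ u≤ (γ , t , Γγ , l≤t , t< , e) = γ , t , Γγ , ≤-trans l≤ l≤t , ≤-trans t< u≤ , e

  cols-disjoint : ∀ {l w l′ w′} x → l + w ≤ l′ → l′ + w′ ≤ suc Y → Cols l w ∋ x → ¬ (Cols l′ w′ ∋ x)
  cols-disjoint {l} {w} {l′} {w′} x ≤l′ ≤Y (γ , t , Γγ , l≤t , t< , e) (γ′ , t′ , Γγ′ , l′≤t′ , t′< , e′) =
      <-irrefl (cong proj₂ (pos-unique (<⇒≤ (<-≤-trans t<t′ t′≤Y)) t′≤Y Γγ Γγ′ (trans (sym e) e′))) t<t′
    where
    t′≤Y : t′ ≤ Y
    t′≤Y = s≤s⁻¹ (≤-trans t′< ≤Y)
    t<t′ : t < t′
    t<t′ = <-≤-trans t< (≤-trans ≤l′ l′≤t′)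

  cols-split-≥ : ∀ X l c d → l + (c + d) ≤ suc Y → ⌊ X ⋂ Cols l c ⌋ + ⌊ X ⋂ Cols (l + c) d ⌋ ≤ ⌊ X ⋂ Cols l (c + d) ⌋
  cols-split-≥ X l c d ≤Y = card-disjoint U (X ⋂ Cols l (c + d)) (X ⋂ Cols l c) (X ⋂ Cols (l + c) d)
    (λ x _ q → proj₁ q , cols-mono x ≤-refl (+-monoʳ-≤ l (m≤m+n c d)) (proj₂ q))
    (λ x _ q → proj₁ q , cols-mono x (m≤m+n l c) (≤-reflexive (+-assoc l c d)) (proj₂ q))
    (λ x _ q q′ → cols-disjoint {l} {c} {l + c} {d} x ≤-refl (≤-trans (≤-reflexive (+-assoc l c d)) ≤Y) (proj₂ q) (proj₂ q′))

  column-count : Sub G → G → ℕ → ℕ → ℕ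
  column-count X γ = count ⟪ (λ t → dec X (pos γ t)) ⟫

  cols≤∑ : ∀ X l w → ⌊ X ⋂ Cols l w ⌋ ≤ ∑ (els U Γ) (λ γ → column-count X γ l w)
  cols≤∑ X l w = ≤-trans (card-inj (X ⋂ Cols l w) Q U-unique (λ x u → x ≡ pos (proj₁ u) (l + proj₂ u))
      (λ { x _ (Xx , γ , t , Γγ , l≤t , t< , e) → go x Xx γ t Γγ l≤t t< e }) (λ { x x′ u _ _ e e′ → trans e (sym e′) }))
      (≤-reflexive (∑-card-⊗ (els U Γ) (upTo w) Q))
    where
    Q : Sub (G × ℕ)
    Q = ⟪ (λ u → dec X (pos (proj₁ u) (l + proj₂ u))) ⟫
    go : ∀ x → X ∋ x → ∀ γ t → Γ ∋ γ → l ≤ t → t < l + w → x ≡ pos γ t → Σ (G × ℕ) λ u → u ∈ cells w × Q ∋ u × (x ≡ pos (proj₁ u) (l + proj₂ u))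
    go x Xx γ t Γγ l≤t t< e = (γ , t ∸ l) , ∈-cells Γγ (+-cancelˡ-< l _ _ (subst (_< l + w) (sym t≡) t<)) , subst (X ∋_) e′ Xx , e′
      where
      t≡ : l + (t ∸ l) ≡ t
      t≡ = m+[n∸m]≡n l≤t
      e′ : x ≡ pos γ (l + (t ∸ l))
      e′ = trans e (cong (pos γ) (sym t≡))

  ∑≤cols : ∀ X l w → l + w ≤ suc Y → ∑ (els U Γ) (λ γ → column-count X γ l w) ≤ ⌊ X ⋂ Cols l w ⌋
  ∑≤cols X l w ≤Y = ≤-trans (≤-reflexive (sym (∑-card-⊗ (els U Γ) (upTo w) Q)))
      (card-inj Q (X ⋂ Cols l w) (cells-unique w) (λ u x → Γ ∋ proj₁ u × proj₂ u < w × (x ≡ pos (proj₁ u) (l + proj₂ u)))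
        (λ { (γ , i) u∈ q → let Γγ , i< = cells-∈ w u∈ in pos γ (l + i) , U-full _ , (q , γ , l + i , Γγ , m≤m+n l i , +-monoʳ-< l i< , refl) , Γγ , i< , refl })
        (λ { (γ , i) (γ′ , i′) x _ _ (Γγ , i< , e) (Γγ′ , i′< , e′) → inj i< i′< (pos-unique (low i<) (low i′<) Γγ Γγ′ (trans (sym e) e′)) }))
    where
    Q : Sub (G × ℕ)
    Q = ⟪ (λ u → dec X (pos (proj₁ u) (l + proj₂ u))) ⟫
    low : ∀ {i} → i < w → l + i ≤ Y
    low i< = s≤s⁻¹ (≤-trans (+-monoʳ-< l i<) ≤Y)
    inj : ∀ {γ γ′ i i′} → i < w → i′ < w → (γ , l + i) ≡ (γ′ , l + i′) → (γ , i) ≡ (γ′ , i′)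
    inj {i = i} {i′} _ _ q = cong₂ _,_ (cong proj₁ q) (+-cancelˡ-≡ l i i′ (cong proj₂ q))

  cols-size : ∀ X l w → ⌊ X ⋂ Cols l w ⌋ ≤ N * w
  cols-size X l w = ≤-trans (cols≤∑ X l w) (∑-≤ (els U Γ) _ w λ γ _ → count-≤ ⟪ (λ t → dec X (pos γ t)) ⟫ l w)

  1≤5T : 1 ≤ 5 * T
  1≤5T = ≤-trans 1≤T (m≤n*m T 5)

  D₁⊂D₅ : ∀ j → D 1 ∋ j → D (5 * T) ∋ j
  D₁⊂D₅ j = D-mono j 1≤5T

  cell-move : ∀ {l w j} x → D 1 ∋ j → Cols (l + r) w ∋ x → Cols l (r + w + r) ∋ x ⊞ j
  cell-move {l} {w} {j} x Dj (γ , t , Γγ , l≤t , t< , eq) = build (act (D₁⊂D₅ j Dj) γ Γγ)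
    where
    arith : ∀ l w r t e t′ → t < l + r + w → e ≤ 2 * r → t′ + r ≡ t + e → t′ < l + (r + w + r)
    arith l w r t e t′ h₁ h₂ h₃ = linear 0 (h₁ ⊹ h₂ ⊹ ≤-reflexive h₃) (solve (l ∷ w ∷ r ∷ t ∷ e ∷ t′ ∷ []))
    build : (Σ G λ γ′ → Σ ℕ λ e → Act j γ γ′ e) → Cell l (r + w + r) (x ⊞ j)
    build (γ′ , e , ac@(Γγ′ , e≤ , _)) = γ′ , t + e ∸ r , Γγ′ , +-cancelʳ-≤ r l _ (≤-trans l≤t (≤-trans (m≤m+n t e) (≤-reflexive (sym t′+r)))) ,
        arith l w r t e _ t< e≤ t′+r , trans (cong (_⊞ j) eq) (move t ac r≤)
      where
      r≤ : r ≤ t + e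
      r≤ = ≤-trans (≤-trans (m≤n+m r l) l≤t) (m≤m+n t e)
      t′+r : t + e ∸ r + r ≡ t + e
      t′+r = m∸n+n≡m r≤

  -- A point leaves the part of `X` in the band either because its image is outside `X`, or because
  -- the image is in `X` but not in the band. In the second case it is within `r` cells of the band,
  -- as no displacement exceeds `r`.
  band-loss : ∀ X l w {j} → D 1 ∋ j →
    δ (X ⋂ Cols (l + r) w) j ≤ ⌊ lost X j ⋂ Cols (l + r) w ⌋ + (⌊ X ⋂ Cols l r ⌋ + ⌊ X ⋂ Cols (l + r + w) r ⌋)
  band-loss X l w {j} Dj = ≤-trans (card-cover U (lost M′ j) (lost X j ⋂ Cols (l + r) w) landing split)
      (+-monoʳ-≤ _ (≤-trans (card-cover U landing low high (λ _ _ q → q)) (+-mono-≤ (translate low (X ⋂ Cols l r) j λ _ q → q) (translate high (X ⋂ Cols (l + r + w) r) j λ _ q → q))))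
    where
    M′ low high landing : Sub G
    M′ = X ⋂ Cols (l + r) w
    low  = ⟪ (λ x → dec (X ⋂ Cols l r) (x ⊞ j)) ⟫
    high = ⟪ (λ x → dec (X ⋂ Cols (l + r + w) r) (x ⊞ j)) ⟫
    landing = low ⋃ high
    place : ∀ x → X ∋ x ⊞ j → ¬ (M′ ∋ x ⊞ j) → Cols l (r + w + r) ∋ x ⊞ j → landing ∋ x
    place x Xx ∉M (γ , t , Γγ , l≤t , t< , e) with t <? l + r | t <? l + r + w
    ... | yes q | _     = inj₁ (Xx , γ , t , Γγ , l≤t , q , e)
    ... | no q  | yes s = ⊥-elim (∉M (Xx , γ , t , Γγ , ≮⇒≥ q , s , e))
    ... | no q  | no s  = inj₂ (Xx , γ , t , Γγ , ≮⇒≥ s , ≤-trans t< (≤-reflexive (reorder l r w)) , e)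
      where
      reorder : ∀ l r w → l + (r + w + r) ≡ l + r + w + r
      reorder = solve-∀
    split : ∀ x → x ∈ U → lost M′ j ∋ x → (lost X j ⋂ Cols (l + r) w ∋ x) ⊎ (landing ∋ x)
    split x _ ((Xx , Cx) , ∉M) with dec X (x ⊞ j)
    ... | no q  = inj₁ ((Xx , q) , Cx)
    ... | yes q = inj₂ (place x q ∉M (cell-move x Dj Cx))

  module Flux (j : G) (Dj : D 1 ∋ j) where

    step : ∀ γ → Dec (Γ ∋ γ) → G × ℕ
    step γ (yes q) = let γ′ , e , _ = act (D₁⊂D₅ j Dj) γ q in γ′ , e
    -- A placeholder: the sums below run over `Γ` only.
    step γ (no _)  = γ , 0

    step-spec : ∀ γ (d : Dec (Γ ∋ γ)) → Γ ∋ γ → Act j γ (proj₁ (step γ d)) (proj₂ (step γ d))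
    step-spec γ (yes q) _ = let _ , _ , s = act (D₁⊂D₅ j Dj) γ q in s
    step-spec γ (no ¬q) q = ⊥-elim (¬q q)

    π : G → G
    π γ = proj₁ (step γ (dec Γ γ))

    e : G → ℕ
    e γ = proj₂ (step γ (dec Γ γ))

    π-e : ∀ {γ} → Γ ∋ γ → Act j γ (π γ) (e γ)
    π-e {γ} = step-spec γ (dec Γ γ)

    -- The total displacement of the overview is E - N·r.
    E : ℕ
    E = ∑ (els U Γ) e

    E≤ : E ≤ N * (2 * r)
    E≤ = ∑-≤ (els U Γ) e (2 * r) λ γ γ∈ → proj₁ (proj₂ (π-e (proj₂ (els-∈ U Γ γ∈))))

    landing : ℕ → ℕ → Sub G
    landing l w = ⟪ (λ x → dec (Cols l w) (x ⊞ j)) ⟫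

    -- Summed over `Γ`, `window-shift` compares the part of `A` in a fixed window with the points of
    -- `A` that j carries into it. Those of the latter that stay in `A` inject into the former under
    -- the shift by j, so that this number cancels and only the losses and the two edge strips
    -- remain.
    flux : ∀ l w → l + r + (w + r) + r ≤ suc Y →
      E ≤ ⌊ lost A j ⋂ landing (l + r) (w + r) ⌋ + (⌊ ∁ A ⋂ Cols l r ⌋ + ⌊ A ⋂ Cols (l + r + w) r ⌋) + N * r
    flux l w ≤Y = arith _ _ _ _ _ _ _ _ E (N * r) summed (cols≤∑ A (l + r) (w + r)) shifted (∑≤cols (∁ A) l r lowY) (∑≤cols A (l + r + w) r highY)
      where
      arith : ∀ a s m q A₁ L m′ q′ E Nr → a + E ≤ s + m + q + Nr → A₁ ≤ a → s ≤ L + A₁ → m ≤ m′ → q ≤ q′ → E ≤ L + (m′ + q′) + Nr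
      arith a s m q A₁ L m′ q′ E Nr h₁ h₂ h₃ h₄ h₅ = linear 0 (h₁ ⊹ h₂ ⊹ h₃ ⊹ h₄ ⊹ h₅) (solve (a ∷ s ∷ m ∷ q ∷ A₁ ∷ L ∷ m′ ∷ q′ ∷ E ∷ Nr ∷ []))
      lowY : l + r ≤ suc Y
      lowY = ≤-trans (≤-trans (m≤m+n (l + r) (w + r)) (m≤m+n _ r)) ≤Y
      highY : l + r + w + r ≤ suc Y
      highY = ≤-trans (≤-reflexive (+-assoc (l + r) w r)) (≤-trans (m≤m+n _ r) ≤Y)
      Q : Sub (G × ℕ)
      Q = ⟪ (λ u → dec A (pos (proj₁ u) (l + (2 * r ∸ e (proj₁ u)) + proj₂ u))) ⟫
      summed : ∑ (els U Γ) (λ γ → column-count A γ (l + r) (w + r)) + E ≤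
        card (cells (w + r)) Q + ∑ (els U Γ) (λ γ → column-count (∁ A) γ l r) + ∑ (els U Γ) (λ γ → column-count A γ (l + r + w) r) + N * r
      summed = begin
          ∑ Γs (λ γ → column-count A γ (l + r) (w + r)) + E  ≡⟨ sym (∑-+ Γs _ _) ⟩
          ∑ Γs (λ γ → column-count A γ (l + r) (w + r) + e γ)  ≤⟨ ∑-mono Γs (λ γ γ∈ → window-shift ⟪ (λ t → dec A (pos γ t)) ⟫ l w r (e γ) (proj₁ (proj₂ (π-e (proj₂ (els-∈ U Γ γ∈)))))) ⟩
          ∑ Γs (λ γ → f₁ γ + f₂ γ + f₃ γ + r)  ≡⟨ ∑-+ Γs (λ γ → f₁ γ + f₂ γ + f₃ γ) (λ _ → r) ⟩
          ∑ Γs (λ γ → f₁ γ + f₂ γ + f₃ γ) + ∑ Γs (λ _ → r)  ≡⟨ cong₂ _+_ (∑-+ Γs (λ γ → f₁ γ + f₂ γ) f₃) (∑-const Γs r) ⟩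
          ∑ Γs (λ γ → f₁ γ + f₂ γ) + ∑ Γs f₃ + N * r  ≡⟨ cong (λ s → s + ∑ Γs f₃ + N * r) (∑-+ Γs f₁ f₂) ⟩
          ∑ Γs f₁ + ∑ Γs f₂ + ∑ Γs f₃ + N * r  ≡⟨ cong (λ s → s + ∑ Γs f₂ + ∑ Γs f₃ + N * r) (sym (∑-card-⊗ Γs (upTo (w + r)) Q)) ⟩
          card (cells (w + r)) Q + ∑ Γs f₂ + ∑ Γs f₃ + N * r  ∎
        where
        open ≤-Reasoning
        Γs : List G
        Γs = els U Γ
        f₁ f₂ f₃ : G → ℕ
        f₁ γ = column-count A γ (l + (2 * r ∸ e γ)) (w + r)
        f₂ γ = column-count (∁ A) γ l r
        f₃ γ = column-count A γ (l + r + w) r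
      land : Sub G
      land = landing (l + r) (w + r)
      shifted : card (cells (w + r)) Q ≤ ⌊ lost A j ⋂ land ⌋ + ⌊ A ⋂ Cols (l + r) (w + r) ⌋
      shifted = ≤-trans (card-inj Q (A ⋂ land) (cells-unique (w + r)) R tot R-inj)
          (≤-trans (card-cover U (A ⋂ land) (lost A j ⋂ land) (kept A j ⋂ land) split)
            (+-monoʳ-≤ _ (translate (kept A j ⋂ land) (A ⋂ Cols (l + r) (w + r)) j λ x q → proj₂ (proj₁ q) , proj₂ q)))
        where
        level′ : G → ℕ → ℕ
        level′ γ i = l + (2 * r ∸ e γ) + i
        R : G × ℕ → G → Set
        R (γ , i) x = (Γ ∋ γ) × i < w + r × (x ≡ pos γ (level′ γ i))
        low : ∀ γ i → i < w + r → level′ γ i ≤ Y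
        low γ i i< = s≤s⁻¹ (≤-trans (s≤s (+-monoˡ-≤ i (+-monoʳ-≤ l (m∸n≤m (2 * r) (e γ))))) (≤-trans (bound l r w i i<) ≤Y))
          where
          bound : ∀ l r w i → i < w + r → suc (l + 2 * r + i) ≤ l + r + (w + r) + r
          bound l r w i h = linear 0 h (solve (l ∷ r ∷ w ∷ i ∷ []))
        R-inj : ∀ u u′ x → Q ∋ u → Q ∋ u′ → R u x → R u′ x → u ≡ u′
        R-inj (γ , i) (γ′ , i′) x _ _ (Γγ , i< , q) (Γγ′ , i′< , q′) = go (pos-unique (low γ i i<) (low γ′ i′ i′<) Γγ Γγ′ (trans (sym q) q′))
          where
          go : (γ , level′ γ i) ≡ (γ′ , level′ γ′ i′) → (γ , i) ≡ (γ′ , i′)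
          go s with cong proj₁ s
          ... | refl = cong (γ ,_) (+-cancelˡ-≡ (l + (2 * r ∸ e γ)) i i′ (cong proj₂ s))
        tot : ∀ u → u ∈ cells (w + r) → Q ∋ u → Σ G λ x → x ∈ U × A ⋂ land ∋ x × R u x
        tot (γ , i) u∈ q = pos γ (level′ γ i) , U-full _ , (q , π γ , l + r + i , proj₁ (π-e Γγ) , m≤m+n (l + r) i , +-monoʳ-< (l + r) i< ,
              trans (move (level′ γ i) (π-e Γγ) r≤) (cong (pos (π γ)) (trans (cong (_∸ r) total) (m+n∸n≡m _ r)))) , Γγ , i< , refl
          where
          Γγ : Γ ∋ γ
          Γγ = proj₁ (cells-∈ (w + r) u∈)
          i< : i < w + r
          i< = proj₂ (cells-∈ (w + r) u∈)
          total : level′ γ i + e γ ≡ l + r + i + r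
          total = trans (regroup l (2 * r ∸ e γ) i (e γ)) (trans (cong (λ s → l + s + i) (m∸n+n≡m (proj₁ (proj₂ (π-e Γγ))))) (double l r i))
            where
            regroup : ∀ l s i e → l + s + i + e ≡ l + (s + e) + i
            regroup = solve-∀
            double : ∀ l r i → l + 2 * r + i ≡ l + r + i + r
            double = solve-∀
          r≤ : r ≤ level′ γ i + e γ
          r≤ = ≤-trans (m≤n+m r (l + r + i)) (≤-reflexive (sym total))
        split : ∀ x → x ∈ U → A ⋂ land ∋ x → (lost A j ⋂ land ∋ x) ⊎ (kept A j ⋂ land ∋ x)
        split x _ (Ax , c) with lost-or-kept A j x Ax
        ... | inj₁ q = inj₁ (q , c)
        ... | inj₂ q = inj₂ (q , c)

    total : List G → G
    total = foldr _⊞_ 𝟘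

    total-↭ : ∀ {xs ys} → xs Perm.↭ ys → total xs ≡ total ys
    total-↭ Perm.refl = refl
    total-↭ (Perm.prep x q) = cong (x ⊞_) (total-↭ q)
    total-↭ (Perm.swap x y q) = trans (cong (λ s → x ⊞ (y ⊞ s)) (total-↭ q)) (ac 3 (λ x y s → x ∙ (y ∙ s) ⊜ y ∙ (x ∙ s)) refl x y _)
    total-↭ (Perm.trans q q′) = trans (total-↭ q) (total-↭ q′)

    total-shift : ∀ xs → (∀ {x} → x ∈ xs → Γ ∋ x) → total xs ⊞ length xs · j ⊞ (length xs * r) · b ≡ total (map π xs) ⊞ ∑ xs e · b
    total-shift []       Γxs = trans (identityʳ _) refl
    total-shift (x ∷ xs) Γxs = begin
        x ⊞ X ⊞ (j ⊞ J) ⊞ (r + length xs * r) · b  ≡⟨ cong (x ⊞ X ⊞ (j ⊞ J) ⊞_) (·-+ b r (length xs * r)) ⟩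
        x ⊞ X ⊞ (j ⊞ J) ⊞ (r · b ⊞ L)  ≡⟨ ac 6 (λ x X j J r L → ((x ∙ X) ∙ (j ∙ J)) ∙ (r ∙ L) ⊜ ((x ∙ j) ∙ r) ∙ ((X ∙ J) ∙ L)) refl x X j J (r · b) L ⟩
        x ⊞ j ⊞ r · b ⊞ (X ⊞ J ⊞ L)  ≡⟨ cong₂ _⊞_ (proj₂ (proj₂ (π-e (Γxs (here refl))))) (total-shift xs λ x∈ → Γxs (there x∈)) ⟩
        π x ⊞ e x · b ⊞ (total (map π xs) ⊞ ∑ xs e · b)  ≡⟨ ac 4 (λ p e t s → (p ∙ e) ∙ (t ∙ s) ⊜ (p ∙ t) ∙ (e ∙ s)) refl (π x) (e x · b) (total (map π xs)) (∑ xs e · b) ⟩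
        π x ⊞ total (map π xs) ⊞ (e x · b ⊞ ∑ xs e · b)  ≡⟨ cong (π x ⊞ total (map π xs) ⊞_) (sym (·-+ b (e x) (∑ xs e))) ⟩
        π x ⊞ total (map π xs) ⊞ (e x + ∑ xs e) · b  ∎
      where
      open ≡-Reasoning
      X J L : G
      X = total xs
      J = length xs · j
      L = (length xs * r) · b

    -- By `act-inj` the map `π` permutes `Γ`, so the tops have the same sum before and after the
    -- shift, and this sum cancels.
    E-equation : N · j ⊞ (N * r) · b ≡ E · b
    E-equation = cancelʳ (total Γs) _ _ (begin
        N · j ⊞ (N * r) · b ⊞ total Γs  ≡⟨ ac 3 (λ x y z → (x ∙ y) ∙ z ⊜ (z ∙ x) ∙ y) refl (N · j) ((N * r) · b) (total Γs) ⟩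
        total Γs ⊞ N · j ⊞ (N * r) · b  ≡⟨ total-shift Γs (λ x∈ → proj₂ (els-∈ U Γ x∈)) ⟩
        total (map π Γs) ⊞ E · b  ≡⟨ cong (_⊞ E · b) (total-↭ permuted) ⟩
        total Γs ⊞ E · b  ≡⟨ comm _ _ ⟩
        E · b ⊞ total Γs  ∎)
      where
      open ≡-Reasoning
      Γs : List G
      Γs = els U Γ
      Γ∈ : ∀ {x} → x ∈ Γs → Γ ∋ x
      Γ∈ x∈ = proj₂ (els-∈ U Γ x∈)
      sub : ∀ {y} → y ∈ map π Γs → y ∈ Γs
      sub y∈ with ∈-map⁻ π y∈
      ... | x , x∈ , refl = ∈-els Γ (U-full _) (proj₁ (π-e (Γ∈ x∈)))
      permuted : map π Γs Perm.↭ Γs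
      permuted = sublist-↭ Γs (map-unique π (els-unique Γ U-unique) λ x y x∈ y∈ q → act-inj (Γ∈ x∈) (Γ∈ y∈) (π-e (Γ∈ x∈)) (subst (λ g → Act j y g (e y)) (sym q) (π-e (Γ∈ y∈))))
        sub (≤-reflexive (sym (length-map π Γs)))

-- Quiet zones

InClass : (ℕ → ℕ) → ℕ → Sub ℕ
InClass m v = ⟪ (λ i → (m i ≤? v) ×-dec (v ≤? 2 * m i)) ⟫

dyadic : ∀ ℓ x → 1 ≤ x → x < 2 ^ ℓ → Σ ℕ λ s → s < ℓ × 2 ^ s ≤ x × x < 2 ^ suc s
dyadic zero    x 1≤x x<1 = ⊥-elim (<⇒≱ x<1 1≤x)
dyadic (suc ℓ) x 1≤x x< with 2 ^ ℓ ≤? x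
... | yes q = ℓ , ≤-refl , q , x<
... | no q = let s , s< , h = dyadic ℓ x 1≤x (≰⇒> q) in s , m≤n⇒m≤1+n s< , h

-- At most half of the 2ℓK values exceed V, for otherwise their sum would be too large. The others
-- lie between 1 and V < 2^ℓ, hence in ℓ dyadic classes, one of which has K members. The witness v
-- is the upper end of its interval, at most 2V because the class is not empty.
popular-class : ∀ (m : ℕ → ℕ) ℓ K V → V < 2 ^ ℓ → 1 ≤ K → 1 ≤ ℓ → (∀ i → i < 2 * (ℓ * K) → 1 ≤ m i) →
  2 * ∑ (upTo (2 * (ℓ * K))) m ≤ 2 * (ℓ * K) * suc V →
  Σ ℕ λ v → 1 ≤ v × v ≤ 2 * V × (K ≤ card (upTo (2 * (ℓ * K))) (InClass m v))
popular-class m ℓ K V V< 1≤K 1≤ℓ 1≤m total = conclude (some-or-none (upTo ℓ) popular)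
  where
  I : ℕ
  I = 2 * (ℓ * K)
  loud quiet : Sub ℕ
  loud  = ⟪ (λ i → V <? m i) ⟫
  quiet = ⟪ (λ i → ¬? (V <? m i)) ⟫
  class : ℕ → Sub ℕ
  class s = ⟪ (λ i → (¬? (V <? m i)) ×-dec ((2 ^ s ≤? m i) ×-dec (m i <? 2 ^ suc s))) ⟫
  popular : Sub ℕ
  popular = ⟪ (λ s → K ≤? card (upTo I) (class s)) ⟫
  loud-few : card (upTo I) loud * suc V ≤ ∑ (upTo I) m
  loud-few = ≤-trans (≤-reflexive (trans (cong (_* suc V) (card-∑ (upTo I) loud)) (trans (*-comm _ (suc V)) (sym (∑-* (upTo I) (suc V) _))))) (∑-mono (upTo I) λ i _ → pointwise i)
    where
    pointwise : ∀ i → suc V * ⟦ dec loud i ⟧ ≤ m i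
    pointwise i with V <? m i
    ... | yes q = ≤-trans (≤-reflexive (*-identityʳ (suc V))) q
    ... | no q  = ≤-trans (≤-reflexive (*-zeroʳ (suc V))) z≤n
  quiet-many : ℓ * K ≤ card (upTo I) quiet
  quiet-many = *-cancelʳ-≤ _ _ (2 * suc V) (arith (ℓ * K) V (card (upTo I) loud) (card (upTo I) quiet) (∑ (upTo I) m) loud-few total cover)
    where
    cover : 2 * (ℓ * K) ≤ card (upTo I) loud + card (upTo I) quiet
    cover = ≤-trans (count-∁ loud 0 I) ≤-refl
    arith : ∀ h V l q t → l * suc V ≤ t → 2 * t ≤ 2 * h * suc V → 2 * h ≤ l + q → h * (2 * suc V) ≤ q * (2 * suc V)
    arith h V l q t h₁ h₂ h₃ = linear 0 (2 ⊛ h₁ ⊹ h₂ ⊹ (2 * suc V) ⊛ h₃) (solve (h ∷ V ∷ l ∷ q ∷ t ∷ []))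
  quiet≤∑ : card (upTo I) quiet ≤ ∑ (upTo ℓ) (λ s → card (upTo I) (class s))
  quiet≤∑ = ≤-trans (card-inj quiet both (Uniq.upTo⁺ I) (λ i si → proj₂ si ≡ i) tot (λ { i i′ si _ _ refl refl → refl }))
      (≤-reflexive (∑-card-⊗ (upTo ℓ) (upTo I) both))
    where
    both : Sub (ℕ × ℕ)
    both = ⟪ (λ si → dec (class (proj₁ si)) (proj₂ si)) ⟫
    tot : ∀ i → i ∈ upTo I → quiet ∋ i → Σ (ℕ × ℕ) λ si → si ∈ upTo ℓ ⊗ upTo I × both ∋ si × proj₂ si ≡ i
    tot i i∈ q = let s , s< , lo , hi = dyadic ℓ (m i) (1≤m i (∈-upTo⁻ i∈)) (≤-<-trans (≮⇒≥ q) V<)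
      in (s , i) , ∈-⊗⁺ (∈-upTo⁺ s<) i∈ , (q , lo , hi) , refl
  conclude : _ ⊎ (∀ s → s ∈ upTo ℓ → ¬ (K ≤ card (upTo I) (class s))) → Σ ℕ λ v → 1 ≤ v × v ≤ 2 * V × (K ≤ card (upTo I) (InClass m v))
  conclude (inj₁ (s , _ , q)) = 2 ^ suc s , m^n>0 2 (suc s) , v≤ (some-or-none (upTo I) (class s)) ,
      ≤-trans q (card-mono (upTo I) (class s) (InClass m (2 ^ suc s)) λ { i _ (_ , lo , hi) → <⇒≤ hi , *-monoʳ-≤ 2 lo })
    where
    v≤ : _ ⊎ (∀ i → i ∈ upTo I → ¬ (class s ∋ i)) → 2 ^ suc s ≤ 2 * V
    v≤ (inj₁ (i , _ , c , lo , hi)) = *-monoʳ-≤ 2 (≤-trans lo (≮⇒≥ c))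
    v≤ (inj₂ none) = ⊥-elim (<⇒≱ 1≤K (≤-trans q (≤-reflexive (trans (card-∑ (upTo I) (class s)) (trans (∑-cong (upTo I) λ i i∈ → zeroed i (none i i∈)) (trans (∑-const (upTo I) 0) (*-zeroʳ (length (upTo I)))))))))
      where
      zeroed : ∀ i → ¬ (class s ∋ i) → ⟦ dec (class s) i ⟧ ≡ 0
      zeroed i ¬q with dec (class s) i
      ... | yes q = ⊥-elim (¬q q)
      ... | no _  = refl
  conclude (inj₂ none) = ⊥-elim (<⇒≱ (≤-trans (+-monoˡ-≤ S 1≤ℓ) bound) (≤-trans quiet-many quiet≤∑))
    where
    S : ℕ
    S = ∑ (upTo ℓ) (λ s → card (upTo I) (class s))
    bound : ℓ + S ≤ ℓ * K
    bound = begin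
      ℓ + S  ≡⟨ cong (_+ S) (sym (trans (∑-const (upTo ℓ) 1) (trans (*-identityʳ _) (length-upTo ℓ)))) ⟩
      ∑ (upTo ℓ) (λ _ → 1) + S  ≡⟨ sym (∑-+ (upTo ℓ) _ _) ⟩
      ∑ (upTo ℓ) (λ s → suc (card (upTo I) (class s)))  ≤⟨ ∑-≤ (upTo ℓ) _ K (λ s s∈ → ≰⇒> (none s s∈)) ⟩
      length (upTo ℓ) * K  ≡⟨ cong (_* K) (length-upTo ℓ) ⟩
      ℓ * K  ∎
      where open ≤-Reasoning

count-suc : ∀ P l w → count P l (suc w) ≡ count P l w + ⟦ dec P (l + w) ⟧
count-suc P l w = trans (cong (count P l) (+-comm 1 w)) (trans (count-+ P l w 1) (cong (count P l w +_) (trans (card-∑ (upTo 1) ⟪ (λ i → dec P (l + w + i)) ⟫) (trans (+-identityʳ _) (cong (λ i → ⟦ dec P i ⟧) (+-identityʳ (l + w)))))))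

count-one : ∀ P l → P ∋ l → count P l 1 ≡ 1
count-one P l q = trans (count-suc P l 0) (trans (cong (λ i → ⟦ dec P i ⟧) (+-identityʳ l)) (one (dec P l)))
  where
  one : (d : Dec (P ∋ l)) → ⟦ d ⟧ ≡ 1
  one (yes _) = refl
  one (no ¬q) = ⊥-elim (¬q q)

nth : ∀ P I x → x < count P 0 I → Σ ℕ λ i → i < I × P ∋ i × count P 0 i ≡ x
nth P zero    x ()
nth P (suc I) x x< = go (x <? count P 0 I) (dec P I) (subst (x <_) (count-suc P 0 I) x<)
  where
  go : Dec (x < count P 0 I) → (d : Dec (P ∋ I)) → x < count P 0 I + ⟦ d ⟧ → Σ ℕ λ i → i < suc I × P ∋ i × count P 0 i ≡ x
  go (yes q) _       _ = let i , i< , h = nth P I x q in i , m≤n⇒m≤1+n i< , h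
  go (no q)  (no _)  h = ⊥-elim (q (≤-trans h (≤-reflexive (+-identityʳ _))))
  go (no q)  (yes r) h = I , ≤-refl , r , ≤-antisym (≮⇒≥ q) (s≤s⁻¹ (≤-trans h (≤-reflexive (+-comm _ 1))))

-- Numbering starts at 0, so x is the number of earlier elements of `P`. The value 0 beyond the last
-- element is a placeholder.
nth′ : ∀ P I x → ℕ
nth′ P I x with x <? count P 0 I
... | yes q = proj₁ (nth P I x q)
... | no _  = 0

nth′-spec : ∀ P I x → x < count P 0 I → nth′ P I x < I × P ∋ nth′ P I x × (count P 0 (nth′ P I x) ≡ x)
nth′-spec P I x x< with x <? count P 0 I
... | yes q = proj₂ (nth P I x q)
... | no q  = ⊥-elim (q x<)

count-mono : ∀ P l {c d} → c ≤ d → count P l c ≤ count P l d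
count-mono P l {c} {d} c≤d = ≤-trans (m≤m+n _ (count P (l + c) (d ∸ c))) (≤-reflexive (trans (sym (count-+ P l c (d ∸ c))) (cong (count P l) (m+[n∸m]≡n c≤d))))

nth′-< : ∀ P I {x y} → x < y → y < count P 0 I → nth′ P I x < nth′ P I y
nth′-< P I {x} {y} x<y y< with nth′ P I y ≤? nth′ P I x
... | no q  = ≰⇒> q
... | yes q = ⊥-elim (<⇒≱ x<y (≤-trans (≤-reflexive (sym (proj₂ (proj₂ (nth′-spec P I y y<))))) (≤-trans (count-mono P 0 q) (≤-reflexive (proj₂ (proj₂ (nth′-spec P I x (<-trans x<y y<))))))))

nth′-between : ∀ P I {x} g → x + suc g < count P 0 I →
  count P (suc (nth′ P I x)) (nth′ P I (x + suc g) ∸ suc (nth′ P I x)) ≡ g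
nth′-between P I {x} g y< = +-cancelˡ-≡ (x + 1) _ _ (begin
    x + 1 + count P (suc i) (j ∸ suc i)  ≡⟨ cong (_+ count P (suc i) (j ∸ suc i)) (sym start) ⟩
    count P 0 (suc i) + count P (suc i) (j ∸ suc i)  ≡⟨ sym (count-+ P 0 (suc i) (j ∸ suc i)) ⟩
    count P 0 (suc i + (j ∸ suc i))  ≡⟨ cong (count P 0) (m+[n∸m]≡n (nth′-< P I x<y y<)) ⟩
    count P 0 j  ≡⟨ proj₂ (proj₂ (nth′-spec P I (x + suc g) y<)) ⟩
    x + suc g  ≡⟨ sym (+-assoc x 1 g) ⟩
    x + 1 + g  ∎)
  where
  open ≡-Reasoning
  x<y : x < x + suc g
  x<y = m<m+n x (s≤s z≤n)
  i j : ℕ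
  i = nth′ P I x
  j = nth′ P I (x + suc g)
  start : count P 0 (suc i) ≡ x + 1
  start = trans (cong (count P 0) (+-comm 1 i)) (trans (count-+ P 0 i 1) (cong₂ _+_ (proj₂ (proj₂ (nth′-spec P I x (<-trans x<y y<)))) (count-one P i (proj₁ (proj₂ (nth′-spec P I x (<-trans x<y y<)))))))

module Zones {𝔾 : PrimeGroup} {A : Sub (PrimeGroup.G 𝔾)} {k : ℕ} {small : Small 𝔾 A k} (system : ColumnSystem small)
  (a₀ : PrimeGroup.G 𝔾) (Y : ℕ) (fits : Columns.Fits system Y) where

  open Picture system a₀ Y fits public

  -- Poor strips of width `r` alternate with rich bands, so that by `band-loss` little of a band can
  -- escape into the rest of `X`. The factor 24 = 3·8 is what `level-bound` asks for at the
  -- threshold 8v.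
  record Bands (X : Sub G) (v s : ℕ) : Set where
    field
      l         : ℕ → ℕ
      l-step    : ∀ a → a < s → l a + r ≤ l (suc a)
      edge-poor : ∀ a → a ≤ s → ⌊ X ⋂ Cols (l a) r ⌋ ≤ v
      band-rich : ∀ a → a < s → 24 * v ≤ ⌊ X ⋂ Cols (l a + r) (l (suc a) ∸ (l a + r)) ⌋

  -- The flux window extends from `hi` of the inner zone to `lo` of the outer one, and in both zones
  -- the bands lie between `lo` and `hi`, away from that window. If v = 0, no bands are needed.
  record Quiet (X : Sub G) (O I V s : ℕ) : Set where
    field
      v lo hi : ℕ
      v≤      : v ≤ 2 * V
      O≤lo    : O ≤ lo
      lo≤     : lo + r ≤ O + I * r
      O≤hi    : O ≤ hi
      hi≤     : hi + r ≤ O + I * r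
      lo-poor : ⌊ X ⋂ Cols lo r ⌋ ≤ v
      hi-poor : ⌊ X ⋂ Cols hi r ⌋ ≤ v
      bands   : 1 ≤ v → Σ (Bands X v s) λ β → lo + r ≤ Bands.l β 0 × Bands.l β s ≤ hi

  module Blocks (X : Sub G) (O ℓ V s : ℕ) (1≤ℓ : 1 ≤ ℓ) (V< : V < 2 ^ ℓ)
    (inside : O + 2 * (ℓ * (2 + s * 49)) * r ≤ suc Y)
    (total : 2 * ⌊ X ⋂ Cols O (2 * (ℓ * (2 + s * 49)) * r) ⌋ ≤ 2 * (ℓ * (2 + s * 49)) * suc V) where

    -- Member 0 of the popular class serves as `lo`, and the members 1 + 49a with a ≤ s as edges.
    -- The 48 members between consecutive edges carry at least v/2 points each, hence 24v together.
    K I : ℕ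
    K = 2 + s * 49
    I = 2 * (ℓ * K)

    at : ℕ → ℕ
    at i = O + i * r

    m : ℕ → ℕ
    m i = ⌊ X ⋂ Cols (at i) r ⌋

    at-suc : ∀ i → at i + r ≡ at (suc i)
    at-suc i = trans (+-assoc O (i * r) r) (cong (O +_) (+-comm (i * r) r))

    at-mono : ∀ {i j} → i ≤ j → at i ≤ at j
    at-mono i≤j = +-monoʳ-≤ O (*-monoˡ-≤ r i≤j)

    at-+ : ∀ i d → at (i + d) ≡ at i + d * r
    at-+ i d = trans (cong (O +_) (*-distribʳ-+ r i d)) (sym (+-assoc O _ _))

    weighted : ∀ (g : ℕ → ℕ) i d → i + d ≤ I → (∀ j → i ≤ j → j < i + d → g j ≤ m j) → ∑ (upTo d) (λ c → g (i + c)) ≤ ⌊ X ⋂ Cols (at i) (d * r) ⌋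
    weighted g i zero    _  _  = z≤n
    weighted g i (suc d) ≤I gm = begin
        ∑ (upTo (suc d)) (λ c → g (i + c))  ≡⟨ ∑-upTo-suc d _ ⟩
        g (i + 0) + ∑ (upTo d) (λ c → g (i + suc c))  ≡⟨ cong₂ _+_ (cong g (+-identityʳ i)) (∑-cong (upTo d) λ c _ → cong g (+-suc i c)) ⟩
        g i + ∑ (upTo d) (λ c → g (suc i + c))  ≤⟨ +-mono-≤ (gm i ≤-refl (m<m+n i (s≤s z≤n))) (weighted g (suc i) d (≤-trans (≤-reflexive (sym (+-suc i d))) ≤I) λ j i≤j j< → gm j (<⇒≤ i≤j) (≤-trans j< (≤-reflexive (sym (+-suc i d))))) ⟩
        m i + ⌊ X ⋂ Cols (at (suc i)) (d * r) ⌋  ≡⟨ cong (λ l → m i + ⌊ X ⋂ Cols l (d * r) ⌋) (sym (at-suc i)) ⟩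
        m i + ⌊ X ⋂ Cols (at i + r) (d * r) ⌋  ≤⟨ cols-split-≥ X (at i) r (d * r) (≤-trans (≤-reflexive (sym (at-+ i (suc d)))) (≤-trans (at-mono ≤I) inside)) ⟩
        ⌊ X ⋂ Cols (at i) (suc d * r) ⌋  ∎
      where
      open ≤-Reasoning
      ∑-upTo-suc : ∀ d (f : ℕ → ℕ) → ∑ (upTo (suc d)) f ≡ f 0 + ∑ (upTo d) (λ c → f (suc c))
      ∑-upTo-suc d f = cong (f 0 +_) (∑-applyUpTo-∘ f suc d)

    class-count : ∀ v i d → i + d ≤ I → v * count (InClass m v) i d ≤ 2 * ⌊ X ⋂ Cols (at i) (d * r) ⌋
    class-count v i d ≤I = ≤-trans (≤-reflexive (trans (cong (v *_) (card-∑ (upTo d) _)) (sym (∑-* (upTo d) v _))))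
        (≤-trans (∑-mono (upTo d) λ c _ → pointwise (i + c)) (≤-trans (≤-reflexive (∑-* (upTo d) 2 (λ c → m (i + c)))) (*-monoʳ-≤ 2 (weighted m i d ≤I λ _ _ _ → ≤-refl))))
      where
      pointwise : ∀ j → v * ⟦ dec (InClass m v) j ⟧ ≤ 2 * m j
      pointwise j with dec (InClass m v) j
      ... | yes q = ≤-trans (≤-reflexive (*-identityʳ v)) (proj₂ q)
      ... | no _  = ≤-trans (≤-reflexive (*-zeroʳ v)) z≤n

    block-quiet : ∀ v i → i < I → m i ≤ v → v ≤ 2 * V → ¬ (1 ≤ v) → Quiet X O I V s
    block-quiet v i i< mi≤ v≤ v≡0 = record { v = v ; lo = at i ; hi = at i ; v≤ = v≤ ; O≤lo = m≤m+n O _ ; lo≤ = top ; O≤hi = m≤m+n O _ ; hi≤ = top ; lo-poor = mi≤ ; hi-poor = mi≤ ; bands = λ 1≤v → ⊥-elim (v≡0 1≤v) }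
      where
      top : at i + r ≤ at I
      top = ≤-trans (≤-reflexive (at-suc i)) (at-mono i<)

    class-quiet : ∀ v → 1 ≤ v → v ≤ 2 * V → K ≤ count (InClass m v) 0 I → Quiet X O I V s
    class-quiet v 1≤v v≤ K≤ = record { v = v ; lo = at (idx 0) ; hi = at (idx (1 + s * 49)) ; v≤ = v≤ ; O≤lo = m≤m+n O _ ; lo≤ = top 0 (s≤s z≤n) ; O≤hi = m≤m+n O _ ; hi≤ = top (1 + s * 49) ≤-refl
        ; lo-poor = poor 0 (s≤s z≤n) ; hi-poor = poor (1 + s * 49) ≤-refl ; bands = λ _ → β , after 0 1 (s≤s z≤n) (s≤s (s≤s z≤n)) , ≤-refl }
      where
      P : Sub ℕ
      P = InClass m v
      idx : ℕ → ℕ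
      idx = nth′ P I
      spec : ∀ x → x < K → idx x < I × P ∋ idx x × (count P 0 (idx x) ≡ x)
      spec x x< = nth′-spec P I x (≤-trans x< K≤)
      top : ∀ x → x < K → at (idx x) + r ≤ at I
      top x x< = ≤-trans (≤-reflexive (at-suc (idx x))) (at-mono (proj₁ (spec x x<)))
      poor : ∀ x → x < K → m (idx x) ≤ v
      poor x x< = proj₁ (proj₁ (proj₂ (spec x x<)))
      after : ∀ x y → x < y → y < K → at (idx x) + r ≤ at (idx y)
      after x y x<y y< = ≤-trans (≤-reflexive (at-suc (idx x))) (at-mono (nth′-< P I x<y (≤-trans y< K≤)))
      e : ℕ → ℕ
      e a = 1 + a * 49
      e< : ∀ {a} → a ≤ s → e a < K
      e< a≤ = s≤s (s≤s (*-monoˡ-≤ 49 a≤))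
      e-suc : ∀ a → e (suc a) ≡ e a + 49
      e-suc a = cong suc (+-comm 49 (a * 49))
      rich : ∀ a → a < s → 24 * v ≤ ⌊ X ⋂ Cols (at (idx (e a)) + r) (at (idx (e (suc a))) ∸ (at (idx (e a)) + r)) ⌋
      rich a a< = *-cancelˡ-≤ 2 (begin
          2 * (24 * v)  ≡⟨ half v ⟩
          v * 48  ≡⟨ cong (v *_) (sym between) ⟩
          v * count P (suc i) (j ∸ suc i)  ≤⟨ class-count v (suc i) (j ∸ suc i) (≤-trans (≤-reflexive (m+[n∸m]≡n i<j)) (<⇒≤ (proj₁ (spec (e (suc a)) (e< a<))))) ⟩
          2 * ⌊ X ⋂ Cols (at (suc i)) ((j ∸ suc i) * r) ⌋  ≡⟨ cong₂ (λ l w → 2 * ⌊ X ⋂ Cols l w ⌋) (sym (at-suc i)) width ⟩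
          2 * ⌊ X ⋂ Cols (at i + r) (at j ∸ (at i + r)) ⌋  ∎)
        where
        open ≤-Reasoning
        i j : ℕ
        i = idx (e a)
        j = idx (e (suc a))
        half : ∀ v → 2 * (24 * v) ≡ v * 48
        half = solve-∀
        i<j : i < j
        i<j = nth′-< P I (≤-trans (m<m+n (e a) {49} (s≤s z≤n)) (≤-reflexive (sym (e-suc a)))) (≤-trans (e< a<) K≤)
        between : count P (suc i) (j ∸ suc i) ≡ 48
        between = trans (cong (λ y → count P (suc i) (idx y ∸ suc i)) (e-suc a)) (nth′-between P I {e a} 48 (≤-trans (≤-trans (≤-reflexive (cong suc (sym (e-suc a)))) (e< a<)) K≤))
        width : (j ∸ suc i) * r ≡ at j ∸ (at i + r)
        width = sym (trans (cong₂ _∸_ (trans (cong at (sym (m+[n∸m]≡n i<j))) (at-+ (suc i) (j ∸ suc i))) (at-suc i)) (m+n∸m≡n (at (suc i)) _))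
      β : Bands X v s
      β = record { l = λ a → at (idx (e a)) ; l-step = λ a a< → after (e a) (e (suc a)) (≤-trans (m<m+n (e a) {49} (s≤s z≤n)) (≤-reflexive (sym (e-suc a)))) (e< a<)
                 ; edge-poor = λ a a≤ → poor (e a) (e< a≤) ; band-rich = rich }

    quiet : Quiet X O I V s
    quiet = conclude (some-or-none (upTo I) ⟪ (λ i → m i ≤? 0) ⟫)
      where
      ∑m≤ : 2 * ∑ (upTo I) m ≤ I * suc V
      ∑m≤ = ≤-trans (*-monoʳ-≤ 2 (≤-trans (weighted m 0 I ≤-refl λ _ _ _ → ≤-refl) (≤-reflexive (cong (λ l → ⌊ X ⋂ Cols l (I * r) ⌋) (+-identityʳ O))))) total
      conclude : (Σ ℕ λ i → i ∈ upTo I × m i ≤ 0) ⊎ (∀ i → i ∈ upTo I → ¬ (m i ≤ 0)) → Quiet X O I V s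
      conclude (inj₁ (i , i∈ , q)) = block-quiet 0 i (∈-upTo⁻ i∈) q z≤n λ ()
      conclude (inj₂ none) = let v , 1≤v , v≤ , K≤ = popular-class m ℓ K V V< (s≤s z≤n) 1≤ℓ (λ i i< → ≰⇒> (none i (∈-upTo⁺ i<))) ∑m≤ in class-quiet v 1≤v v≤ K≤

-- The flux argument

card-family : {A : Set} {xs : List A} → Unique xs → ∀ s (P : ℕ → Sub A) (X : Sub A) → (∀ a x → a < s → P a ∋ x → X ∋ x) →
  (∀ a a′ x → a < a′ → a′ < s → P a ∋ x → ¬ (P a′ ∋ x)) → ∑ (upTo s) (λ a → card xs (P a)) ≤ card xs X
card-family {A} {xs} u s P X sub disj = ≤-trans (≤-reflexive (sym (∑-card-⊗ (upTo s) xs both)))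
    (card-inj both X (⊗-unique (Uniq.upTo⁺ s) u) (λ ax x → proj₁ ax < s × proj₂ ax ≡ x) tot inj)
  where
  both : Sub (ℕ × A)
  both = ⟪ (λ ax → dec (P (proj₁ ax)) (proj₂ ax)) ⟫
  tot : ∀ ax → ax ∈ upTo s ⊗ xs → both ∋ ax → Σ A λ x → x ∈ xs × X ∋ x × proj₁ ax < s × proj₂ ax ≡ x
  tot (a , x) ax∈ q = let a∈ , x∈ = ∈-⊗⁻ (upTo s) xs ax∈ in x , x∈ , sub a x (∈-upTo⁻ a∈) q , ∈-upTo⁻ a∈ , refl
  inj : ∀ u u′ x → both ∋ u → both ∋ u′ → proj₁ u < s × proj₂ u ≡ x → proj₁ u′ < s × proj₂ u′ ≡ x → u ≡ u′
  inj (a , x) (a′ , .x) .x q q′ (a< , refl) (a′< , refl) with <-cmp a a′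
  ... | tri≈ _ refl _ = refl
  ... | tri< a<a′ _ _ = ⊥-elim (disj a a′ x a<a′ a′< q q′)
  ... | tri> _ _ a′<a = ⊥-elim (disj a′ a x a′<a a< q′ q)

module Final {𝔾 : PrimeGroup} {A : Sub (PrimeGroup.G 𝔾)} {k : ℕ} {small : Small 𝔾 A k} (system : ColumnSystem small)
  (a₀ : PrimeGroup.G 𝔾) (Y : ℕ) (fits : Columns.Fits system Y)
  (B : Sub (PrimeGroup.G 𝔾)) (|B|≡k : card (PrimeGroup.U 𝔾) B ≡ k)
  (antisymmetric : ∀ x → B ∋ x → ¬ (B ∋ PrimeGroup.⊟_ 𝔾 x))
  (δ<k : ∀ x → B ∋ x → Groups.δ 𝔾 A x < k) where

  open Zones system a₀ Y fits public

  B⊂D : ∀ β → B ∋ β → D 1 ∋ β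
  B⊂D β q = D₁ β (<⇒≤ (δ<k β q))

  Landing : G → ℕ → ℕ → Sub G
  Landing j l w = ⟪ (λ x → dec (Cols l w) (x ⊞ j)) ⟫

  abstract

    -- The sum `Flux.E` takes a membership proof as argument; deciding membership makes it a
    -- function of j alone, with 0 as value off `D 1`.
    E-or-0 : ∀ j → Dec (D 1 ∋ j) → ℕ
    E-or-0 j (yes q) = Flux.E j q
    E-or-0 j (no _)  = 0

    Ê : G → ℕ
    Ê j = E-or-0 j (dec (D 1) j)

    Ê-≤ : ∀ j → Ê j ≤ N * (2 * r)
    Ê-≤ j = go (dec (D 1) j)
      where
      go : ∀ d → E-or-0 j d ≤ N * (2 * r)
      go (yes q) = Flux.E≤ j q
      go (no _)  = z≤n

    Ê-equation : ∀ j → D 1 ∋ j → N · j ⊞ (N * r) · b ≡ Ê j · b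
    Ê-equation j Dj = go (dec (D 1) j)
      where
      go : ∀ d → N · j ⊞ (N * r) · b ≡ E-or-0 j d · b
      go (yes q) = Flux.E-equation j q
      go (no ¬q) = ⊥-elim (¬q Dj)

    Ê-flux : ∀ j → D 1 ∋ j → ∀ l w → l + r + (w + r) + r ≤ suc Y →
      Ê j ≤ ⌊ lost A j ⋂ Landing j (l + r) (w + r) ⌋ + (⌊ ∁ A ⋂ Cols l r ⌋ + ⌊ A ⋂ Cols (l + r + w) r ⌋) + N * r
    Ê-flux j Dj l w ≤Y = go (dec (D 1) j)
      where
      go : ∀ d → E-or-0 j d ≤ ⌊ lost A j ⋂ Landing j (l + r) (w + r) ⌋ + (⌊ ∁ A ⋂ Cols l r ⌋ + ⌊ A ⋂ Cols (l + r + w) r ⌋) + N * r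
      go (yes q) = Flux.flux j q l w ≤Y
      go (no ¬q) = ⊥-elim (¬q Dj)

  module _ (4rN<p : N * (4 * r) < p) (1≤r : 1 ≤ r) where

    N<p : N < p
    N<p = ≤-<-trans (m≤m*n N (4 * r) ⦃ >-nonZero (≤-trans 1≤r (m≤n*m r 4)) ⦄) 4rN<p

    Ê-injective : ∀ i j → D 1 ∋ i → D 1 ∋ j → Ê i ≡ Ê j → i ≡ j
    Ê-injective i j Di Dj e = ·-injʳ N 1≤N N<p (cancelʳ ((N * r) · b) _ _ (trans (Ê-equation i Di) (trans (cong (_· b) e) (sym (Ê-equation j Dj)))))

    -- By `E-equation` both sides have the same product with b. Both are below p, because 4rN < p,
    -- so they are equal as integers: j and -j have opposite displacements.
    Ê-⊟ : ∀ j → D 1 ∋ j → Ê j + Ê (⊟ j) ≡ N * r + N * r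
    Ê-⊟ j Dj = ·-injˡ _ _ b≢𝟘 (≤-<-trans (≤-trans (+-mono-≤ (Ê-≤ j) (Ê-≤ (⊟ j))) (≤-reflexive (four N r))) 4rN<p)
        (≤-<-trans (≤-trans (m≤m+n (N * r + N * r) (N * r + N * r)) (≤-reflexive (four′ N r))) 4rN<p) (begin
          (Ê j + Ê (⊟ j)) · b  ≡⟨ ·-+ b (Ê j) (Ê (⊟ j)) ⟩
          Ê j · b ⊞ Ê (⊟ j) · b  ≡⟨ cong₂ _⊞_ (sym (Ê-equation j Dj)) (sym (Ê-equation (⊟ j) (D-⊟ 1 j Dj))) ⟩
          N · j ⊞ (N * r) · b ⊞ (N · (⊟ j) ⊞ (N * r) · b)  ≡⟨ ac 4 (λ j r i s → (j ∙ r) ∙ (i ∙ s) ⊜ (i ∙ j) ∙ (r ∙ s)) refl (N · j) ((N * r) · b) (N · (⊟ j)) ((N * r) · b) ⟩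
          N · (⊟ j) ⊞ N · j ⊞ ((N * r) · b ⊞ (N * r) · b)  ≡⟨ cong₂ _⊞_ (·-⊟ N j) (sym (·-+ b (N * r) (N * r))) ⟩
          𝟘 ⊞ (N * r + N * r) · b  ≡⟨ identityˡ _ ⟩
          (N * r + N * r) · b  ∎)
      where
      open ≡-Reasoning
      four : ∀ N r → N * (2 * r) + N * (2 * r) ≡ N * (4 * r)
      four = solve-∀
      four′ : ∀ N r → N * r + N * r + (N * r + N * r) ≡ N * (4 * r)
      four′ = solve-∀

    abstract

      pick : ∀ β → Dec (N * r ≤ Ê β) → G
      pick β (yes _) = β
      pick β (no _)  = ⊟ β

      -- The one of β and -β whose total displacement is not negative.
      sgn : G → G
      sgn β = pick β (N * r ≤? Ê β)

      sgn-D : ∀ β → D 1 ∋ β → D 1 ∋ sgn β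
      sgn-D β Dβ = go (N * r ≤? Ê β)
        where
        go : ∀ d → D 1 ∋ pick β d
        go (yes _) = Dβ
        go (no _)  = D-⊟ 1 β Dβ

      sgn-δ : ∀ β → δ A (sgn β) ≤ δ A β
      sgn-δ β = go (N * r ≤? Ê β)
        where
        go : ∀ d → δ A (pick β d) ≤ δ A β
        go (yes _) = ≤-refl
        go (no _)  = δ-⊟ A β

      sgn-Ê : ∀ β → D 1 ∋ β → N * r ≤ Ê (sgn β)
      sgn-Ê β Dβ = go (N * r ≤? Ê β)
        where
        go : ∀ d → N * r ≤ Ê (pick β d)
        go (yes q) = q
        go (no q)  = +-cancelˡ-≤ (N * r) _ _ (≤-trans (≤-reflexive (sym (Ê-⊟ β Dβ))) (+-monoˡ-≤ _ (<⇒≤ (≰⇒> q))))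

      ⊟⊟ : ∀ x → ⊟ (⊟ x) ≡ x
      ⊟⊟ x = cancelʳ (⊟ x) _ _ (trans (inverseˡ (⊟ x)) (sym (inverseʳ x)))

      sgn-injective : ∀ β β′ → B ∋ β → B ∋ β′ → sgn β ≡ sgn β′ → β ≡ β′
      sgn-injective β β′ Bβ Bβ′ = go (N * r ≤? Ê β) (N * r ≤? Ê β′)
        where
        go : ∀ d d′ → pick β d ≡ pick β′ d′ → β ≡ β′
        go (yes _) (yes _) e = e
        go (yes _) (no _)  e = ⊥-elim (antisymmetric β′ Bβ′ (subst (B ∋_) e Bβ))
        go (no _)  (yes _) e = ⊥-elim (antisymmetric β Bβ (subst (B ∋_) (sym e) Bβ′))
        go (no _)  (no _)  e = trans (sym (⊟⊟ β)) (trans (cong ⊟_ e) (⊟⊟ β′))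

      val : G → ℕ
      val β = Ê (sgn β) ∸ N * r

      val-Ê : ∀ β → B ∋ β → N * r + val β ≡ Ê (sgn β)
      val-Ê β Bβ = m+[n∸m]≡n (sgn-Ê β (B⊂D β Bβ))

      val-injective : ∀ β β′ → B ∋ β → B ∋ β′ → val β ≡ val β′ → β ≡ β′
      val-injective β β′ Bβ Bβ′ e = sgn-injective β β′ Bβ Bβ′ (Ê-injective _ _ (sgn-D β (B⊂D β Bβ)) (sgn-D β′ (B⊂D β′ Bβ′))
        (trans (sym (val-Ê β Bβ)) (trans (cong (N * r +_) e) (val-Ê β′ Bβ′))))

      ⊟𝟘 : ⊟ 𝟘 ≡ 𝟘
      ⊟𝟘 = trans (sym (identityˡ (⊟ 𝟘))) (inverseʳ 𝟘)

      -- Displacement 0 would force `sgn β`, hence β, to be 0, and then β = -β would lie in both `B`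
      -- and -B.
      val-positive : ∀ β → B ∋ β → 1 ≤ val β
      val-positive β Bβ = go (val β) refl
        where
        go : ∀ v → val β ≡ v → 1 ≤ v
        go (suc v) _ = s≤s z≤n
        go zero    e = ⊥-elim (antisymmetric β Bβ (subst (B ∋_) (trans β≡𝟘 (trans (sym ⊟𝟘) (cong ⊟_ (sym β≡𝟘)))) Bβ))
          where
          s : G
          s = sgn β
          s≡𝟘 : s ≡ 𝟘
          s≡𝟘 = torsion-free N s 1≤N N<p (cancelʳ ((N * r) · b) _ _ (trans (Ê-equation s (sgn-D β (B⊂D β Bβ)))
                  (trans (cong (_· b) (trans (sym (val-Ê β Bβ)) (trans (cong (N * r +_) e) (+-identityʳ _)))) (sym (identityˡ _)))))
          β≡𝟘 : β ≡ 𝟘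
          β≡𝟘 = go′ (N * r ≤? Ê β) s≡𝟘
            where
            go′ : ∀ d → pick β d ≡ 𝟘 → β ≡ 𝟘
            go′ (yes _) q = q
            go′ (no _)  q = trans (sym (⊟⊟ β)) (trans (cong ⊟_ q) ⊟𝟘)

    Large : ℕ → Sub G
    Large w = B ⋂ ⟪ (λ β → k ≤? val β + w) ⟫

    -- The k values are distinct and positive, so at most k - 1 - w of them lie below k - w.
    many-large : ∀ w → w < k → w < ⌊ Large w ⌋
    many-large w w<k = arith k w ⌊ Large w ⌋ ⌊ Rest ⌋ (k ∸ suc w) (m+[n∸m]≡n w<k) (≤-trans (≤-reflexive (sym |B|≡k)) (card-split U B ⟪ (λ β → k ≤? val β + w) ⟫)) rest≤
      where
      Rest : Sub G
      Rest = B ⋂ ⟪ (λ β → ¬? (k ≤? val β + w)) ⟫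
      arith : ∀ k w l r c → suc w + c ≡ k → k ≤ l + r → r ≤ c → w < l
      arith k w l r c refl h₁ h₂ = linear 0 (h₁ ⊹ h₂) (solve (w ∷ l ∷ r ∷ c ∷ []))
      rest≤ : ⌊ Rest ⌋ ≤ k ∸ suc w
      rest≤ = ≤-trans (length-inj (λ β i → B ∋ β × val β ≡ suc i) (λ { (Bβ , e) (Bβ′ , e′) → val-injective _ _ Bβ Bβ′ (trans e (sym e′)) })
          (upTo (k ∸ suc w)) (els-unique Rest U-unique) tot) (≤-reflexive (length-upTo _))
        where
        tot : ∀ {β} → β ∈ els U Rest → Σ ℕ λ i → (i ∈ upTo (k ∸ suc w)) × B ∋ β × val β ≡ suc i
        tot {β} β∈ = let _ , Bβ , q = els-∈ U Rest β∈ in go Bβ q (val β) refl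
          where
          go : B ∋ β → ¬ (k ≤ val β + w) → ∀ v → val β ≡ v → Σ ℕ λ i → (i ∈ upTo (k ∸ suc w)) × B ∋ β × val β ≡ suc i
          go Bβ q zero    e = ⊥-elim (<⇒≱ (val-positive β Bβ) (≤-reflexive e))
          go Bβ q (suc i) e = i , ∈-upTo⁺ (+-cancelˡ-≤ (suc w) _ _ (≤-trans (≤-trans (≤-reflexive (shuffle w i)) (subst (λ v → suc (v + w) ≤ k) e (≰⇒> q))) (≤-reflexive (sym (m+[n∸m]≡n w<k))))) , Bβ , e
            where
            shuffle : ∀ w i → suc w + suc i ≡ suc (suc i + w)
            shuffle = solve-∀

    finish-0 : (∀ β → B ∋ β → Ê (sgn β) ≤ δ A (sgn β) + N * r) → ⊥
    finish-0 bound with some-or-none U (Large 0)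
    ... | inj₁ (β , _ , Bβ , k≤) = <⇒≱ (≤-<-trans (sgn-δ β) (δ<k β Bβ)) (≤-trans k≤ (≤-trans (≤-reflexive (+-identityʳ (val β)))
            (+-cancelˡ-≤ (N * r) _ _ (≤-trans (≤-reflexive (val-Ê β Bβ)) (≤-trans (bound β Bβ) (≤-reflexive (+-comm _ (N * r))))))))
    ... | inj₂ none = <⇒≱ (many-large 0 1≤k) (≤-trans (mono (Large 0) nothing λ β q → none β (U-full β) q) (≤-reflexive empty))
      where
      nothing : Sub G
      nothing = ⟪ (λ _ → no (λ (x : ⊥) → x)) ⟫
      empty : ⌊ nothing ⌋ ≡ 0
      empty = trans (card-∑ U nothing) (trans (∑-const U 0) (*-zeroʳ (length U)))

    -- On average over the candidates β, half of the gains exceed 8v.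
    finish : ∀ h v (g : ℕ → G → ℕ) → 37 ≤ h → 1 ≤ v → 144 * v < k →
      (∀ a → a < 2 * h → card (els U (Large (144 * v))) ⟪ (λ β → g a β ≤? 8 * v) ⟫ ≤ 9 * (8 * v)) →
      (∀ β → B ∋ β → Ê (sgn β) + ∑ (upTo (2 * h)) (λ a → g a β) ≤ δ A (sgn β) + (v + v) + N * r + 2 * h * (v + v)) → ⊥
    finish h v g 37≤h 1≤v small′ few bound = contradict (average L bad (≤-trans (s≤s z≤n) (many-large (144 * v) small′)))
      where
      L : List G
      L = els U (Large (144 * v))
      bad : G → ℕ
      bad β = card (upTo (2 * h)) ⟪ (λ a → g a β ≤? 8 * v) ⟫
      ∑bad≤ : ∑ L bad ≤ 2 * h * (9 * (8 * v))
      ∑bad≤ = ≤-trans (≤-reflexive (∑-card-swap L (upTo (2 * h)) (λ β a → g a β ≤? 8 * v))) (≤-trans (∑-≤ (upTo (2 * h)) _ (9 * (8 * v)) λ a a∈ → few a (∈-upTo⁻ a∈)) (≤-reflexive (cong (_* (9 * (8 * v))) (length-upTo (2 * h)))))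
      contradict : (Σ G λ β → β ∈ L × length L * bad β ≤ ∑ L bad) → ⊥
      contradict (β , β∈ , avg) = <-irrefl refl (arith h v k (val β) (δ A (sgn β)) (N * r) S S≥ (bound′ (bound β Bβ)) δ′ k≤ 37≤h)
        where
        Bβ : B ∋ β
        Bβ = proj₁ (proj₂ (els-∈ U (Large (144 * v)) β∈))
        k≤ : k ≤ val β + 144 * v
        k≤ = proj₂ (proj₂ (els-∈ U (Large (144 * v)) β∈))
        δ′ : δ A (sgn β) < k
        δ′ = ≤-<-trans (sgn-δ β) (δ<k β Bβ)
        S : ℕ
        S = ∑ (upTo (2 * h)) (λ a → g a β)
        -- Over the 2h bands there are at most 2h·72v = 144v·h bad pairs, shared by more than 144v
        -- candidates β.
        bad≤h : bad β ≤ h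
        bad≤h = *-cancelˡ-≤ (144 * v) ⦃ m*n≢0 144 v ⦃ _ ⦄ ⦃ >-nonZero 1≤v ⦄ ⦄ (≤-trans (*-monoˡ-≤ (bad β) (<⇒≤ (many-large (144 * v) small′))) (≤-trans avg (≤-trans ∑bad≤ (≤-reflexive (same h v)))))
          where
          same : ∀ h v → 2 * h * (9 * (8 * v)) ≡ 144 * v * h
          same = solve-∀
        good : Sub ℕ
        good = ⟪ (λ a → ¬? (g a β ≤? 8 * v)) ⟫
        good≥h : h ≤ card (upTo (2 * h)) good
        good≥h = +-cancelˡ-≤ h _ _ (≤-trans (≤-trans (≤-reflexive (cong (h +_) (sym (+-identityʳ h)))) (count-∁ ⟪ (λ a → g a β ≤? 8 * v) ⟫ 0 (2 * h))) (+-monoˡ-≤ _ bad≤h))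
        S≥ : h * (8 * v) ≤ S
        S≥ = ≤-trans (*-monoˡ-≤ (8 * v) good≥h) (≤-trans (≤-reflexive (trans (*-comm _ (8 * v)) (trans (cong (8 * v *_) (card-∑ (upTo (2 * h)) good)) (sym (∑-* (upTo (2 * h)) (8 * v) _))))) (∑-mono (upTo (2 * h)) λ a _ → pointwise a))
          where
          pointwise : ∀ a → 8 * v * ⟦ dec good a ⟧ ≤ g a β
          pointwise a with g a β ≤? 8 * v
          ... | yes q = ≤-trans (≤-reflexive (*-zeroʳ (8 * v))) z≤n
          ... | no q  = ≤-trans (≤-reflexive (*-identityʳ (8 * v))) (<⇒≤ (≰⇒> q))
        bound′ : Ê (sgn β) + S ≤ δ A (sgn β) + (v + v) + N * r + 2 * h * (v + v) → N * r + val β + S ≤ δ A (sgn β) + (v + v) + N * r + 2 * h * (v + v)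
        bound′ = subst (λ E → E + S ≤ δ A (sgn β) + (v + v) + N * r + 2 * h * (v + v)) (sym (val-Ê β Bβ))
        -- The h good bands gain 8v each and all 2h bands pay 2v each for their edges. The net gain
        -- 4hv ≥ 148v exceeds the deficit 144v of the displacement plus the 2v spent at the ends of
        -- the flux window.
        arith : ∀ h v k x d c S → h * (8 * v) ≤ S → c + x + S ≤ d + (v + v) + c + 2 * h * (v + v) → d < k → k ≤ x + 144 * v → 37 ≤ h → 0 < 0
        arith h v k x d c S h₁ h₂ h₃ h₄ h₅ = linear (2 * v) (h₁ ⊹ h₂ ⊹ h₃ ⊹ h₄ ⊹ (4 * v) ⊛ h₅) (solve (h ∷ v ∷ k ∷ x ∷ d ∷ c ∷ S ∷ []))

    -- This is `level-bound` for the exceptional points of one band in the place of `A`. The map z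
    -- is `sgn` or its negative, according to the zone.
    few : ∀ w v M′ (z : G → G) → (∀ β β′ → B ∋ β → B ∋ β′ → z β ≡ z β′ → β ≡ β′) → 1 ≤ v → 24 * v ≤ ⌊ M′ ⌋ → 2 * ⌊ M′ ⌋ < p →
      card (els U (Large w)) ⟪ (λ β → δ M′ (z β) ≤? 8 * v) ⟫ ≤ 9 * (8 * v)
    few w v M′ z inj 1≤v rich 2M<p = ≤-trans
      (card-inj ⟪ (λ β → δ M′ (z β) ≤? 8 * v) ⟫ (level M′ (8 * v)) (els-unique (Large w) U-unique) (λ β x → B ∋ β × z β ≡ x)
        (λ β β∈ q → z β , U-full _ , q , proj₁ (proj₂ (els-∈ U (Large w) β∈)) , refl) (λ β β′ x _ _ (Bβ , e) (Bβ′ , e′) → inj β β′ Bβ Bβ′ (trans e (sym e′))))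
      (level-bound M′ (8 * v) 2M<p (≤-trans 1≤v (m≤n*m v 8)) (≤-trans (≤-reflexive (sym (*-assoc 3 8 v))) rich))

    -- The bands are taken from the zone with the larger v: their gain is proportional to that v,
    -- and it has to pay for the edge strips of both zones.
    module Combine (h I V O : ℕ) (37≤h : 37 ≤ h) (inner : Quiet (∁ A) 0 I V (2 * h)) (outer : Quiet A O I V (2 * h))
      (zones-apart : I * r ≤ O) (zones-inside : O + I * r + r ≤ suc Y) (V-small : 300 * V ≤ k) (zones-small : 2 * (N * (I * r)) < p) where

      module In = Quiet inner
      module Out = Quiet outer

      s w : ℕ
      s = 2 * h
      w = Out.lo ∸ (In.hi + r)

      hi+r+w : In.hi + r + w ≡ Out.lo
      hi+r+w = m+[n∸m]≡n (≤-trans In.hi≤ (≤-trans zones-apart Out.O≤lo))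

      Main : G → Sub G
      Main j = Landing j (In.hi + r) (w + r)

      Main-end : In.hi + r + (w + r) ≡ Out.lo + r
      Main-end = trans (sym (+-assoc (In.hi + r) w r)) (cong (_+ r) hi+r+w)

      Main-inside : In.hi + r + (w + r) + r ≤ suc Y
      Main-inside = ≤-trans (≤-reflexive (cong (_+ r) Main-end)) (≤-trans (+-monoˡ-≤ r Out.lo≤) zones-inside)

      main-flux : ∀ j → D 1 ∋ j → Ê j ≤ ⌊ lost A j ⋂ Main j ⌋ + (In.v + Out.v) + N * r
      main-flux j Dj = ≤-trans (Ê-flux j Dj In.hi w Main-inside)
        (+-monoˡ-≤ (N * r) (+-monoʳ-≤ ⌊ lost A j ⋂ Main j ⌋ (+-mono-≤ In.hi-poor (≤-trans (≤-reflexive (cong (λ l → ⌊ A ⋂ Cols l r ⌋) hi+r+w)) Out.lo-poor))))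

      combine : ∀ j (P : ℕ → Sub G) → (∀ a x → a < s → P a ∋ x → lost A j ∋ x) → (∀ a x → a < s → P a ∋ x → ¬ (Main j ∋ x)) →
        (∀ a a′ x → a < a′ → a′ < s → P a ∋ x → ¬ (P a′ ∋ x)) → ⌊ lost A j ⋂ Main j ⌋ + ∑ (upTo s) (λ a → ⌊ P a ⌋) ≤ δ A j
      combine j P sub apart disj = ≤-trans (+-monoʳ-≤ _ (card-family U-unique s P (lost A j ⋂ ∁ (Main j)) (λ a x a< q → sub a x a< q , apart a x a< q) disj))
        (card-disjoint U (lost A j) (lost A j ⋂ Main j) (lost A j ⋂ ∁ (Main j)) (λ _ _ → proj₁) (λ _ _ → proj₁) λ _ _ q q′ → proj₂ q′ (proj₂ q))

      module BandFacts {X : Sub G} {v : ℕ} (β : Bands X v s) (O′ hi′ : ℕ) (O′≤ : O′ ≤ Bands.l β 0) (≤hi′ : Bands.l β s ≤ hi′) (hi′≤ : hi′ + r ≤ O′ + I * r) (in-Y : O′ + I * r ≤ suc Y) where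

        open Bands β public

        width : ℕ → ℕ
        width a = l (suc a) ∸ (l a + r)

        band : ℕ → Sub G
        band a = Cols (l a + r) (width a)

        ends : ∀ a → a < s → l a + r + width a ≡ l (suc a)
        ends a a< = m+[n∸m]≡n (l-step a a<)

        l-mono : ∀ a c → a + c ≤ s → l a ≤ l (a + c)
        l-mono a zero    _ = ≤-reflexive (cong l (sym (+-identityʳ a)))
        l-mono a (suc c) ≤s = ≤-trans (l-mono a c (≤-trans (+-monoʳ-≤ a (n≤1+n c)) ≤s)) (≤-trans (≤-trans (m≤m+n _ r) (l-step (a + c) (≤-trans (≤-reflexive (sym (+-suc a c))) ≤s))) (≤-reflexive (cong l (sym (+-suc a c)))))

        l-mono′ : ∀ {a a′} → a ≤ a′ → a′ ≤ s → l a ≤ l a′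
        l-mono′ {a} {a′} a≤ ≤s = subst (λ c → l a ≤ l c) (m+[n∸m]≡n a≤) (l-mono a (a′ ∸ a) (≤-trans (≤-reflexive (m+[n∸m]≡n a≤)) ≤s))

        top : ∀ a → a ≤ s → l a + r ≤ O′ + I * r
        top a a≤ = ≤-trans (+-monoˡ-≤ r (≤-trans (l-mono′ a≤ ≤-refl) ≤hi′)) hi′≤

        band-end : ∀ a → a < s → l a + r + width a ≤ suc Y
        band-end a a< = ≤-trans (≤-reflexive (ends a a<)) (≤-trans (≤-trans (m≤m+n _ r) (top (suc a) a<)) in-Y)

        bands-disjoint : ∀ a a′ x → a < a′ → a′ < s → band a ∋ x → ¬ (band a′ ∋ x)
        bands-disjoint a a′ x a<a′ a′< = cols-disjoint {l a + r} {width a} {l a′ + r} {width a′} x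
          (≤-trans (≤-reflexive (ends a (<-trans a<a′ a′<))) (≤-trans (l-mono′ a<a′ (<⇒≤ a′<)) (m≤m+n _ r))) (band-end a′ a′<)

        band-small : ∀ a → a < s → 2 * ⌊ X ⋂ band a ⌋ < p
        band-small a a< = ≤-<-trans (*-monoʳ-≤ 2 (≤-trans (cols-size X (l a + r) (width a)) (*-monoʳ-≤ N width≤))) zones-small
          where
          width≤ : width a ≤ I * r
          width≤ = +-cancelˡ-≤ O′ _ _ (≤-trans (+-monoˡ-≤ (width a) (≤-trans O′≤ (≤-trans (l-mono′ z≤n (<⇒≤ a<)) (m≤m+n _ r)))) (≤-trans (≤-reflexive (ends a a<)) (≤-trans (m≤m+n _ r) (top (suc a) a<))))

        gain : ∀ a → a < s → ∀ {j} → D 1 ∋ j → δ (X ⋂ band a) j ≤ ⌊ lost X j ⋂ band a ⌋ + (v + v)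
        gain a a< {j} Dj = ≤-trans (band-loss X (l a) (width a) Dj) (+-monoʳ-≤ ⌊ lost X j ⋂ band a ⌋ (+-mono-≤ (edge-poor a (<⇒≤ a<))
          (≤-trans (≤-reflexive (cong (λ m → ⌊ X ⋂ Cols m r ⌋) (ends a a<))) (edge-poor (suc a) a<))))

      144v<k : ∀ v → 1 ≤ v → v ≤ 2 * V → 144 * v < k
      144v<k v 1≤v v≤ = arith v V k 1≤v v≤ V-small
        where
        arith : ∀ v V k → 1 ≤ v → v ≤ 2 * V → 300 * V ≤ k → 144 * v < k
        arith v V k h₁ h₂ h₃ = linear 5 (6 ⊛ h₁ ⊹ 150 ⊛ h₂ ⊹ h₃) (solve (v ∷ V ∷ k ∷ []))

      gather : ∀ v j (g P : ℕ → ℕ) → In.v ≤ v → Out.v ≤ v → D 1 ∋ j → (∀ a → a < s → g a ≤ P a + (v + v)) →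
        ⌊ lost A j ⋂ Main j ⌋ + ∑ (upTo s) P ≤ δ A j → Ê j + ∑ (upTo s) g ≤ δ A j + (v + v) + N * r + s * (v + v)
      gather v j g P In≤ Out≤ Dj gP total = arith (Ê j) (∑ (upTo s) g) (∑ (upTo s) P) ⌊ lost A j ⋂ Main j ⌋ (In.v) (Out.v) v (δ A j) (N * r) (s * (v + v)) (main-flux j Dj) In≤ Out≤ ∑g≤ total
        where
        ∑g≤ : ∑ (upTo s) g ≤ ∑ (upTo s) P + s * (v + v)
        ∑g≤ = ≤-trans (∑-mono (upTo s) λ a a∈ → gP a (∈-upTo⁻ a∈)) (≤-reflexive (trans (∑-+ (upTo s) P (λ _ → v + v)) (cong (∑ (upTo s) P +_) (trans (∑-const (upTo s) (v + v)) (cong (_* (v + v)) (length-upTo s))))))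
        arith : ∀ E g P L i o v d c q → E ≤ L + (i + o) + c → i ≤ v → o ≤ v → g ≤ P + q → L + P ≤ d → E + g ≤ d + (v + v) + c + q
        arith E g P L i o v d c q h₁ h₂ h₃ h₄ h₅ = linear 0 (h₁ ⊹ h₂ ⊹ h₃ ⊹ h₄ ⊹ h₅) (solve (E ∷ g ∷ P ∷ L ∷ i ∷ o ∷ v ∷ d ∷ c ∷ q ∷ []))

      -- The exceptional points of the inner zone are not in `A`. If -j moves such a point y into
      -- `A`, then y - j is a point of `A` lost under j. The shifts are therefore negated, and
      -- losses are located by their images.
      inner-wins : Out.v ≤ In.v → 1 ≤ In.v → ⊥
      inner-wins Out≤In 1≤v = finish h In.v g 37≤h 1≤v (144v<k In.v 1≤v In.v≤)
          (λ a a< → few (144 * In.v) In.v (∁ A ⋂ band a) (λ β → ⊟ sgn β) inj 1≤v (band-rich a a<) (band-small a a<))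
          (λ β Bβ → gather In.v (sgn β) (λ a → g a β) (λ a → ⌊ P β a ⌋) ≤-refl Out≤In (sgn-D β (B⊂D β Bβ)) (λ a a< → step a a< β Bβ) (combine (sgn β) (P β) (λ _ _ _ → proj₁) (off-main β) (disjoint β)))
        where
        open BandFacts (proj₁ (In.bands 1≤v)) 0 In.hi z≤n (proj₂ (proj₂ (In.bands 1≤v))) In.hi≤ (≤-trans zones-apart (≤-trans (≤-trans (m≤m+n O _) (m≤m+n _ r)) zones-inside))
        g : ℕ → G → ℕ
        g a β = δ (∁ A ⋂ band a) (⊟ sgn β)
        P : G → ℕ → Sub G
        P β a = lost A (sgn β) ⋂ Landing (sgn β) (l a + r) (width a)
        inj : ∀ β β′ → B ∋ β → B ∋ β′ → ⊟ sgn β ≡ ⊟ sgn β′ → β ≡ β′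
        inj β β′ Bβ Bβ′ e = sgn-injective β β′ Bβ Bβ′ (trans (sym (⊟⊟ _)) (trans (cong ⊟_ e) (⊟⊟ _)))
        off-main : ∀ β a x → a < s → P β a ∋ x → ¬ (Main (sgn β) ∋ x)
        off-main β a x a< (_ , c) = cols-disjoint {l a + r} {width a} {In.hi + r} {w + r} (x ⊞ sgn β)
          (≤-trans (≤-reflexive (ends a a<)) (≤-trans (l-mono′ a< ≤-refl) (≤-trans (proj₂ (proj₂ (In.bands 1≤v))) (m≤m+n _ r)))) (≤-trans (m≤m+n _ r) Main-inside) c
        disjoint : ∀ β a a′ x → a < a′ → a′ < s → P β a ∋ x → ¬ (P β a′ ∋ x)
        disjoint β a a′ x a<a′ a′< (_ , c) (_ , c′) = bands-disjoint a a′ (x ⊞ sgn β) a<a′ a′< c c′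
        step : ∀ a → a < s → ∀ β → B ∋ β → g a β ≤ ⌊ P β a ⌋ + (In.v + In.v)
        step a a< β Bβ = ≤-trans (gain a a< (D-⊟ 1 _ (sgn-D β (B⊂D β Bβ)))) (+-monoˡ-≤ _ (translate (lost (∁ A) (⊟ sgn β) ⋂ band a) (P β a) (⊟ sgn β) shift))
          where
          back : ∀ y → y ⊝ sgn β ⊞ sgn β ≡ y
          back y = ⊖-⊞ y (sgn β)
          shift : ∀ y → lost (∁ A) (⊟ sgn β) ⋂ band a ∋ y → P β a ∋ y ⊝ sgn β
          shift y ((y∉A , ¬¬) , c) = (stable (dec A (y ⊝ sgn β)) , λ q → y∉A (subst (A ∋_) (back y) q)) , subst (band a ∋_) (sym (back y)) c
            where
            stable : Dec (A ∋ y ⊝ sgn β) → A ∋ y ⊝ sgn β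
            stable (yes q) = q
            stable (no q)  = ⊥-elim (¬¬ q)

      outer-wins : In.v ≤ Out.v → 1 ≤ Out.v → ⊥
      outer-wins In≤Out 1≤v = finish h Out.v g 37≤h 1≤v (144v<k Out.v 1≤v Out.v≤)
          (λ a a< → few (144 * Out.v) Out.v (A ⋂ band a) sgn sgn-injective 1≤v (band-rich a a<) (band-small a a<))
          (λ β Bβ → gather Out.v (sgn β) (λ a → g a β) (λ a → ⌊ P β a ⌋) In≤Out ≤-refl (sgn-D β (B⊂D β Bβ)) (λ a a< → gain a a< (sgn-D β (B⊂D β Bβ))) (combine (sgn β) (P β) (λ _ _ _ → proj₁) (off-main β Bβ) (disjoint β)))
        where
        lo+r≤ : Out.lo + r ≤ Bands.l (proj₁ (Out.bands 1≤v)) 0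
        lo+r≤ = proj₁ (proj₂ (Out.bands 1≤v))
        open BandFacts (proj₁ (Out.bands 1≤v)) O Out.hi (≤-trans (≤-trans Out.O≤lo (m≤m+n _ r)) lo+r≤) (proj₂ (proj₂ (Out.bands 1≤v))) Out.hi≤ (≤-trans (m≤m+n _ r) zones-inside)
        g : ℕ → G → ℕ
        g a β = δ (A ⋂ band a) (sgn β)
        P : G → ℕ → Sub G
        P β a = lost A (sgn β) ⋂ band a
        -- Here losses are located by their starting points. The image may be `r` cells lower, which
        -- is still not below lo + r, where the flux window ends; this is why the first edge of the
        -- bands differs from `lo`.
        off-main : ∀ β → B ∋ β → ∀ a x → a < s → P β a ∋ x → ¬ (Main (sgn β) ∋ x)
        off-main β Bβ a x a< (_ , c) q = cols-disjoint {In.hi + r} {w + r} {l a} {r + width a + r} (x ⊞ sgn β)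
          (≤-trans (≤-reflexive Main-end) (≤-trans lo+r≤ (l-mono′ z≤n (<⇒≤ a<))))
          (≤-trans (≤-reflexive (regroup (l a) r (width a))) (≤-trans (+-monoˡ-≤ r (≤-reflexive (ends a a<))) (≤-trans (top (suc a) a<) (≤-trans (m≤m+n _ r) zones-inside))))
          q (cell-move x (sgn-D β (B⊂D β Bβ)) c)
          where
          regroup : ∀ l r w → l + (r + w + r) ≡ l + r + w + r
          regroup = solve-∀
        disjoint : ∀ β a a′ x → a < a′ → a′ < s → P β a ∋ x → ¬ (P β a′ ∋ x)
        disjoint β a a′ x a<a′ a′< (_ , c) (_ , c′) = bands-disjoint a a′ x a<a′ a′< c c′

      nobody-wins : In.v ≡ 0 → Out.v ≡ 0 → ⊥
      nobody-wins i0 o0 = finish-0 λ β Bβ → ≤-trans (main-flux (sgn β) (sgn-D β (B⊂D β Bβ)))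
        (+-monoˡ-≤ (N * r) (≤-trans (≤-reflexive (trans (cong₂ (λ i o → ⌊ lost A (sgn β) ⋂ Main (sgn β) ⌋ + (i + o)) i0 o0) (+-identityʳ _))) (mono (lost A (sgn β) ⋂ Main (sgn β)) (lost A (sgn β)) λ _ → proj₁)))

      contradiction : ⊥
      contradiction = go (In.v) (Out.v) refl refl
        where
        go : ∀ i o → In.v ≡ i → Out.v ≡ o → ⊥
        go zero zero i0 o0 = nobody-wins i0 o0
        go (suc i) o i≡ o≡ with ≤-total Out.v In.v
        ... | inj₁ q = inner-wins q (≤-trans (s≤s z≤n) (≤-reflexive (sym i≡)))
        ... | inj₂ q = outer-wins q (≤-trans (≤-trans (s≤s z≤n) (≤-reflexive (sym i≡))) q)
        go zero (suc o) i≡ o≡ = outer-wins (≤-trans (≤-reflexive i≡) z≤n) (≤-trans (s≤s z≤n) (≤-reflexive (sym o≡)))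

-- Existence of quiet zones

module Averaging {𝔾 : PrimeGroup} {A : Sub (PrimeGroup.G 𝔾)} {k : ℕ} {small : Small 𝔾 A k} (system : ColumnSystem small) where

  open Columns system public

  cost : ℕ → ℕ
  cost Λ = (2 * T + Λ * M) * k

  δ-column : ∀ Λ γ t → Γ ∋ γ → t ≤ Λ → δ A (γ ⊞ t · b) ≤ cost Λ
  δ-column Λ γ t Γγ t≤ = D-⊞ (2 * T) (Λ * M) γ (t · b) (Γ⊂D γ Γγ) (D-mono (t · b) (*-monoˡ-≤ M t≤) (D-· M t b b∈D))

  offsets : ℕ → List (G × ℕ)
  offsets Λ = els U Γ ⊗ upTo Λ

  offset : G × ℕ → G
  offset (γ , t) = γ ⊞ t · b

  ∑-offsets : ∀ Λ (f : G × ℕ → ℕ) → (∀ u → f u ≤ δ A (offset u)) → ∑ (offsets Λ) f ≤ N * Λ * cost Λ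
  ∑-offsets Λ f f≤ = ≤-trans (∑-≤ (offsets Λ) f (cost Λ) bound) (≤-reflexive (cong (_* cost Λ) (trans (length-⊗ (els U Γ) (upTo Λ)) (cong (N *_) (length-upTo Λ)))))
    where
    bound : ∀ u → u ∈ offsets Λ → f u ≤ cost Λ
    bound (γ , t) u∈ = let γ∈ , t∈ = ∈-⊗⁻ (els U Γ) (upTo Λ) u∈
      in ≤-trans (f≤ (γ , t)) (δ-column Λ γ t (proj₂ (els-∈ U Γ γ∈)) (<⇒≤ (∈-upTo⁻ t∈)))

  misses : ℕ → G → ℕ
  misses Λ a = card (offsets Λ) ⟪ (λ u → ¬? (dec A (a ⊞ offset u))) ⟫

  -- The points γ + t·b with t ≤ Λ lie in `D (2 * T + Λ * M)`, so each such shift moves at most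
  -- `cost Λ` elements of `A` out of `A`. Some element is at most as bad as the average.
  inner-base : ∀ Λ → 1 ≤ n → Σ G λ a₀ → n * misses Λ a₀ ≤ N * Λ * cost Λ
  inner-base Λ 1≤n = let a₀ , _ , avg = average (els U A) (misses Λ) 1≤n in a₀ , ≤-trans avg total
    where
    total : ∑ (els U A) (misses Λ) ≤ N * Λ * cost Λ
    total = ≤-trans (≤-reflexive (∑-card-swap (els U A) (offsets Λ) (λ a u → ¬? (dec A (a ⊞ offset u))))) (∑-offsets Λ _ λ u →
      card-inj ⟪ (λ a → ¬? (dec A (a ⊞ offset u))) ⟫ (lost A (offset u)) (els-unique A U-unique) _≡_
        (λ a a∈ q → a , U-full a , (proj₂ (els-∈ U A a∈) , q) , refl) (λ _ _ _ _ _ e e′ → trans e (sym e′)))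

module Outer {𝔾 : PrimeGroup} {A : Sub (PrimeGroup.G 𝔾)} {k : ℕ} {small : Small 𝔾 A k} (system : ColumnSystem small)
  (a₀ : PrimeGroup.G 𝔾) (Y : ℕ) (fits : Columns.Fits system Y) where

  open Picture system a₀ Y fits
  open Averaging system using (cost; δ-column; offsets; offset; ∑-offsets; misses)

  inner-total : ∀ Λ → ⌊ ∁ A ⋂ Cols 0 Λ ⌋ ≤ misses Λ a₀
  inner-total Λ = ≤-trans (cols≤∑ (∁ A) 0 Λ) (≤-reflexive (sym (∑-card-⊗ (els U Γ) (upTo Λ) ⟪ (λ u → ¬? (dec A (a₀ ⊞ offset u))) ⟫)))

  module _ (Λ Q : ℕ) (low : Λ + Q ≤ suc Y) where

    outside : Sub (G × ℕ)
    outside = ⟪ (λ u → ¬? (dec A (pos (proj₁ u) (Λ + proj₂ u)))) ⟫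

    candidates : List (G × ℕ)
    candidates = els (cells Q) outside

    candidates-many : N * Q ≤ length candidates + n
    candidates-many = ≤-trans (≤-reflexive (sym (trans (length-⊗ (els U Γ) (upTo Q)) (cong (N *_) (length-upTo Q)))))
        (≤-trans (card-∁ (cells Q) within) (≤-trans (≤-reflexive (+-comm _ (length candidates)))
          (+-monoʳ-≤ (length candidates) (≤-trans (≤-reflexive (∑-card-⊗ (els U Γ) (upTo Q) within)) (≤-trans (∑≤cols A Λ Q low) (mono (A ⋂ Cols Λ Q) A λ _ → proj₁))))))
      where
      within : Sub (G × ℕ)
      within = ⟪ (λ u → dec A (pos (proj₁ u) (Λ + proj₂ u))) ⟫

    hits : ℕ → G × ℕ → ℕ
    hits Λ′ u = card (offsets Λ′) ⟪ (λ u′ → dec A (pos (proj₁ u) (Λ + proj₂ u) ⊞ offset u′)) ⟫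

    -- The same average over cells outside `A`: a shift u that moves c into `A` exhibits c + u as a
    -- loss under -u, and δ is symmetric.
    outer-base : ∀ Λ′ → 1 ≤ length candidates → Σ G λ γ → Σ ℕ λ t → Γ ∋ γ × t < Q × (length candidates * hits Λ′ (γ , t) ≤ N * Λ′ * cost Λ′)
    outer-base Λ′ 1≤c = let (γ , t) , u∈ , avg = average candidates (hits Λ′) 1≤c
                            Γγ , t< = cells-∈ Q (proj₁ (els-∈ (cells Q) outside u∈))
                        in γ , t , Γγ , t< , ≤-trans avg total
      where
      place : G × ℕ → G
      place u = pos (proj₁ u) (Λ + proj₂ u)
      few-hits : ∀ u′ → card candidates ⟪ (λ u → dec A (place u ⊞ offset u′)) ⟫ ≤ δ A (offset u′)
      few-hits u′ = ≤-trans (card-inj ⟪ (λ u → dec A (place u ⊞ offset u′)) ⟫ (lost A (⊟ offset u′)) (els-unique outside (cells-unique Q)) R tot inj) (δ-⊟ A (offset u′))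
        where
        R : G × ℕ → G → Set
        R u x = (u ∈ cells Q) × place u ⊞ offset u′ ≡ x
        tot : ∀ u → u ∈ candidates → A ∋ place u ⊞ offset u′ → Σ G λ x → x ∈ U × (lost A (⊟ offset u′) ∋ x) × R u x
        tot u u∈ q = let u∈Q , out = els-∈ (cells Q) outside u∈ in place u ⊞ offset u′ , U-full _ , (q , λ q′ → out (subst (A ∋_) (⊞-⊖ (place u) (offset u′)) q′)) , u∈Q , refl
        inj : ∀ u v x → A ∋ place u ⊞ offset u′ → A ∋ place v ⊞ offset u′ → R u x → R v x → u ≡ v
        inj (γ , t) (γ′ , t′) x _ _ (u∈ , e) (v∈ , e′) =
          let Γγ , t< = cells-∈ Q u∈
              Γγ′ , t′< = cells-∈ Q v∈
              q = pos-unique (bound t<) (bound t′<) Γγ Γγ′ (cancelʳ (offset u′) _ _ (trans e (sym e′)))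
          in cong₂ _,_ (cong proj₁ q) (+-cancelˡ-≡ Λ t t′ (cong proj₂ q))
          where
          bound : ∀ {t} → t < Q → Λ + t ≤ Y
          bound t< = s≤s⁻¹ (≤-trans (+-monoʳ-< Λ t<) low)
      total : ∑ candidates (hits Λ′) ≤ N * Λ′ * cost Λ′
      total = ≤-trans (≤-reflexive (∑-card-swap candidates (offsets Λ′) (λ u u′ → dec A (place u ⊞ offset u′)))) (∑-offsets Λ′ _ few-hits)

    -- Seen from the chosen cell, the column of γ starts at γ - γ₁, which is on a column again up to
    -- `r` steps. Beginning the zone `r` cells higher keeps the index natural, and lengthening the
    -- offsets by 2r covers every displacement.
    outer-total : ∀ γ₁ t₁ → Γ ∋ γ₁ → ⌊ A ⋂ Cols (Λ + t₁ + r) Λ ⌋ ≤ hits (Λ + 2 * r) (γ₁ , t₁)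
    outer-total γ₁ t₁ Γγ₁ = card-inj (A ⋂ Cols (Λ + t₁ + r) Λ) ⟪ (λ u → dec A (c₁ ⊞ offset u)) ⟫ U-unique (λ x u → x ≡ c₁ ⊞ offset u)
        (λ { x _ (Ax , γ , t , Γγ , l≤t , t< , e) → build x Ax γ t Γγ l≤t t< e (column-≤ (2 * T + 2 * T) (γ ⊝ γ₁) 4T≤ (D-⊖ (2 * T) (2 * T) γ γ₁ (Γ⊂D γ Γγ) (Γ⊂D γ₁ Γγ₁))) })
        (λ _ _ _ _ _ e e′ → trans e (sym e′))
      where
      c₁ : G
      c₁ = pos γ₁ (Λ + t₁)
      build : ∀ x → A ∋ x → ∀ γ t → Γ ∋ γ → Λ + t₁ + r ≤ t → t < Λ + t₁ + r + Λ → x ≡ pos γ t →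
        (Σ G λ γ′ → Σ ℕ λ e → Γ ∋ γ′ × e ≤ 2 * r × γ ⊝ γ₁ ⊞ r · b ≡ γ′ ⊞ e · b) →
        Σ (G × ℕ) λ u → (u ∈ offsets (Λ + 2 * r)) × A ∋ c₁ ⊞ offset u × x ≡ c₁ ⊞ offset u
      build x Ax γ t Γγ l≤t t< x≡ (γ′ , e , Γγ′ , e≤ , q) = (γ′ , c + e) , ∈-cells Γγ′ (+-mono-<-≤ c< e≤) , subst (A ∋_) eq Ax , eq
        where
        c : ℕ
        c = t ∸ (Λ + t₁ + r)
        t≡ : Λ + t₁ + r + c ≡ t
        t≡ = m+[n∸m]≡n l≤t
        c< : c < Λ
        c< = +-cancelˡ-< (Λ + t₁ + r) _ _ (subst (_< Λ + t₁ + r + Λ) (sym t≡) t<)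
        eq : x ≡ c₁ ⊞ (γ′ ⊞ (c + e) · b)
        eq = trans x≡ (begin
          a₀ ⊞ (γ ⊞ t · b)  ≡⟨ cong (λ s → a₀ ⊞ (γ ⊞ s)) (trans (cong (_· b) (sym t≡)) (trans (·-+ b (Λ + t₁ + r) c) (cong (_⊞ c · b) (·-+ b (Λ + t₁) r)))) ⟩
          a₀ ⊞ (γ ⊞ ((Λ + t₁) · b ⊞ r · b ⊞ c · b))  ≡⟨ cong (λ g → a₀ ⊞ (g ⊞ ((Λ + t₁) · b ⊞ r · b ⊞ c · b))) (sym (⊖-⊞ γ γ₁)) ⟩
          a₀ ⊞ (γ ⊝ γ₁ ⊞ γ₁ ⊞ ((Λ + t₁) · b ⊞ r · b ⊞ c · b))  ≡⟨ ac 6 (λ a g g₁ l r c → a ∙ ((g ∙ g₁) ∙ ((l ∙ r) ∙ c)) ⊜ (a ∙ (g₁ ∙ l)) ∙ ((g ∙ r) ∙ c)) refl a₀ (γ ⊝ γ₁) γ₁ ((Λ + t₁) · b) (r · b) (c · b) ⟩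
          c₁ ⊞ (γ ⊝ γ₁ ⊞ r · b ⊞ c · b)  ≡⟨ cong (λ g → c₁ ⊞ (g ⊞ c · b)) q ⟩
          c₁ ⊞ (γ′ ⊞ e · b ⊞ c · b)  ≡⟨ cong (c₁ ⊞_) (trans (assoc γ′ _ _) (cong (γ′ ⊞_) (trans (comm _ _) (sym (·-+ b c e))))) ⟩
          c₁ ⊞ (γ′ ⊞ (c + e) · b)  ∎)
          where open ≡-Reasoning

quotient : ∀ d k .⦃ _ : NonZero d ⦄ → Σ ℕ λ q → d * q ≤ k × k < d * suc q
quotient d k = k / d , ≤-trans (≤-reflexive (*-comm d (k / d))) (m/n*n≤m k d) ,
  ≤-trans (s≤s (≤-reflexive (m≡m%n+[m/n]*n k d))) (≤-trans (+-monoˡ-≤ _ (m%n<n k d)) (≤-reflexive (trans (cong (d +_) (*-comm (k / d) d)) (sym (*-suc d (k / d))))))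

module Assembly {𝔾 : PrimeGroup} {A : Sub (PrimeGroup.G 𝔾)} {k : ℕ} {small : Small 𝔾 A k} (system : ColumnSystem small)
  (B : Sub (PrimeGroup.G 𝔾)) (|B|≡k : card (PrimeGroup.U 𝔾) B ≡ k)
  (antisymmetric : ∀ x → B ∋ x → ¬ (B ∋ PrimeGroup.⊟_ 𝔾 x))
  (δ<k : ∀ x → B ∋ x → Groups.δ 𝔾 A x < k)
  (ℓ h : ℕ) (37≤h : 37 ≤ h) (1≤ℓ : 1 ≤ ℓ) (k<2^ℓ : k < 2 ^ ℓ) where

  open Averaging system

  I Λ : ℕ
  I = 2 * (ℓ * (2 + 2 * h * 49))
  Λ = I * r

  2≤I : 2 ≤ I
  2≤I = *-monoʳ-≤ 2 (*-mono-≤ 1≤ℓ (s≤s z≤n))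

  -- The first long inequality makes the average number of exceptions per strip small against k. The
  -- second makes the zones and margins of the columns negligible against |A|, so that many of the
  -- other cells lie outside `A`.
  impossible : 1 ≤ r → 1 ≤ n → 2400 * (N * r * (2 * T + (Λ + 2 * r) * M)) ≤ n → 2 * (N * (2 * Λ + 6 * r + 2)) ≤ n → ⊥
  impossible 1≤r 1≤n cheap roomy = choose (inner-base Λ 1≤n) (quotient 300 k) (maximum (λ Q → N * (Q + (2 * Λ + 6 * r + 1)) <? p) p start)
    where
    n<p : n < p
    n<p = ≤-<-trans (m≤m+n n _) 2|A|<
    start : N * (0 + (2 * Λ + 6 * r + 1)) < p
    start = ≤-<-trans (≤-trans (*-monoʳ-≤ N (+-monoʳ-≤ (2 * Λ + 6 * r) (s≤s z≤n))) (≤-trans (m≤n*m _ 2) roomy)) n<p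
    -- With V about k/300, every v ≤ 2V satisfies 144v ≤ 288V, below k once v is positive. `Q` is
    -- the largest height for which the columns fit.
    choose : (Σ G λ a₀ → n * misses Λ a₀ ≤ N * Λ * cost Λ) → (Σ ℕ λ V → 300 * V ≤ k × k < 300 * suc V) →
      (Σ ℕ λ Q → Q ≤ p × (N * (Q + (2 * Λ + 6 * r + 1)) < p) × (∀ j → Q < j → j ≤ p → ¬ (N * (j + (2 * Λ + 6 * r + 1)) < p))) → ⊥
    choose (a₀ , inner-avg) (V , V-small , V-large) (Q , Q≤p , Q-fits , Q-max) = located (outer-base Λ Q low (Λ + 2 * r) cand≥1)
      where
      Y : ℕ
      Y = 2 * Λ + 2 * r + Q
      reorder : ∀ N Λ r Q → N * (Q + (2 * Λ + 6 * r + 1)) ≡ N * suc (2 * Λ + 2 * r + Q + 4 * r)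
      reorder = solve-∀
      fits : Fits Y
      fits = ≤-<-trans (≤-reflexive (sym (reorder N Λ r Q))) Q-fits
      open Outer system a₀ Y fits
      low : Λ + Q ≤ suc Y
      low = ≤-trans (+-monoˡ-≤ Q (≤-trans (m≤n*m Λ 2) (m≤m+n _ (2 * r)))) (n≤1+n Y)
      Q<p : Q < p
      Q<p = ≤-<-trans (≤-trans (m≤m+n Q _) (m≤n*m _ N ⦃ >-nonZero 1≤N ⦄)) Q-fits
      p≤ : p ≤ N * (suc Q + (2 * Λ + 6 * r + 1))
      p≤ = ≮⇒≥ (Q-max (suc Q) ≤-refl Q<p)
      C : ℕ
      C = length (candidates Λ Q low)
      -- By maximality of `Q` the middle cells number at least p - n/2 > 3n/2, and at most n of them
      -- are in `A`.
      n≤2C : n ≤ 2 * C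
      n≤2C = arith n p N Λ r Q C 2|A|< p≤ (candidates-many Λ Q low) roomy
        where
        arith : ∀ n p N Λ r Q C → 2 * n < p → p ≤ N * (suc Q + (2 * Λ + 6 * r + 1)) → N * Q ≤ C + n → 2 * (N * (2 * Λ + 6 * r + 2)) ≤ n → n ≤ 2 * C
        arith n p N Λ r Q C h₁ h₂ h₃ h₄ = linear 2 (2 ⊛ h₁ ⊹ 2 ⊛ h₂ ⊹ 2 ⊛ h₃ ⊹ h₄) (solve (n ∷ p ∷ N ∷ Λ ∷ r ∷ Q ∷ C ∷ []))
      cand≥1 : 1 ≤ C
      cand≥1 = *-cancelˡ-< 2 0 C (≤-trans 1≤n n≤2C)
      c₁≤c₂ : 2 * T + Λ * M ≤ 2 * T + (Λ + 2 * r) * M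
      c₁≤c₂ = +-monoʳ-≤ (2 * T) (*-monoˡ-≤ M (m≤m+n Λ (2 * r)))
      scale : ∀ m → 300 * n * (2 * m) ≤ 300 * n * (I * suc V) → 2 * m ≤ I * suc V
      scale m = *-cancelˡ-≤ (300 * n) ⦃ m*n≢0 300 n ⦃ _ ⦄ ⦃ >-nonZero 1≤n ⦄ ⦄
      -- The constant 2400 is 8·300: the 300 comes from V, and the outer zone below uses up three
      -- factors 2, for `C` being only n/2, for the range Λ + 2r ≤ 2Λ, and for the doubled total.
      few-misses : 2 * misses Λ a₀ ≤ I * suc V
      few-misses = scale (misses Λ a₀) (arith n (misses Λ a₀) N I r (2 * T + Λ * M) (2 * T + (Λ + 2 * r) * M) k V inner-avg c₁≤c₂ cheap V-large)
        where
        arith : ∀ n m N i r x y k V → n * m ≤ N * (i * r) * (x * k) → x ≤ y → 2400 * (N * r * y) ≤ n → k < 300 * suc V → 300 * n * (2 * m) ≤ 300 * n * (i * suc V)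
        arith n m N i r x y k V h₁ h₂ h₃ h₄ = linear (n * i + 1800 * (N * i * r * k * y)) (600 ⊛ h₁ ⊹ (600 * (N * i * r * k)) ⊛ h₂ ⊹ (i * k) ⊛ h₃ ⊹ (n * i) ⊛ h₄) (solve (n ∷ m ∷ N ∷ i ∷ r ∷ x ∷ y ∷ k ∷ V ∷ []))
      located : (Σ G λ γ₁ → Σ ℕ λ t₁ → Γ ∋ γ₁ × t₁ < Q × (C * hits Λ Q low (Λ + 2 * r) (γ₁ , t₁) ≤ N * (Λ + 2 * r) * cost (Λ + 2 * r))) → ⊥
      located (γ₁ , t₁ , Γγ₁ , t₁<Q , outer-avg) =
          F.Combine.contradiction 4rN<p 1≤r h I V O 37≤h
            (F.Blocks.quiet (∁ A) 0 ℓ V (2 * h) 1≤ℓ V<2^ℓ inner-inside (≤-trans (*-monoʳ-≤ 2 (inner-total Λ)) few-misses))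
            (F.Blocks.quiet A O ℓ V (2 * h) 1≤ℓ V<2^ℓ (≤-trans (m≤m+n _ r) zones-inside) (≤-trans (*-monoʳ-≤ 2 (outer-total Λ Q low γ₁ t₁ Γγ₁)) few-hits))
            (≤-trans (m≤m+n Λ t₁) (m≤m+n _ r)) zones-inside V-small zones-small
        where
        module F = Final system a₀ Y fits B |B|≡k antisymmetric δ<k
        O H : ℕ
        O = Λ + t₁ + r
        H = hits Λ Q low (Λ + 2 * r) (γ₁ , t₁)
        few-hits : 2 * H ≤ I * suc V
        few-hits = scale H (arith n H N I r C (Λ + 2 * r) (2 * T + (Λ + 2 * r) * M) k V outer-avg n≤2C wide cheap V-large)
          where
          wide : Λ + 2 * r ≤ 2 * (I * r)
          wide = ≤-trans (+-monoʳ-≤ Λ (*-monoˡ-≤ r 2≤I)) (≤-reflexive (cong (Λ +_) (sym (+-identityʳ Λ))))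
          arith : ∀ n m N i r c q y k V → c * m ≤ N * q * (y * k) → n ≤ 2 * c → q ≤ 2 * (i * r) → 2400 * (N * r * y) ≤ n → k < 300 * suc V → 300 * n * (2 * m) ≤ 300 * n * (i * suc V)
          arith n m N i r c q y k V h₁ h₂ h₃ h₄ h₅ = linear (n * i) (1200 ⊛ h₁ ⊹ (600 * m) ⊛ h₂ ⊹ (1200 * (N * y * k)) ⊛ h₃ ⊹ (i * k) ⊛ h₄ ⊹ (n * i) ⊛ h₅) (solve (n ∷ m ∷ N ∷ i ∷ r ∷ c ∷ q ∷ y ∷ k ∷ V ∷ []))
        V<2^ℓ : V < 2 ^ ℓ
        V<2^ℓ = ≤-<-trans (≤-trans (m≤n*m V 300) V-small) k<2^ℓ
        inner-inside : Λ ≤ suc Y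
        inner-inside = ≤-trans (m≤m+n Λ Q) low
        zones-inside : O + I * r + r ≤ suc Y
        zones-inside = arith Λ t₁ r Q t₁<Q
          where
          arith : ∀ Λ t r Q → t < Q → Λ + t + r + Λ + r ≤ suc (2 * Λ + 2 * r + Q)
          arith Λ t r Q h = linear 2 h (solve (Λ ∷ t ∷ r ∷ Q ∷ []))
        zones-small : 2 * (N * (I * r)) < p
        zones-small = ≤-<-trans (≤-trans (*-monoʳ-≤ 2 (*-monoʳ-≤ N (≤-trans (m≤n*m Λ 2) (≤-trans (m≤m+n (2 * Λ) (6 * r)) (m≤m+n _ 2))))) roomy) n<p
        4rN<p : N * (4 * r) < p
        4rN<p = ≤-<-trans (≤-trans (*-monoʳ-≤ N (≤-trans (*-monoˡ-≤ r {4} {6} (s≤s (s≤s (s≤s (s≤s z≤n))))) (≤-trans (m≤n+m (6 * r) (2 * Λ)) (m≤m+n _ 2)))) (≤-trans (m≤n*m _ 2) roomy)) n<p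

-- Choice of constants

module Threshold where

  -- 18 * 54 is what base-exists and separated-step require, 9 * suc M bounds |Γ| / k, and 37 comes from finish.
  record Constants : Set where
    field
      M Tₘ s h : ℕ
      M-large  : 18 * 54 ≤ M
      s-large  : 9 * suc M ≤ 2 ^ s
      Tₘ-large : 2 * 8 ^ s ≤ Tₘ
      h-large  : 37 ≤ h

  abstract
    constants : Constants
    constants = record { M = 972 ; Tₘ = 2 * 8 ^ 14 ; s = 14 ; h = 37 ; M-large = ≤ᵇ⇒≤ 972 972 _ ; s-large = ≤ᵇ⇒≤ 8757 16384 _ ; Tₘ-large = ≤-refl ; h-large = ≤-refl }

  open Constants constants

  -- `r₀` and `ρ` are the least values that `Base` admits. `depth` adds up the levels that need
  -- `Room`, so that one inequality serves them all; ν·k bounds |Γ|. `C₂` and `C₃` answer the two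
  -- size conditions of `impossible`, with the factor k·ℓ taken out.
  r₀ ρ r reach depth K ν C₂ C₃ C : ℕ
  r₀ = 9 * (M + Tₘ) + 10
  ρ = 10 * r₀
  r = 2 * r₀
  reach = r₀ + r₀ * ρ
  depth = (reach * M + 3 * suc (18 * M)) + ((r₀ * M + r₀ * Tₘ + 1) + ((Tₘ + ρ * M) + M))
  K = 2 + 2 * h * 49
  ν = 9 * suc M
  C₂ = 2400 * (ν * r * (2 * Tₘ + (2 * K * r + 2 * r) * M))
  C₃ = 2 * (ν * (4 * K * r + 6 * r + 2))
  C = 3 * depth + (C₂ + C₃)

  module Main (𝔾 : PrimeGroup) (A B : Sub (PrimeGroup.G 𝔾)) (ℓ : ℕ) where

    open Groups 𝔾

    private
      k : ℕ
      k = ⌊ B ⌋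

    antisymmetric⇒𝟘∉ : (∀ x → B ∋ x → ¬ (B ∋ (⊟ x))) → ¬ (B ∋ 𝟘)
    antisymmetric⇒𝟘∉ anti q = anti 𝟘 q (subst (B ∋_) (trans (sym (inverseʳ 𝟘)) (identityˡ (⊟ 𝟘))) q)

    -- The level set contains `B` and also 0, which antisymmetry keeps out of `B`; this one extra
    -- element makes the inequality strict and offsets the loss of 1 in each use of
    -- Cauchy-Davenport.
    smallness : 1 ≤ k → 2 * ⌊ A ⌋ < p → (∀ x → B ∋ x → ¬ (B ∋ (⊟ x))) → (∀ x → B ∋ x → δ A x < k) → Small 𝔾 A k
    smallness 1≤k 2A<p anti δ<k = record { 1≤k = 1≤k ; 2|A|< = 2A<p ; k<D = strict B (level A k) 𝟘 (λ x q → <⇒≤ (δ<k x q)) (≤-trans (≤-reflexive (δ-𝟘 A)) z≤n) (antisymmetric⇒𝟘∉ anti) }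

    module _ (1≤k : 1 ≤ k) (2A<p : 2 * ⌊ A ⌋ < p) (anti : ∀ x → B ∋ x → ¬ (B ∋ (⊟ x))) (δ<k : ∀ x → B ∋ x → δ A x < k)
      (1≤ℓ : 1 ≤ ℓ) (k<2^ℓ : k < 2 ^ ℓ) (large : C * (k * ℓ) ≤ ⌊ A ⌋) where

      small : Small 𝔾 A k
      small = smallness 1≤k 2A<p anti δ<k

      open Structure small using (Room; mkRoom; room-mono; Separated; D; D-𝟘; separated; base-exists)

      room : Room depth
      room = mkRoom (≤-trans (arith depth (C₂ + C₃) k ℓ 1≤ℓ) large)
        where
        arith : ∀ d c k ℓ → 1 ≤ ℓ → 3 * (d * k) ≤ (3 * d + c) * (k * ℓ)
        arith d c k ℓ h = linear (c * k * ℓ) ((3 * d * k) ⊛ h) (solve (d ∷ c ∷ k ∷ ℓ ∷ []))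

      2≤M : 2 ≤ M
      2≤M = ≤-trans (s≤s (s≤s z≤n)) M-large

      M≤depth : M ≤ depth
      M≤depth = ≤-trans (m≤n+m M (Tₘ + ρ * M)) (≤-trans (m≤n+m _ (r₀ * M + r₀ * Tₘ + 1)) (m≤n+m _ (reach * M + 3 * suc (18 * M))))

      1≤n : 1 ≤ ⌊ A ⌋
      1≤n = Structure.1≤n small (≤-trans (s≤s z≤n) 2≤M) (room-mono M≤depth room)

      54<p : 54 < p
      54<p = ≤-<-trans (≤-trans (≤-trans (m≤m+n 54 (17 * 54)) M-large) (≤-trans M≤n (m≤m+n ⌊ A ⌋ _))) 2A<p
        where
        M≤n : M ≤ ⌊ A ⌋
        M≤n = ≤-trans (≤-trans (m≤m*n M k ⦃ >-nonZero 1≤k ⦄) (m≤n*m (M * k) 3)) (Structure.Room.3Tk≤n (room-mono M≤depth room))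

      module _ (b : G) (b∈D : D M ∋ b) (sep₅₄ : Separated b 54) where

        base : Base small
        base = record
          { M = M ; Tₘ = Tₘ ; r₀ = r₀ ; ρ = ρ ; b = b ; b∈D = b∈D
          ; b-sep = separated M b b∈D sep₅₄ reach (room-mono (m≤m+n _ _) room)
          ; r₀-large = ≤-refl ; ρ-large = ≤-refl
          ; room = room-mono (≤-trans (m≤m+n _ _) (m≤n+m _ (reach * M + 3 * suc (18 * M)))) room
          ; room′ = room-mono (≤-trans (m≤m+n (Tₘ + ρ * M) M) (≤-trans (m≤n+m _ (r₀ * M + r₀ * Tₘ + 1)) (m≤n+m _ (reach * M + 3 * suc (18 * M))))) room }

        open Tops base using (Γ; Γ⊂D; Γ-unique; Γ-bound; top; Stable; stability; stable-exists; sep-ρ; 1≤r₀; 2r₀≤ρ)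

        module _ (T : ℕ) (1≤T : 1 ≤ T) (16T≤ : 8 * T + 8 * T ≤ Tₘ) (st : Stable T) where

          2T+2T≤ : 2 * T + 2 * T ≤ Tₘ
          2T+2T≤ = ≤-trans (+-mono-≤ (*-monoˡ-≤ T {2} {8} (s≤s (s≤s z≤n))) (*-monoˡ-≤ T {2} {8} (s≤s (s≤s z≤n)))) 16T≤

          origin : Σ ℕ λ i → i < r₀ × (Γ (2 * T) ∋ 𝟘 ⊞ i · b)
          origin = top (2 * T) 𝟘 2T+2T≤ (D-𝟘 (2 * T))

          system : ColumnSystem small
          system = record
            { M = M ; T = T ; r = r ; ρ = ρ ; b = b ; Γ = Γ (2 * T)
            ; b≢𝟘 = λ e → sep-ρ 1 ≤-refl (≤-trans 1≤r₀ (≤-trans (m≤m+n r₀ r₀) 2r₀≤ρ)) (subst (D 2 ∋_) (sym (trans (identityʳ b) e)) (D-𝟘 2))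
            ; b∈D = b∈D ; Γ⊂D = Γ⊂D (2 * T) ; Γ-unique = Γ-unique (2 * T)
            ; γ₀ = 𝟘 ⊞ proj₁ origin · b ; γ₀∈Γ = proj₂ (proj₂ origin) ; 1≤T = 1≤T
            ; ρ-large = arith r₀ 1≤r₀ ; column = stability T 16T≤ st }
            where
            arith : ∀ r → 1 ≤ r → 4 * (2 * r) + 2 ≤ 10 * r
            arith r h = linear 0 (2 ⊛ h) (solve (r ∷ []))

          N≤ : ⌊ Γ (2 * T) ⌋ ≤ ν * k
          N≤ = ≤-trans (Γ-bound (2 * T) (≤-trans 1≤T (m≤n*m T 2)) (≤-trans (m≤m+n _ _) 2T+2T≤)) (≤-reflexive (sym (*-assoc 9 (suc M) k)))

          T≤ : T ≤ Tₘ
          T≤ = ≤-trans (≤-trans (m≤n*m T 8) (m≤m+n (8 * T) _)) 16T≤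

          module As = Assembly system B refl anti δ<k ℓ h h-large 1≤ℓ k<2^ℓ

          cheap : 2400 * (⌊ Γ (2 * T) ⌋ * r * (2 * T + (As.Λ + 2 * r) * M)) ≤ ⌊ A ⌋
          cheap = begin
              2400 * (⌊ Γ (2 * T) ⌋ * r * (2 * T + (As.Λ + 2 * r) * M))  ≤⟨ *-monoʳ-≤ 2400 (*-mono-≤ (*-monoˡ-≤ r N≤) (spread T Tₘ ℓ K r M T≤ 1≤ℓ)) ⟩
              2400 * (ν * k * r * ((2 * Tₘ + (2 * K * r + 2 * r) * M) * ℓ))  ≡⟨ regroup ν k r (2 * Tₘ + (2 * K * r + 2 * r) * M) ℓ ⟩
              C₂ * (k * ℓ)  ≤⟨ *-monoˡ-≤ (k * ℓ) (≤-trans (m≤m+n C₂ C₃) (m≤n+m _ (3 * depth))) ⟩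
              C * (k * ℓ)  ≤⟨ large ⟩
              ⌊ A ⌋  ∎
            where
            open ≤-Reasoning
            spread : ∀ T Tₘ ℓ K r M → T ≤ Tₘ → 1 ≤ ℓ → 2 * T + (2 * (ℓ * K) * r + 2 * r) * M ≤ (2 * Tₘ + (2 * K * r + 2 * r) * M) * ℓ
            spread T Tₘ ℓ K r M h₁ h₂ = linear 0 (2 ⊛ h₁ ⊹ (2 * Tₘ + 2 * r * M) ⊛ h₂) (solve (T ∷ Tₘ ∷ ℓ ∷ K ∷ r ∷ M ∷ []))
            regroup : ∀ ν k r c ℓ → 2400 * (ν * k * r * (c * ℓ)) ≡ 2400 * (ν * r * c) * (k * ℓ)
            regroup = solve-∀

          roomy : 2 * (⌊ Γ (2 * T) ⌋ * (2 * As.Λ + 6 * r + 2)) ≤ ⌊ A ⌋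
          roomy = begin
              2 * (⌊ Γ (2 * T) ⌋ * (2 * As.Λ + 6 * r + 2))  ≤⟨ *-monoʳ-≤ 2 (*-mono-≤ N≤ (spread ℓ K r 1≤ℓ)) ⟩
              2 * (ν * k * ((4 * K * r + 6 * r + 2) * ℓ))  ≡⟨ regroup ν k (4 * K * r + 6 * r + 2) ℓ ⟩
              C₃ * (k * ℓ)  ≤⟨ *-monoˡ-≤ (k * ℓ) (≤-trans (m≤n+m C₃ C₂) (m≤n+m _ (3 * depth))) ⟩
              C * (k * ℓ)  ≤⟨ large ⟩
              ⌊ A ⌋  ∎
            where
            open ≤-Reasoning
            spread : ∀ ℓ K r → 1 ≤ ℓ → 2 * (2 * (ℓ * K) * r) + 6 * r + 2 ≤ (4 * K * r + 6 * r + 2) * ℓ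
            spread ℓ K r h = linear 0 ((6 * r + 2) ⊛ h) (solve (ℓ ∷ K ∷ r ∷ []))
            regroup : ∀ ν k c ℓ → 2 * (ν * k * (c * ℓ)) ≡ 2 * (ν * c) * (k * ℓ)
            regroup = solve-∀

          absurd : ⊥
          absurd = As.impossible (≤-trans 1≤r₀ (m≤n*m r₀ 2)) 1≤n cheap roomy

        absurd-base : ⊥
        absurd-base = let T , 1≤T , 16T≤ , st = stable-exists s s-large Tₘ-large in absurd T 1≤T 16T≤ st

      no-small-increments : ⊥
      no-small-increments = let b , b∈D , sep = base-exists 54 M M-large 2≤M 54<p (room-mono M≤depth room) in absurd-base b b∈D sep

  1≤C : 1 ≤ C
  1≤C = ≤-trans (≤-trans (≤-trans (m≤n+m 1 (r₀ * M + r₀ * Tₘ)) (≤-trans (m≤m+n _ _) (m≤n+m _ (reach * M + 3 * suc (18 * M))))) (m≤n*m depth 3)) (m≤m+n (3 * depth) (C₂ + C₃))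

open Threshold using (C; 1≤C; module Main)

-- The cyclic group

module Cyclic (p : ℕ) .⦃ p≢0 : NonZero p ⦄ (prime : Prime p) where

  toℕ-mod : ∀ m → toℕ (m mod p) ≡ m % p
  toℕ-mod m = toℕ-fromℕ< (m%n<n m p)

  %-+ˡ : ∀ a c → (a % p + c) % p ≡ (a + c) % p
  %-+ˡ a c = trans (%-distribˡ-+ (a % p) c p) (trans (cong (λ x → (x + c % p) % p) (m%n%n≡m%n a p)) (sym (%-distribˡ-+ a c p)))

  %-+ʳ : ∀ a c → (a + c % p) % p ≡ (a + c) % p
  %-+ʳ a c = trans (cong (_% p) (+-comm a (c % p))) (trans (%-+ˡ c a) (cong (_% p) (+-comm c a)))

  toℕ-⊕ : ∀ (x y : Fin p) → toℕ (x ⊕ y) ≡ (toℕ x + toℕ y) % p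
  toℕ-⊕ x y = toℕ-mod (toℕ x + toℕ y)

  ⊕-assoc : ∀ (x y z : Fin p) → (x ⊕ y) ⊕ z ≡ x ⊕ (y ⊕ z)
  ⊕-assoc x y z = toℕ-injective (begin
      toℕ ((x ⊕ y) ⊕ z)  ≡⟨ toℕ-⊕ (x ⊕ y) z ⟩
      (toℕ (x ⊕ y) + toℕ z) % p  ≡⟨ cong (λ s → (s + toℕ z) % p) (toℕ-⊕ x y) ⟩
      ((toℕ x + toℕ y) % p + toℕ z) % p  ≡⟨ %-+ˡ (toℕ x + toℕ y) (toℕ z) ⟩
      (toℕ x + toℕ y + toℕ z) % p  ≡⟨ cong (_% p) (+-assoc (toℕ x) (toℕ y) (toℕ z)) ⟩
      (toℕ x + (toℕ y + toℕ z)) % p  ≡⟨ sym (%-+ʳ (toℕ x) (toℕ y + toℕ z)) ⟩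
      (toℕ x + (toℕ y + toℕ z) % p) % p  ≡⟨ cong (λ s → (toℕ x + s) % p) (sym (toℕ-⊕ y z)) ⟩
      (toℕ x + toℕ (y ⊕ z)) % p  ≡⟨ sym (toℕ-⊕ x (y ⊕ z)) ⟩
      toℕ (x ⊕ (y ⊕ z))  ∎)
    where open ≡-Reasoning

  ⊕-comm : ∀ (x y : Fin p) → x ⊕ y ≡ y ⊕ x
  ⊕-comm x y = cong (_mod p) (+-comm (toℕ x) (toℕ y))

  0ᶠ : Fin p
  0ᶠ = 0 mod p

  0<p : 0 < p
  0<p = n≢0⇒n>0 (≢-nonZero⁻¹ p)

  toℕ-0 : toℕ 0ᶠ ≡ 0
  toℕ-0 = trans (toℕ-mod 0) (m<n⇒m%n≡m 0<p)

  ⊕-identityˡ : ∀ (x : Fin p) → 0ᶠ ⊕ x ≡ x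
  ⊕-identityˡ x = toℕ-injective (trans (toℕ-⊕ 0ᶠ x) (trans (cong (λ s → (s + toℕ x) % p) toℕ-0) (m<n⇒m%n≡m (toℕ<n x))))

  ⊕-inverseˡ : ∀ (x : Fin p) → (⊖ x) ⊕ x ≡ 0ᶠ
  ⊕-inverseˡ x = toℕ-injective (begin
      toℕ ((⊖ x) ⊕ x)  ≡⟨ toℕ-⊕ (⊖ x) x ⟩
      (toℕ (⊖ x) + toℕ x) % p  ≡⟨ cong (λ s → (s + toℕ x) % p) (toℕ-mod (p ∸ toℕ x)) ⟩
      ((p ∸ toℕ x) % p + toℕ x) % p  ≡⟨ %-+ˡ (p ∸ toℕ x) (toℕ x) ⟩
      (p ∸ toℕ x + toℕ x) % p  ≡⟨ cong (_% p) (m∸n+n≡m (<⇒≤ (toℕ<n x))) ⟩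
      p % p  ≡⟨ n%n≡0 p ⟩
      0  ≡⟨ sym toℕ-0 ⟩
      toℕ 0ᶠ  ∎)
    where open ≡-Reasoning

  ⊕-isAbelianGroup : IsAbelianGroup _≡_ (_⊕_ {p}) 0ᶠ ⊖_
  ⊕-isAbelianGroup = record
    { isGroup = record
      { isMonoid = record
        { isSemigroup = record { isMagma = record { isEquivalence = isEquivalence ; ∙-cong = cong₂ _⊕_ } ; assoc = ⊕-assoc }
        ; identity = ⊕-identityˡ , λ x → trans (⊕-comm x 0ᶠ) (⊕-identityˡ x) }
      ; inverse = ⊕-inverseˡ , λ x → trans (⊕-comm x (⊖ x)) (⊕-inverseˡ x)
      ; ⁻¹-cong = cong ⊖_ }
    ; comm = ⊕-comm }

  length-allFin : length (allFin p) ≡ p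
  length-allFin = length-tabulate {n = p} (λ i → i)

  multiple : ℕ → Fin p → Fin p
  multiple zero    x = 0ᶠ
  multiple (suc i) x = x ⊕ multiple i x

  toℕ-multiple : ∀ i x → toℕ (multiple i x) ≡ (i * toℕ x) % p
  toℕ-multiple zero    x = toℕ-mod 0
  toℕ-multiple (suc i) x = trans (toℕ-⊕ x (multiple i x)) (trans (cong (λ s → (toℕ x + s) % p) (toℕ-multiple i x)) (%-+ʳ (toℕ x) (i * toℕ x)))

  no-torsion : ∀ i x → 0 < i → i < length (allFin p) → multiple i x ≡ 0ᶠ → x ≡ 0ᶠ
  no-torsion i x 0<i i<p e = go (euclidsLemma i (toℕ x) prime (m%n≡0⇒n∣m (i * toℕ x) p (trans (sym (toℕ-multiple i x)) (trans (cong toℕ e) toℕ-0))))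
    where
    vanish : ∀ m → p ∣ m → m < p → m ≡ 0
    vanish zero    _ _ = refl
    vanish (suc m) d m<p = ⊥-elim (<⇒≱ m<p (∣⇒≤ d))
    go : (p ∣ i) ⊎ (p ∣ toℕ x) → x ≡ 0ᶠ
    go (inj₁ d) = ⊥-elim (<⇒≱ 0<i (≤-reflexive (vanish i d (≤-trans i<p (≤-reflexive length-allFin)))))
    go (inj₂ d) = toℕ-injective (trans (vanish (toℕ x) d (toℕ<n x)) (sym toℕ-0))

  cyclic : PrimeGroup
  cyclic = record
    { G = Fin p ; _⊞_ = _⊕_ ; 𝟘 = 0ᶠ ; ⊟_ = ⊖_ ; isAbelianGroup = ⊕-isAbelianGroup ; _≟ᴳ_ = _≟ᶠ_
    ; U = allFin p ; U-unique = Uniq.allFin⁺ p ; U-full = ∈-allFin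
    ; torsion-free = λ i x 0<i i<p e → no-torsion i x 0<i i<p (trans (same i x) e) }
    where
    same : ∀ i x → multiple i x ≡ _
    same zero    x = refl
    same (suc i) x = cong (x ⊕_) (same i x)

-- Boolean subsets and the final translation

⟨_⟩ : ∀ {n} → Subset n → Sub (Fin n)
⟨ S ⟩ = ⟪ (λ x → lookup S x ≟ᵇ true) ⟫

∣∣-card : ∀ {n} (S : Subset n) → ∣ S ∣ ≡ card (allFin n) ⟨ S ⟩
∣∣-card S = go S (λ i → i) ⟨ S ⟩ (λ _ q → q) (λ _ q → q)
  where
  go : ∀ {m n} (S : Subset n) (g : Fin n → Fin m) (X : Sub (Fin m)) → (∀ i → X ∋ g i → lookup S i ≡ true) → (∀ i → lookup S i ≡ true → X ∋ g i) →
    ∣ S ∣ ≡ card (tabulate g) X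
  go Vec.[]          g X to from = refl
  go (true Vec.∷ S)  g X to from = trans (cong suc (go S (λ i → g (suc i)) X (λ i → to (suc i)) (λ i → from (suc i)))) (sym (card-∷-yes _ X (from zero refl)))
  go (false Vec.∷ S) g X to from = trans (go S (λ i → g (suc i)) X (λ i → to (suc i)) (λ i → from (suc i))) (sym (card-∷-no _ X λ q → false≢true (to zero q)))
    where
    false≢true : false ≢ true
    false≢true ()

≤-foldr-⊔ : ∀ {A : Set} (f : A → ℕ) xs {x} → x ∈ xs → f x ≤ foldr _⊔_ 0 (map f xs)
≤-foldr-⊔ f (y ∷ xs) (here refl) = m≤m⊔n (f y) _
≤-foldr-⊔ f (y ∷ xs) (there x∈)  = ≤-trans (≤-foldr-⊔ f xs x∈) (m≤n⊔m (f y) _)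

module Increment (p : ℕ) .⦃ p≢0 : NonZero p ⦄ (prime : Prime p) (A B : Subset p) where

  open Cyclic p prime
  open Groups cyclic using (δ; lost; ⌊_⌋; cancelʳ; ⊞-⊖; U-unique; U-full)

  δ≤Δ : ∀ x → δ ⟨ A ⟩ x ≤ Δ A x
  δ≤Δ x = ≤-trans (card-inj (lost ⟨ A ⟩ x) ⟨ (A +ₛ x) ─ A ⟩ U-unique (λ a y → a ⊕ x ≡ y)
      (λ a _ q → a ⊕ x , U-full _ , gained a q , refl) (λ a a′ y _ _ e e′ → cancelʳ x a a′ (trans e (sym e′)))) (≤-reflexive (sym (∣∣-card ((A +ₛ x) ─ A))))
    where
    gained : ∀ a → lost ⟨ A ⟩ x ∋ a → lookup ((A +ₛ x) ─ A) (a ⊕ x) ≡ true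
    gained a (Aa , ¬Aax) = difference (A +ₛ x) A (a ⊕ x) (trans (lookup∘tabulate _ (a ⊕ x)) (trans (cong (lookup A) (⊞-⊖ a x)) Aa)) ¬Aax
      where
      difference : ∀ {n} (S R : Subset n) i → lookup S i ≡ true → ¬ (lookup R i ≡ true) → lookup (S ─ R) i ≡ true
      difference (s Vec.∷ S) (true Vec.∷ R)  zero    q ¬r = ⊥-elim (¬r refl)
      difference (s Vec.∷ S) (false Vec.∷ R) zero    q ¬r = q
      difference (s Vec.∷ S) (true Vec.∷ R)  (suc i) q ¬r = difference S R i q ¬r
      difference (s Vec.∷ S) (false Vec.∷ R) (suc i) q ¬r = difference S R i q ¬r

  Δ≤μ : ∀ x → lookup B x ≡ true → Δ A x ≤ μ A B
  Δ≤μ x q = ≤-trans (≤-reflexive (sym (cong (λ t → if t then Δ A x else 0) q))) (≤-foldr-⊔ (λ b → if lookup B b then Δ A b else 0) (allFin p) (∈-allFin x))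

  antisymmetric : Empty (B ∩ negₛ B) → ∀ x → lookup B x ≡ true → ¬ (lookup B (⊖ x) ≡ true)
  antisymmetric empty x q q′ = empty (x , x∈p∩q⁺ (lookup⇒[]= x B q , lookup⇒[]= x (negₛ B) (trans (lookup∘tabulate _ x) q′)))

  -- For 2^s ≤ |A| < 2^(s+1) the power inequality gives 2sC|B| < |A|. As |A| ≥ 2, s is at least 1
  -- and ℓ = s + 1 ≤ 2s, which is the reason for the factor 2 in the exponent.
  conclusion : 1 < ∣ A ∣ → 2 * ∣ A ∣ < p → Empty (B ∩ negₛ B) → ∣ A ∣ ^ (2 * C * ∣ B ∣) < 2 ^ (1 * ∣ A ∣) → ∣ B ∣ ≤ μ A B
  conclusion 1<A 2A<p empty hyp = go (∣ B ∣ ≤? μ A B)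
    where
    n k : ℕ
    n = ∣ A ∣
    k = ∣ B ∣
    go : Dec (k ≤ μ A B) → k ≤ μ A B
    go (yes q) = q
    go (no q)  = ⊥-elim (refute (dyadic n n (<⇒≤ 1<A) (n<2^n n)))
      where
      n<2^n : ∀ m → m < 2 ^ m
      n<2^n zero    = s≤s z≤n
      n<2^n (suc m) = ≤-trans (+-mono-≤ (m^n>0 2 m) (n<2^n m)) (≤-reflexive (cong (2 ^ m +_) (sym (+-identityʳ (2 ^ m)))))
      k≡ : ⌊ ⟨ B ⟩ ⌋ ≡ k
      k≡ = sym (∣∣-card B)
      μ<k : μ A B < k
      μ<k = ≰⇒> q
      δ<k : ∀ x → ⟨ B ⟩ ∋ x → δ ⟨ A ⟩ x < ⌊ ⟨ B ⟩ ⌋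
      δ<k x Bx = ≤-trans (≤-trans (s≤s (≤-trans (δ≤Δ x) (Δ≤μ x Bx))) μ<k) (≤-reflexive (sym k≡))
      refute : (Σ ℕ λ s → s < n × 2 ^ s ≤ n × n < 2 ^ suc s) → ⊥
      refute (zero  , _ , _ , n<2) = <⇒≱ n<2 1<A
      refute (suc s′ , _ , 2^s≤n , n<) = Main.no-small-increments cyclic ⟨ A ⟩ ⟨ B ⟩ (suc s)
          (≤-trans (≤-trans (s≤s z≤n) μ<k) (≤-reflexive (sym k≡)))
          (≤-trans (≤-trans (s≤s (≤-reflexive (cong (2 *_) (sym (∣∣-card A))))) 2A<p) (≤-reflexive (sym length-allFin)))
          (antisymmetric empty) δ<k (s≤s z≤n) (≤-<-trans (≤-trans (≤-reflexive k≡) k≤n) n<)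
          (≤-trans (≤-reflexive (cong (λ k → C * (k * suc s)) k≡)) (≤-trans large (≤-reflexive (∣∣-card A))))
        where
        s : ℕ
        s = suc s′
        exponent : s * (2 * C * k) < n
        exponent = ≰⇒> λ n≤ → <⇒≱ hyp (begin
            2 ^ (1 * n)  ≡⟨ cong (2 ^_) (*-identityˡ n) ⟩
            2 ^ n  ≤⟨ ^-monoʳ-≤ 2 n≤ ⟩
            2 ^ (s * (2 * C * k))  ≡⟨ sym (^-*-assoc 2 s (2 * C * k)) ⟩
            (2 ^ s) ^ (2 * C * k)  ≤⟨ ^-monoˡ-≤ (2 * C * k) 2^s≤n ⟩
            n ^ (2 * C * k)  ∎)
          where open ≤-Reasoning
        large : C * (k * suc s) ≤ n
        large = ≤-trans (arith C k s (s≤s z≤n)) (<⇒≤ exponent)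
          where
          arith : ∀ c k s → 1 ≤ s → c * (k * suc s) ≤ s * (2 * c * k)
          arith c k s h = linear 0 ((c * k) ⊛ h) (solve (c ∷ k ∷ s ∷ []))
        k≤n : k ≤ n
        k≤n = ≤-trans (≤-trans (m≤m*n k (suc s)) (m≤n*m (k * suc s) C ⦃ >-nonZero 1≤C ⦄)) large

-- The bound |B| < c|A|/ln|A| with c = (m/n) ln 2 is stated in exponentiated form, which avoids real
-- numbers. Since c may always be decreased, constants of this shape are as good as arbitrary
-- positive ones.
theorem2 : Σ ℕ λ m → Σ ℕ λ n → (1 ≤ m) × (1 ≤ n) ×
    ((p : ℕ) .{{_ : NonZero p}} → Prime p → (A B : Subset p) →
    1 < ∣ A ∣ → 2 * ∣ A ∣ < p →
    Empty (B ∩ negₛ B) →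
    ∣ A ∣ ^ (n * ∣ B ∣) < 2 ^ (m * ∣ A ∣) →
    8 * (∣ B ∣ * ∣ B ∣) < p →
    ∣ B ∣ ≤ μ A B)
theorem2 = 1 , 2 * C , ≤-refl , ≤-trans 1≤C (m≤n*m C 2) ,
  λ p prime A B 1<A 2A<p empty sparse _ → Increment.conclusion p prime A B 1<A 2A<p empty sparse
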